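{- Fix integers $n\geq 1$ and $m\geq 2$, and let $v\in\mathcal{S}_m$. Let $f^{\mathcal{O}}$ be the cube recurrence in the cylinder (defined in the context). Then the sequence $\left(f^{\mathcal{O}}_v(\epsilon_v+3t)\right)_{t\in\mathbb{N}}$ satisfies a linear recurrence: there exist Laurent polynomials $H_0,H_1,\dots,H_M$ in the variables $\mathbf{x}^{\mathcal{O}}$ with $H_0\neq 0$ and $H_M\neq 0$ such that \[ H_0 f^{\mathcal{O}}_v(\epsilon_v+3t)+H_1 f^{\mathcal{O}}_v(\epsilon_v+3(t+1))+\dots+H_M f^{\mathcal{O}}_v(\epsilon_v+3(t+M))=0 \] for all sufficiently large $t\in\mathbb{N}$.
   Context: Let $\mathbb{P}_0=\{(i,j,k)\in\mathbb{Z}^3: i+j+k=0\}$, $e_{12}=(1,-1,0)$, $e_{23}=(0,1,-1)$, $e_{31}=(-1,0,1)$. For $v=(i,j,k)$ its color $\epsilon_v\in\{0,1,2\}$ satisfies $\epsilon_v\equiv j-k\pmod 3$. The strip is $\mathcal{S}_m=\{(i,j,k)\in\mathbb{P}_0: 0\leq i\leq m\}$; its boundary vertices are those with $i=0$ or $i=m$. Let $g=ne_{23}=(0,n,-n)$. For each $v=(i,j,k)\in\mathcal{S}_m$ with $0<i<m$ introduce a variable $x_v$, subject to $x_{v+3kg}=x_v$ for all $k\in\mathbb{Z}$; $\mathbf{x}^{\mathcal{O}}$ denotes this finite family of indeterminates. The cube recurrence in the cylinder is the family of rational functions $f^{\mathcal{O}}_v(t)$ in $\mathbf{x}^{\mathcal{O}}$,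 for $v\in\mathcal{S}_m$ and integers $t\equiv\epsilon_v\pmod 3$, such that $f^{\mathcal{O}}_v(t)=1$ for boundary $v$, $f^{\mathcal{O}}_v(\epsilon_v)=x_v$ for non-boundary $v$, and for every non-boundary $v$ and $t\equiv\epsilon_v\pmod 3$, \[ f_v(t+3)f_v(t)=f_{v+e_{12}}(t+2)f_{v-e_{12}}(t+1)+f_{v+e_{23}}(t+2)f_{v-e_{23}}(t+1)+f_{v+e_{31}}(t+2)f_{v-e_{31}}(t+1) \] with $f=f^{\mathcal{O}}$. -}

module Defs where

open import Data.Nat as ℕ using (ℕ; zero; suc; _∸_)
open import Data.Integer as ℤ using (ℤ; +_; _+_; _*_; -_; _-_; ∣_∣; _≤_; _<_; 0ℤ; 1ℤ)
open import Data.Integer.DivMod using (_%ℕ_)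
open import Data.Integer.Properties using () renaming (_≟_ to _≟ℤ_)
open import Data.Vec using (Vec; zipWith; replicate; tabulate)
import Data.Vec.Properties as VecP
open import Data.Fin using (Fin; toℕ)
open import Data.List using (List; []; _∷_; map; concatMap)
open import Data.Product using (_×_; _,_; proj₁; proj₂)
open import Data.Sum using (_⊎_)
open import Data.Bool using (if_then_else_; _∧_)
open import Relation.Binary.PropositionalEquality using (_≡_)
open import Relation.Nullary using (¬_; yes; no)
open import Relation.Binary.Definitions using (DecidableEquality)

-- Laurent polynomials over ℤ in the variables x_{a,b}, a < r, b < c.
-- A monomial is an exponent matrix (integer exponents); a Laurent
-- polynomial is a finite formal sum of terms c·x^e, given as a list.
-- Two Laurent polynomials are equal iff all their coefficients agree.

Exp : ℕ → ℕ → Set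
Exp r c = Vec (Vec ℤ c) r

_≟E_ : ∀ {r c} → DecidableEquality (Exp r c)
_≟E_ = VecP.≡-dec (VecP.≡-dec _≟ℤ_)

0E : ∀ {r c} → Exp r c
0E = replicate _ (replicate _ 0ℤ)

_+E_ : ∀ {r c} → Exp r c → Exp r c → Exp r c
_+E_ = zipWith (zipWith _+_)

Laurent : ℕ → ℕ → Set
Laurent r c = List (ℤ × Exp r c)

coeff : ∀ {r c} → Laurent r c → Exp r c → ℤ
coeff [] e = 0ℤ
coeff ((a , e′) ∷ p) e with e′ ≟E e
... | yes _ = a + coeff p e
... | no _  = coeff p e

infix 4 _≈L_
_≈L_ : ∀ {r c} → Laurent r c → Laurent r c → Set
p ≈L q = ∀ e → coeff p e ≡ coeff q e

0L : ∀ {r c} → Laurent r c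
0L = []

1L : ∀ {r c} → Laurent r c
1L = (1ℤ , 0E) ∷ []

_+L_ : ∀ {r c} → Laurent r c → Laurent r c → Laurent r c
p +L q = Data.List._++_ p q

_*L_ : ∀ {r c} → Laurent r c → Laurent r c → Laurent r c
p *L q = concatMap (λ t → map (λ s → (proj₁ t * proj₁ s , proj₂ t +E proj₂ s)) q) p

-- Rational functions: fractions num/den of Laurent polynomials
-- (the fraction field of the Laurent ring = field of rational functions).
-- Equality is cross-multiplication; validity (den ≠ 0) is a separate
-- predicate imposed on the family as a hypothesis.

Frac : ℕ → ℕ → Set
Frac r c = Laurent r c × Laurent r c

ValidF : ∀ {r c} → Frac r c → Set
ValidF x = ¬ (proj₂ x ≈L 0L)

infix 4 _≈F_
_≈F_ : ∀ {r c} → Frac r c → Frac r c → Set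
(a , b) ≈F (c , d) = (a *L d) ≈L (c *L b)

_+F_ : ∀ {r c} → Frac r c → Frac r c → Frac r c
(a , b) +F (c , d) = ((a *L d) +L (c *L b)) , (b *L d)

_*F_ : ∀ {r c} → Frac r c → Frac r c → Frac r c
(a , b) *F (c , d) = (a *L c) , (b *L d)

embed : ∀ {r c} → Laurent r c → Frac r c
embed p = p , 1L

0F : ∀ {r c} → Frac r c
0F = 0L , 1L

1F : ∀ {r c} → Frac r c
1F = 1L , 1L

sumF : ∀ {r c} (k : ℕ) → (Fin k → Frac r c) → Frac r c
sumF zero f = 0F
sumF (suc k) f = f Fin.zero +F sumF k (λ i → f (Fin.suc i))
  where import Data.Fin as Fin

Vertex : Set
Vertex = ℤ × ℤ × ℤ

_+V_ : Vertex → Vertex → Vertex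
(a , b , c) +V (a′ , b′ , c′) = (a + a′) , (b + b′) , (c + c′)

_-V_ : Vertex → Vertex → Vertex
(a , b , c) -V (a′ , b′ , c′) = (a - a′) , (b - b′) , (c - c′)

e12 e23 e31 : Vertex
e12 = 1ℤ , - 1ℤ , 0ℤ
e23 = 0ℤ , 1ℤ , - 1ℤ
e31 = - 1ℤ , 0ℤ , 1ℤ

InP0 : Vertex → Set
InP0 (i , j , k) = i + j + k ≡ 0ℤ

InStrip : ℕ → Vertex → Set
InStrip m v@(i , _ , _) = InP0 v × (0ℤ ≤ i) × (i ≤ + m)

Interior : ℕ → Vertex → Set
Interior m v@(i , _ , _) = InP0 v × (0ℤ < i) × (i < + m)

Boundary : ℕ → Vertex → Set
Boundary m v@(i , _ , _) = InP0 v × ((i ≡ 0ℤ) ⊎ (i ≡ + m))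

color : Vertex → ℕ
color (_ , j , k) = (j - k) %ℕ 3

-- Variables x_v for interior v of S_m, with x_{v+3kg} = x_v, g = (0,n,-n):
-- x_{(i,j,k)} is the variable indexed by (i-1, j mod 3n), i.e. row i-1 < m-1,
-- column (j mod 3n) < 3n.  (For n ≥ 1, suc (3n ∸ 1) = 3n.)

Ring : ℕ → ℕ → Set
Ring m n = Laurent (m ∸ 1) (3 ℕ.* n)

RatFun : ℕ → ℕ → Set
RatFun m n = Frac (m ∸ 1) (3 ℕ.* n)

unitExp : ∀ {r c} → ℕ → ℕ → Exp r c
unitExp a b = tabulate (λ p → tabulate (λ q →
  if (toℕ p ℕ.≡ᵇ a) ∧ (toℕ q ℕ.≡ᵇ b) then 1ℤ else 0ℤ))

var : (m n : ℕ) → Vertex → Ring m n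
var m n (i , j , k) = (1ℤ , unitExp (∣ i ∣ ∸ 1) (j %ℕ suc (3 ℕ.* n ∸ 1))) ∷ []

-- The cube recurrence in the cylinder: a family F v t of rational
-- functions (meaningful for v ∈ S_m, t ≡ ε_v mod 3) satisfying the
-- defining conditions.

record IsCubeRecurrence (m n : ℕ) (F : Vertex → ℤ → RatFun m n) : Set where
  field
    valid    : ∀ v t → InStrip m v → t %ℕ 3 ≡ color v → ValidF (F v t)
    boundary : ∀ v t → Boundary m v → t %ℕ 3 ≡ color v → F v t ≈F 1F
    initial  : ∀ v → Interior m v → F v (+ color v) ≈F embed (var m n v)
    recur    : ∀ v t → Interior m v → t %ℕ 3 ≡ color v →
      (F v (t + + 3) *F F v t) ≈F
        ((F (v +V e12) (t + + 2) *F F (v -V e12) (t + 1ℤ))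
          +F ((F (v +V e23) (t + + 2) *F F (v -V e23) (t + 1ℤ))
          +F (F (v +V e31) (t + + 2) *F F (v -V e31) (t + 1ℤ))))

-- With v = (c - a, a - b, b - c), t = a + b + c and c = a + i, write φ i a b for f_v(t). Up to
-- signs, φ i a b is the Pfaffian τ of the principal submatrix, on the window {a, …, a + i - 1}, of
-- a skew form that evolves in b by V_{b+1} = V_b + u_b ∧ u_{b+1} (for odd i the submatrix is
-- bordered by u_b): the cube recurrence is then a Pfaffian identity, and V_0 is determined by the
-- values at b = 0. Since φ m = 1 on the right boundary, the Pfaffians on windows of length m + 1
-- vanish. This yields linear relations between the rows of V_b, with coefficients that do not depend
-- on b, so that for fixed i all functions b ↦ φ i a b lie in one finite-dimensional space over the
-- field of rational functions. By the periodicity of the cylinder, t ↦ f_v(ε_v + 3 (t + 2 n k)) is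
-- given by such functions with a depending on k and b depending only on t, hence these functions
-- are linearly dependent for k = 0, 1, …, and a dependence is a linear recurrence.
--
-- That no f_v(t) vanishes (needed to solve for V_0) follows by writing it as a quotient of Laurent
-- polynomials with positive values at (1, …, 1).

module Submission where

-- The crux is why the relations survive the evolution in b. Let X be a window of length m + 1 and Y
-- the same window without its first element. For a functional k, `D k (T b) X` pairs k with the
-- vector of signed values of `T b` on X with one element deleted. Contracting the bilinear Pfaffian
-- identity by k, and using that `T b` and `T (suc b)` vanish on X, gives `T (suc b) Y * D k (T b) X
-- ≈ T b Y * D k (T (suc b)) X`: the vectors for different b are proportional, with nonzero factors.
-- The vector at b is annihilated by the border u_b and by the rows of V_b indexed by X, so the
-- vector at b = 0 is annihilated by all of them at once. Its last coordinate does not vanish, hence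
-- the index m + a can be traded for a, ..., m + a - 1. Repeating this moves every window into the
-- first one and bounds the dimension independently of a.
--
-- Even windows carry Pfaffians, odd ones bordered Pfaffians. Their sum `τ` lets one identity serve
-- both parities, because mixed products vanish.

open import Defs
open import Algebra.Bundles using (CommutativeRing)
import Level
open import Relation.Nullary using (Dec; ¬_)
import Data.Nat.Base
import Data.Integer.Base

-- Polynomial identities with integer coefficients in a commutative ring.

module RingSolver {c ℓ} (R : CommutativeRing c ℓ) where
  open CommutativeRing R
  open import Algebra.Properties.Ring ring
  open import Algebra.Properties.AbelianGroup +-abelianGroup using (⁻¹-∙-comm)
  open import Algebra.Properties.Semiring.Mult.TCOptimised semiring using (1+×; ×-homo-+; ×1-homo-*) renaming (_×_ to _•_)
  open import Algebra.Solver.Ring.AlmostCommutativeRing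
  open import Data.Nat.Base as ℕ using (ℕ; zero; suc)
  open import Data.Integer.Base as ℤ using (ℤ; +_; -[1+_]; _⊖_)
  import Data.Integer.Properties as ℤₚ
  import Data.Nat.Properties as ℕₚ
  open import Data.Maybe.Base using (Maybe; just; nothing)
  open import Relation.Nullary using (yes; no)
  open import Relation.Binary.PropositionalEquality as ≡ using (_≡_)
  open import Relation.Binary.Reasoning.Setoid setoid

  fromℤ : ℤ → Carrier
  fromℤ (+ n)    = n • 1#
  fromℤ -[1+ n ] = - (suc n • 1#)

  private
    fromℤ-⊖ : ∀ m n → fromℤ (m ⊖ n) ≈ m • 1# - n • 1#
    fromℤ-⊖ zero    zero    = sym (-‿inverseʳ 0#)
    fromℤ-⊖ zero    (suc n) = sym (+-identityˡ _)
    fromℤ-⊖ (suc m) zero    = sym (trans (+-congˡ -0#≈0#) (+-identityʳ _))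
    fromℤ-⊖ (suc m) (suc n) = begin
      fromℤ (suc m ⊖ suc n)                  ≡⟨ ≡.cong fromℤ (ℤₚ.[1+m]⊖[1+n]≡m⊖n m n) ⟩
      fromℤ (m ⊖ n)                          ≈⟨ fromℤ-⊖ m n ⟩
      m • 1# - n • 1#                        ≈⟨ +-congˡ (sym (+-identityˡ _)) ⟩
      m • 1# + (0# - n • 1#)                 ≈⟨ +-congˡ (+-congʳ (sym (-‿inverseʳ 1#))) ⟩
      m • 1# + ((1# - 1#) - n • 1#)          ≈⟨ +-congˡ (+-assoc _ _ _) ⟩
      m • 1# + (1# + (- 1# - n • 1#))        ≈⟨ +-assoc _ _ _ ⟨
      (m • 1# + 1#) + (- 1# - n • 1#)        ≈⟨ +-cong (+-comm _ _) (⁻¹-∙-comm _ _) ⟩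
      (1# + m • 1#) - (1# + n • 1#)          ≈⟨ +-cong (1+× m 1#) (-‿cong (1+× n 1#)) ⟨
      suc m • 1# - suc n • 1#                ∎

    fromℤ-+ : ∀ i j → fromℤ (i ℤ.+ j) ≈ fromℤ i + fromℤ j
    fromℤ-+ (+ m)    (+ n)    = ×-homo-+ 1# m n
    fromℤ-+ (+ m)    -[1+ n ] = fromℤ-⊖ m (suc n)
    fromℤ-+ -[1+ m ] (+ n)    = trans (fromℤ-⊖ n (suc m)) (+-comm _ _)
    fromℤ-+ -[1+ m ] -[1+ n ] = begin
      - (suc (suc (m ℕ.+ n)) • 1#)           ≡⟨ ≡.cong (λ k → - (suc k • 1#)) (≡.sym (ℕₚ.+-suc m n)) ⟩
      - ((suc m ℕ.+ suc n) • 1#)             ≈⟨ -‿cong (×-homo-+ 1# (suc m) (suc n)) ⟩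
      - (suc m • 1# + suc n • 1#)            ≈⟨ ⁻¹-∙-comm _ _ ⟨
      - (suc m • 1#) - suc n • 1#            ∎

    fromℤ-neg : ∀ i → fromℤ (ℤ.- i) ≈ - fromℤ i
    fromℤ-neg (+ zero)  = sym -0#≈0#
    fromℤ-neg (+ suc n) = refl
    fromℤ-neg -[1+ n ]  = sym (-‿involutive _)

    fromℤ-+* : ∀ m j → fromℤ (+ m ℤ.* j) ≈ (m • 1#) * fromℤ j
    fromℤ-+* m (+ n) = begin
      fromℤ (+ m ℤ.* + n)   ≡⟨ ≡.cong fromℤ (≡.sym (ℤₚ.pos-* m n)) ⟩
      (m ℕ.* n) • 1#        ≈⟨ ×1-homo-* m n ⟩
      (m • 1#) * (n • 1#)   ∎
    fromℤ-+* m -[1+ n ] = begin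
      fromℤ (+ m ℤ.* -[1+ n ])        ≡⟨ ≡.cong fromℤ (≡.sym (ℤₚ.neg-distribʳ-* (+ m) (+ suc n))) ⟩
      fromℤ (ℤ.- (+ m ℤ.* + suc n))   ≈⟨ fromℤ-neg (+ m ℤ.* + suc n) ⟩
      - fromℤ (+ m ℤ.* + suc n)       ≈⟨ -‿cong (fromℤ-+* m (+ suc n)) ⟩
      - ((m • 1#) * (suc n • 1#))     ≈⟨ -‿distribʳ-* _ _ ⟩
      (m • 1#) * - (suc n • 1#)       ∎

    fromℤ-* : ∀ i j → fromℤ (i ℤ.* j) ≈ fromℤ i * fromℤ j
    fromℤ-* (+ m)    j = fromℤ-+* m j
    fromℤ-* -[1+ m ] j = begin
      fromℤ (-[1+ m ] ℤ.* j)        ≡⟨ ≡.cong fromℤ (≡.sym (ℤₚ.neg-distribˡ-* (+ suc m) j)) ⟩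
      fromℤ (ℤ.- (+ suc m ℤ.* j))   ≈⟨ fromℤ-neg (+ suc m ℤ.* j) ⟩
      - fromℤ (+ suc m ℤ.* j)       ≈⟨ -‿cong (fromℤ-+* (suc m) j) ⟩
      - ((suc m • 1#) * fromℤ j)    ≈⟨ -‿distribˡ-* _ _ ⟩
      fromℤ -[1+ m ] * fromℤ j      ∎

    homomorphism : ℤ.+-*-rawRing -Raw-AlmostCommutative⟶ fromCommutativeRing R
    homomorphism = record
      { ⟦_⟧    = fromℤ
      ; +-homo = fromℤ-+
      ; *-homo = fromℤ-*
      ; -‿homo = fromℤ-neg
      ; 0-homo = refl
      ; 1-homo = refl
      }

    -- Coefficients are taken in ℤ because equality can be decided there, while equality in `R` is
    -- arbitrary.
    coeff≟ : ∀ i j → Maybe (fromℤ i ≈ fromℤ j)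
    coeff≟ i j with i ℤₚ.≟ j
    ... | yes ≡.refl = just refl
    ... | no _       = nothing

  open import Algebra.Solver.Ring ℤ.+-*-rawRing (fromCommutativeRing R) homomorphism coeff≟ public
    using (solve; _:=_; _:+_; _:*_; _:-_; :-_; con; Polynomial)

  :1 :0 : ∀ {n} → Polynomial n
  :1 = con (+ 1)
  :0 = con (+ 0)

-- Contraction by a functional of lists, read as wedge products of basis vectors.

module Contraction {c ℓ} (R : CommutativeRing c ℓ) (I : Set) where
  open CommutativeRing R
  open RingSolver R
  open import Data.List.Base using (List; []; _∷_; _++_; length)
  open import Data.List.Properties using (++-identityʳ)
  open import Data.List.Membership.Propositional using (_∈_)
  open import Data.List.Relation.Binary.Subset.Propositional using (_⊆_)
  open import Data.List.Relation.Unary.Any using (here; there)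
  open import Data.Bool.Base using (Bool; false; not)
  import Data.Bool.Properties as Bool
  open import Data.Nat.Base using (ℕ; zero; suc)
  import Data.Nat.Properties as ℕ
  open import Data.Product.Base using (∃; _×_; _,_; proj₁; proj₂)
  open import Relation.Binary.PropositionalEquality as ≡ using (_≡_)
  open import Relation.Binary.Reasoning.Setoid setoid

  -- D k g L = Σₚ (-1)ᵖ k(Lₚ) g(L with position p deleted)
  D : (I → Carrier) → (List I → Carrier) → List I → Carrier
  D k g []      = 0#
  D k g (x ∷ L) = k x * g L - D k (λ M → g (x ∷ M)) L

  -- The pairs (x, M) are those which occur in a summand `k x * g M` of `D k g L`.
  data Deletion (x : I) : List I → List I → Set where
    here  : ∀ {L} → Deletion x L (x ∷ L)
    there : ∀ {y M L} → Deletion x M L → Deletion x (y ∷ M) (y ∷ L)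

  private variable
    k l : I → Carrier
    g h : List I → Carrier

  sub-cong : ∀ {x y z w} → x ≈ y → z ≈ w → x - z ≈ y - w
  sub-cong p q = +-cong p (-‿cong q)

  -- Only the pairs which occur in the sum are compared. This lets inductions on the length of a
  -- list pass through `D`, since each such M is shorter than L.
  D-cong′ : ∀ L → (∀ {x M} → Deletion x M L → k x ≈ l x × g M ≈ h M) → D k g L ≈ D l h L
  D-cong′ []      p = refl
  D-cong′ (x ∷ L) p = sub-cong (*-cong (proj₁ (p here)) (proj₂ (p here)))
    (D-cong′ L λ d → proj₁ (p (there d)) , proj₂ (p (there d)))

  D-cong : ∀ L → (∀ x → k x ≈ l x) → (∀ M → g M ≈ h M) → D k g L ≈ D l h L
  D-cong L p q = D-cong′ L λ {x} {M} _ → p x , q M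

  D-congˡ : ∀ L → (∀ x → k x ≈ l x) → D k g L ≈ D l g L
  D-congˡ L p = D-cong L p λ _ → refl

  D-congʳ : ∀ L → (∀ M → g M ≈ h M) → D k g L ≈ D k h L
  D-congʳ L q = D-cong L (λ _ → refl) q

  Deletion⇒∈ : ∀ {x M L} → Deletion x M L → x ∈ L
  Deletion⇒∈ here      = here ≡.refl
  Deletion⇒∈ (there d) = there (Deletion⇒∈ d)

  Deletion⇒⊆ : ∀ {x M L} → Deletion x M L → M ⊆ L
  Deletion⇒⊆ here      e           = there e
  Deletion⇒⊆ (there d) (here e)    = here e
  Deletion⇒⊆ (there d) (there e)   = there (Deletion⇒⊆ d e)

  ∈⇒Deletion : ∀ {x L} → x ∈ L → ∃ λ M → Deletion x M L
  ∈⇒Deletion {L = _ ∷ L} (here ≡.refl) = L , here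
  ∈⇒Deletion {L = y ∷ _} (there e)     = let M , d = ∈⇒Deletion e in y ∷ M , there d

  D-zeroˡ : ∀ L → (∀ {x M} → Deletion x M L → k x ≈ 0#) → D k g L ≈ 0#
  D-zeroˡ []      p = refl
  D-zeroˡ (x ∷ L) p = trans (sub-cong (trans (*-congʳ (p here)) (zeroˡ _)) (D-zeroˡ L (λ d → p (there d)))) (-‿inverseʳ 0#)

  D-zeroʳ : ∀ L → (∀ M → g M ≈ 0#) → D k g L ≈ 0#
  D-zeroʳ []      q = refl
  D-zeroʳ (x ∷ L) q = trans (sub-cong (trans (*-congˡ (q L)) (zeroʳ _)) (D-zeroʳ L λ M → q (x ∷ M))) (-‿inverseʳ 0#)

  D-linearˡ : ∀ a b k l g L → D (λ x → a * k x + b * l x) g L ≈ a * D k g L + b * D l g L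
  D-linearˡ a b k l g []      = solve 2 (λ a b → :0 := a :* :0 :+ b :* :0) refl a b
  D-linearˡ a b k l g (x ∷ L) = trans (+-congˡ (-‿cong (D-linearˡ a b k l _ L)))
    (solve 7 (λ a b k l g d e →
      (a :* k :+ b :* l) :* g :- (a :* d :+ b :* e) := a :* (k :* g :- d) :+ b :* (l :* g :- e))
      refl a b _ _ _ _ _)

  D-linearʳ : ∀ a b k g h L → D k (λ M → a * g M + b * h M) L ≈ a * D k g L + b * D k h L
  D-linearʳ a b k g h []      = solve 2 (λ a b → :0 := a :* :0 :+ b :* :0) refl a b
  D-linearʳ a b k g h (x ∷ L) = trans (+-congˡ (-‿cong (D-linearʳ a b k _ _ L)))
    (solve 7 (λ a b k g h d e →
      k :* (a :* g :+ b :* h) :- (a :* d :+ b :* e) := a :* (k :* g :- d) :+ b :* (k :* h :- e))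
      refl a b _ _ _ _ _)

  D-+ʳ : ∀ k g h L → D k (λ M → g M + h M) L ≈ D k g L + D k h L
  D-+ʳ k g h L = begin
    D k (λ M → g M + h M) L               ≈⟨ D-congʳ L (λ M → +-cong (*-identityˡ _) (*-identityˡ _)) ⟨
    D k (λ M → 1# * g M + 1# * h M) L     ≈⟨ D-linearʳ 1# 1# k g h L ⟩
    1# * D k g L + 1# * D k h L           ≈⟨ +-cong (*-identityˡ _) (*-identityˡ _) ⟩
    D k g L + D k h L                     ∎

  D-*ʳ : ∀ k a g L → D k (λ M → a * g M) L ≈ a * D k g L
  D-*ʳ k a g L = begin
    D k (λ M → a * g M) L              ≈⟨ D-congʳ L (λ M → solve 2 (λ a b → a :* b := a :* b :+ :0 :* b) refl _ _) ⟩
    D k (λ M → a * g M + 0# * g M) L   ≈⟨ D-linearʳ a 0# k g g L ⟩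
    a * D k g L + 0# * D k g L         ≈⟨ solve 2 (λ a b → a :* b :+ :0 :* b := a :* b) refl _ _ ⟩
    a * D k g L                        ∎

  D-*-ʳ : ∀ k a g h L → D k (λ M → a * g M - h M) L ≈ a * D k g L - D k h L
  D-*-ʳ k a g h L = begin
    D k (λ M → a * g M - h M) L           ≈⟨ D-congʳ L (λ M → solve 3 (λ a g h → a :* g :- h := a :* g :+ :- :1 :* h) refl _ _ _) ⟩
    D k (λ M → a * g M + - 1# * h M) L    ≈⟨ D-linearʳ a (- 1#) k g h L ⟩
    a * D k g L + - 1# * D k h L          ≈⟨ solve 3 (λ a g h → a :* g :+ :- :1 :* h := a :* g :- h) refl _ _ _ ⟩
    a * D k g L - D k h L                 ∎

  D-*-ˡ : ∀ a k l g L → D (λ x → a * k x - l x) g L ≈ a * D k g L - D l g L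
  D-*-ˡ a k l g L = begin
    D (λ x → a * k x - l x) g L           ≈⟨ D-congˡ L (λ x → solve 3 (λ a g h → a :* g :- h := a :* g :+ :- :1 :* h) refl _ _ _) ⟩
    D (λ x → a * k x + - 1# * l x) g L    ≈⟨ D-linearˡ a (- 1#) k l g L ⟩
    a * D k g L + - 1# * D l g L          ≈⟨ solve 3 (λ a g h → a :* g :+ :- :1 :* h := a :* g :- h) refl _ _ _ ⟩
    a * D k g L - D l g L                 ∎

  D-negˡ : ∀ k g L → D (λ x → - k x) g L ≈ - D k g L
  D-negˡ k g []      = solve 0 (:0 := :- :0) refl
  D-negˡ k g (x ∷ L) = trans (+-congˡ (-‿cong (D-negˡ k _ L)))
    (solve 3 (λ a b c → (:- a) :* b :- (:- c) := :- (a :* b :- c)) refl _ _ _)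

  D-negʳ : ∀ k g L → D k (λ M → - g M) L ≈ - D k g L
  D-negʳ k g []      = solve 0 (:0 := :- :0) refl
  D-negʳ k g (x ∷ L) = trans (+-congˡ (-‿cong (D-negʳ k _ L)))
    (solve 3 (λ a b c → a :* (:- b) :- (:- c) := :- (a :* b :- c)) refl _ _ _)

  D-D-∷ : ∀ k l g x L →
    D k (D l g) (x ∷ L) ≈ k x * D l g L - l x * D k g L + D k (D l (λ M → g (x ∷ M))) L
  D-D-∷ k l g x L = begin
    k x * D l g L - D k (λ M → l x * g M - D l (λ N → g (x ∷ N)) M) L
      ≈⟨ +-congˡ (-‿cong (D-*-ʳ k (l x) g _ L)) ⟩
    k x * D l g L - (l x * D k g L - D k (D l (λ M → g (x ∷ M))) L)
      ≈⟨ solve 3 (λ a b c → a :- (b :- c) := a :- b :+ c) refl _ _ _ ⟩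
    k x * D l g L - l x * D k g L + D k (D l (λ M → g (x ∷ M))) L ∎

  -- Contractions by two functionals anticommute, as in the exterior algebra. In `D-D-∷` the head is
  -- removed by the outer contraction, by the inner one, or by neither; the first two cases change
  -- roles.
  D-anticomm : ∀ k l g L → D k (D l g) L ≈ - D l (D k g) L
  D-anticomm k l g []      = solve 0 (:0 := :- :0) refl
  D-anticomm k l g (x ∷ L) = begin
    D k (D l g) (x ∷ L)
      ≈⟨ D-D-∷ k l g x L ⟩
    k x * D l g L - l x * D k g L + D k (D l (λ M → g (x ∷ M))) L
      ≈⟨ +-congˡ (D-anticomm k l _ L) ⟩
    k x * D l g L - l x * D k g L - D l (D k (λ M → g (x ∷ M))) L
      ≈⟨ solve 3 (λ a b c → a :- b :- c := :- (b :- a :+ c)) refl _ _ _ ⟩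
    - (l x * D k g L - k x * D l g L + D l (D k (λ M → g (x ∷ M))) L)
      ≈⟨ -‿cong (D-D-∷ l k g x L) ⟨
    - D l (D k g) (x ∷ L) ∎

  -- Proved apart from `D-anticomm`, which yields only that twice this value is zero, and 2 may fail
  -- to be invertible in `R`.
  D-square : ∀ k g L → D k (D k g) L ≈ 0#
  D-square k g []      = refl
  D-square k g (x ∷ L) = begin
    D k (D k g) (x ∷ L)
      ≈⟨ D-D-∷ k k g x L ⟩
    k x * D k g L - k x * D k g L + D k (D k (λ M → g (x ∷ M))) L
      ≈⟨ +-congˡ (D-square k _ L) ⟩
    k x * D k g L - k x * D k g L + 0#
      ≈⟨ solve 1 (λ a → a :- a :+ :0 := :0) refl _ ⟩
    0# ∎

  -- The inner contraction over X is a linear combination of the functions `Φ x`, and `D k` is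
  -- linear in the contracted function.
  D-interchange : ∀ k (Φ : I → List I → Carrier) g X Y →
    D k (λ N → D (λ x → Φ x N) g X) Y ≈ D (λ x → D k (Φ x) Y) g X
  D-interchange k Φ g []      Y = D-zeroʳ Y λ _ → refl
  D-interchange k Φ g (x ∷ X) Y = begin
    D k (λ N → Φ x N * g X - D (λ x → Φ x N) g′ X) Y
      ≈⟨ D-congʳ Y (λ N → +-congʳ (*-comm _ _)) ⟩
    D k (λ N → g X * Φ x N - D (λ x → Φ x N) g′ X) Y
      ≈⟨ D-*-ʳ k (g X) (Φ x) _ Y ⟩
    g X * D k (Φ x) Y - D k (λ N → D (λ x → Φ x N) g′ X) Y
      ≈⟨ sub-cong (*-comm _ _) (D-interchange k Φ g′ X Y) ⟩
    D k (Φ x) Y * g X - D (λ x → D k (Φ x) Y) g′ X ∎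
    where g′ = λ M → g (x ∷ M)

  -- Both sides are the double sum of `± A x y` times g on X without x times h on Y without y.
  D-transpose : ∀ (A : I → I → Carrier) g h X Y →
    D (λ x → D (A x) h Y) g X ≈ D (λ y → D (λ x → A x y) g X) h Y
  D-transpose A g h []      Y = sym (D-zeroˡ Y λ _ → refl)
  D-transpose A g h (x ∷ X) Y = begin
    D (A x) h Y * g X - D (λ x → D (A x) h Y) g′ X
      ≈⟨ sub-cong (*-comm _ _) (D-transpose A g′ h X Y) ⟩
    g X * D (A x) h Y - D (λ y → D (λ x → A x y) g′ X) h Y
      ≈⟨ D-*-ˡ (g X) (A x) _ h Y ⟨
    D (λ y → g X * A x y - D (λ x → A x y) g′ X) h Y
      ≈⟨ D-congˡ Y (λ y → +-congʳ (*-comm _ _)) ⟩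
    D (λ y → A x y * g X - D (λ x → A x y) g′ X) h Y ∎
    where g′ = λ M → g (x ∷ M)

  parity : List I → Bool
  parity []      = false
  parity (_ ∷ L) = not (parity L)

  Deletion-parity : ∀ {x M L} → Deletion x M L → not (parity M) ≡ parity L
  Deletion-parity here      = ≡.refl
  Deletion-parity (there d) = ≡.cong not (Deletion-parity d)

  VanishesOn : Bool → (List I → Carrier) → Set ℓ
  VanishesOn b g = ∀ L → parity L ≡ b → g L ≈ 0#

  D-parity : ∀ {b} → VanishesOn b g → VanishesOn (not b) (D k g)
  D-parity v []      _ = refl
  D-parity {g = g} {b = b} v (x ∷ L) p = trans
    (sub-cong (trans (*-congˡ (v L q)) (zeroʳ _)) (D-parity v′ L (≡.trans q (≡.sym (Bool.not-involutive b)))))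
    (-‿inverseʳ 0#)
    where
    q : parity L ≡ b
    q = Bool.not-injective p
    v′ : VanishesOn (not b) (λ M → g (x ∷ M))
    v′ M r = v (x ∷ M) (≡.trans (≡.cong not r) (Bool.not-involutive b))

  -- The length is fixed so that the property can be proved for Pfaffians by induction on it, since
  -- `D` raises it by one. `repeat` is a separate field because 2 may fail to be invertible.
  record AlternatingAt (n : ℕ) (g : List I → Carrier) : Set ℓ where
    field
      swap   : ∀ P x y S → length (P ++ x ∷ y ∷ S) ≡ n → g (P ++ x ∷ y ∷ S) ≈ - g (P ++ y ∷ x ∷ S)
      repeat : ∀ P x S → length (P ++ x ∷ x ∷ S) ≡ n → g (P ++ x ∷ x ∷ S) ≈ 0#
  open AlternatingAt public

  Alternating : (List I → Carrier) → Set ℓ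
  Alternating g = ∀ n → AlternatingAt n g

  alternatingAt-∷ : ∀ {n} x → AlternatingAt (suc n) g → AlternatingAt n (λ L → g (x ∷ L))
  alternatingAt-∷ x alt .swap   P y z S e = alt .swap (x ∷ P) y z S (≡.cong suc e)
  alternatingAt-∷ x alt .repeat P y S e   = alt .repeat (x ∷ P) y S (≡.cong suc e)

  Deletion-length : ∀ {x M L} → Deletion x M L → suc (length M) ≡ length L
  Deletion-length here      = ≡.refl
  Deletion-length (there d) = ≡.cong suc (Deletion-length d)

  D-alternatingAt : ∀ {n} → AlternatingAt n g → AlternatingAt (suc n) (D k g)
  D-alternatingAt {g = g} {k = k} alt .swap [] x y S ≡.refl = begin
    k x * g (y ∷ S) - (k y * g (x ∷ S) - D k (λ M → g (x ∷ y ∷ M)) S)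
      ≈⟨ +-congˡ (-‿cong (+-congˡ (-‿cong (trans (D-cong′ S λ {z} {M} d →
           refl , alt .swap [] x y M (≡.cong suc (Deletion-length d))) (D-negʳ k _ S))))) ⟩
    k x * g (y ∷ S) - (k y * g (x ∷ S) - - D k (λ M → g (y ∷ x ∷ M)) S)
      ≈⟨ solve 3 (λ a b c → a :- (b :- (:- c)) := :- (b :- (a :- c))) refl _ _ _ ⟩
    - (k y * g (x ∷ S) - (k x * g (y ∷ S) - D k (λ M → g (y ∷ x ∷ M)) S)) ∎
  D-alternatingAt {g = g} {k = k} {n = suc n} alt .swap (p ∷ P) x y S e = trans
    (sub-cong (*-congˡ (alt .swap P x y S (ℕ.suc-injective e)))
              (D-alternatingAt (alternatingAt-∷ p alt) .swap P x y S (ℕ.suc-injective e)))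
    (solve 3 (λ k a b → k :* (:- a) :- (:- b) := :- (k :* a :- b)) refl _ _ _)
  D-alternatingAt {g = g} {k = k} {n = zero} alt .swap (p ∷ []) x y S ()
  D-alternatingAt {g = g} {k = k} {n = zero} alt .swap (p ∷ _ ∷ _) x y S ()
  D-alternatingAt {g = g} {k = k} alt .repeat [] x S ≡.refl = begin
    k x * g (x ∷ S) - (k x * g (x ∷ S) - D k (λ M → g (x ∷ x ∷ M)) S)
      ≈⟨ +-congˡ (-‿cong (+-congˡ (-‿cong (trans (D-cong′ S λ {z} {M} d →
           refl , alt .repeat [] x M (≡.cong suc (Deletion-length d))) (D-zeroʳ S λ _ → refl))))) ⟩
    k x * g (x ∷ S) - (k x * g (x ∷ S) - 0#)
      ≈⟨ solve 1 (λ a → a :- (a :- :0) := :0) refl _ ⟩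
    0# ∎
  D-alternatingAt {g = g} {k = k} {n = suc n} alt .repeat (p ∷ P) x S e = trans
    (sub-cong (*-congˡ (alt .repeat P x S (ℕ.suc-injective e)))
              (D-alternatingAt (alternatingAt-∷ p alt) .repeat P x S (ℕ.suc-injective e)))
    (solve 1 (λ k → k :* :0 :- :0 := :0) refl _)
  D-alternatingAt {g = g} {k = k} {n = zero} alt .repeat (p ∷ []) x S ()
  D-alternatingAt {g = g} {k = k} {n = zero} alt .repeat (p ∷ _ ∷ _) x S ()

  D-alternating : Alternating g → Alternating (D k g)
  D-alternating alt (suc n) = D-alternatingAt (alt n)
  D-alternating alt zero .swap   []      x y S ()
  D-alternating alt zero .swap   (_ ∷ _) x y S ()
  D-alternating alt zero .repeat []      x S ()
  D-alternating alt zero .repeat (_ ∷ _) x S ()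

  +-alternating : Alternating g → Alternating h → Alternating (λ L → g L + h L)
  +-alternating a b n .swap P x y S e = trans (+-cong (a n .swap P x y S e) (b n .swap P x y S e))
    (solve 2 (λ a b → :- a :+ :- b := :- (a :+ b)) refl _ _)
  +-alternating a b n .repeat P x S e = trans (+-cong (a n .repeat P x S e) (b n .repeat P x S e)) (+-identityˡ 0#)

  alternating-∷ : ∀ x → Alternating g → Alternating (λ L → g (x ∷ L))
  alternating-∷ x alt n = alternatingAt-∷ x (alt (suc n))

  sign : List I → Carrier
  sign []      = 1#
  sign (_ ∷ P) = - sign P

  sign-square : ∀ P → sign P * sign P ≈ 1#
  sign-square []      = *-identityˡ 1#
  sign-square (_ ∷ P) = trans (solve 1 (λ a → (:- a) :* (:- a) := a :* a) refl _) (sign-square P)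

  alternating-front : Alternating g → ∀ P x S → g (P ++ x ∷ S) ≈ sign P * g (x ∷ P ++ S)
  alternating-front alt []      x S = sym (*-identityˡ _)
  alternating-front {g = g} alt (p ∷ P) x S = begin
    g (p ∷ P ++ x ∷ S)              ≈⟨ alternating-front (alternating-∷ p alt) P x S ⟩
    sign P * g (p ∷ x ∷ P ++ S)     ≈⟨ *-congˡ (alt _ .swap [] p x (P ++ S) ≡.refl) ⟩
    sign P * - g (x ∷ p ∷ P ++ S)   ≈⟨ solve 2 (λ a b → a :* (:- b) := (:- a) :* b) refl _ _ ⟩
    - sign P * g (x ∷ p ∷ P ++ S)   ∎

  -- Swaps bring the front x next to its other occurrence.
  alternating-repeat : Alternating g → ∀ {x M L} → Deletion x M L → g (x ∷ L) ≈ 0#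
  alternating-repeat alt {x} (here {L}) = alt _ .repeat [] x L ≡.refl
  alternating-repeat {g = g} alt {x} (there {y} {M} {L} d) = begin
    g (x ∷ y ∷ L)   ≈⟨ alt _ .swap [] x y L ≡.refl ⟩
    - g (y ∷ x ∷ L) ≈⟨ -‿cong (alternating-repeat (alternating-∷ y alt) d) ⟩
    - 0#            ≈⟨ solve 0 (:- :0 := :0) refl ⟩
    0#              ∎

  -- The summand which deletes the last element is split off; its sign is that of the position, the
  -- length of P.
  D-snoc : ∀ k g P z → D k g (P ++ z ∷ []) ≈ D k (λ M → g (M ++ z ∷ [])) P + sign P * (k z * g P)
  D-snoc k g []      z = solve 1 (λ a → a :- :0 := :0 :+ :1 :* a) refl _
  D-snoc k g (p ∷ P) z = trans (+-congˡ (-‿cong (D-snoc k _ P z)))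
    (solve 4 (λ a b s c → a :- (b :+ s :* c) := a :- b :+ (:- s) :* c) refl _ _ _ _)

  alternating-back : Alternating g → ∀ P x → g (P ++ x ∷ []) ≈ sign P * g (x ∷ P)
  alternating-back {g = g} alt P x = trans (alternating-front alt P x [])
    (*-congˡ (reflexive (≡.cong (λ L → g (x ∷ L)) (++-identityʳ P))))

-- Pfaffians and their Plücker relations.

module Pfaffian {c ℓ} (R : CommutativeRing c ℓ) (I : Set) where
  open CommutativeRing R
  open RingSolver R
  open Contraction R I
  open import Data.List.Base using (List; []; _∷_; _++_; length)
  open import Data.List.Membership.Propositional using (_∈_)
  open import Data.List.Relation.Unary.Any using (here; there)
  open import Data.Bool.Base using (true)
  import Data.Bool.Properties as Bool
  open import Data.Nat.Base as ℕ using (ℕ; zero; suc; s≤s)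
  import Data.Nat.Properties as ℕ
  open import Data.Product.Base using (_,_)
  open import Level using (_⊔_)
  open import Relation.Binary.PropositionalEquality as ≡ using (_≡_)
  open import Relation.Binary.Reasoning.Setoid setoid

  Form : Set c
  Form = I → I → Carrier

  private
    -- Expansion along the first row recurses on lists that are not syntactic parts of the given
    -- one, hence the bound on the length. The value at a nonempty list with bound 0 is arbitrary;
    -- `pf` starts with a sufficient bound and never reaches it.
    pfUpTo : Form → ℕ → List I → Carrier
    pfUpTo A n       []      = 1#
    pfUpTo A zero    (x ∷ L) = 1#
    pfUpTo A (suc n) (x ∷ L) = D (A x) (pfUpTo A n) L

    shorter : ∀ {x M L n} → Deletion x M L → length L ℕ.≤ n → length M ℕ.≤ n
    shorter d p = ℕ.<⇒≤ (≡.subst (ℕ._≤ _) (≡.sym (Deletion-length d)) p)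

    pfUpTo-stable : ∀ A {n n′} L → length L ℕ.≤ n → length L ℕ.≤ n′ → pfUpTo A n L ≈ pfUpTo A n′ L
    pfUpTo-stable A []      _       _       = refl
    pfUpTo-stable A (x ∷ L) (s≤s p) (s≤s q) =
      D-cong′ L λ {_} {M} d → refl , pfUpTo-stable A M (shorter d p) (shorter d q)

  pf : Form → List I → Carrier
  pf A L = pfUpTo A (length L) L

  pf-∷ : ∀ A x L → pf A (x ∷ L) ≈ D (A x) (pf A) L
  pf-∷ A x L = D-cong′ L λ {_} {M} d → refl , pfUpTo-stable A M (shorter d ℕ.≤-refl) ℕ.≤-refl

  private
    pf-unique′ : ∀ A {q} → q [] ≈ 1# → (∀ x L → q (x ∷ L) ≈ D (A x) q L) →
      ∀ n L → length L ℕ.≤ n → pf A L ≈ q L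
    pf-unique′ A q[] q∷ n       []      _       = sym q[]
    pf-unique′ A {q} q[] q∷ (suc n) (x ∷ L) (s≤s p) = begin
      pf A (x ∷ L)       ≈⟨ pf-∷ A x L ⟩
      D (A x) (pf A) L   ≈⟨ D-cong′ L (λ {_} {M} d → refl , pf-unique′ A q[] q∷ n M (shorter d p)) ⟩
      D (A x) q L        ≈⟨ q∷ x L ⟨
      q (x ∷ L)          ∎

  -- The expansion along the first row determines the Pfaffian, so a closed formula is proved by
  -- checking that it satisfies this expansion.
  pf-unique : ∀ A {q} → q [] ≈ 1# → (∀ x L → q (x ∷ L) ≈ D (A x) q L) → ∀ L → pf A L ≈ q L
  pf-unique A q[] q∷ L = pf-unique′ A q[] q∷ _ L ℕ.≤-refl

  private
    pf-odd′ : ∀ A n L → length L ℕ.≤ n → parity L ≡ true → pf A L ≈ 0#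
    pf-odd′ A (suc n) (x ∷ L) (s≤s p) odd = begin
      pf A (x ∷ L)         ≈⟨ pf-∷ A x L ⟩
      D (A x) (pf A) L     ≈⟨ D-cong′ L (λ {_} {M} d → refl , pf-odd′ A n M (shorter d p) (oddDeletion d)) ⟩
      D (A x) (λ _ → 0#) L ≈⟨ D-zeroʳ L (λ _ → refl) ⟩
      0# ∎
      where
      oddDeletion : ∀ {y M} → Deletion y M L → parity M ≡ true
      oddDeletion d = Bool.not-injective (≡.trans (Deletion-parity d) (Bool.not-injective odd))

  pf-odd : ∀ A → VanishesOn true (pf A)
  pf-odd A L = pf-odd′ A _ L ℕ.≤-refl

  private
    pf-cong′ : ∀ {A A′} n L → length L ℕ.≤ n → (∀ {x y} → x ∈ L → y ∈ L → A x y ≈ A′ x y) → pf A L ≈ pf A′ L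
    pf-cong′ n               []      _       e = refl
    pf-cong′ {A} {A′} (suc n) (x ∷ L) (s≤s p) e = begin
      pf A (x ∷ L)        ≈⟨ pf-∷ A x L ⟩
      D (A x) (pf A) L    ≈⟨ D-cong′ L (λ {_} {M} d → e (here ≡.refl) (there (Deletion⇒∈ d)) ,
                               pf-cong′ n M (shorter d p) λ y z →
                                 e (there (Deletion⇒⊆ d y)) (there (Deletion⇒⊆ d z))) ⟩
      D (A′ x) (pf A′) L  ≈⟨ pf-∷ A′ x L ⟨
      pf A′ (x ∷ L)       ∎

  pf-cong : ∀ {A A′} L → (∀ {x y} → x ∈ L → y ∈ L → A x y ≈ A′ x y) → pf A L ≈ pf A′ L
  pf-cong L = pf-cong′ _ L ℕ.≤-refl

  record IsAlternatingForm (A : Form) : Set (c ⊔ ℓ) where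
    field
      antisym  : ∀ x y → A x y ≈ - A y x
      diagonal : ∀ x → A x x ≈ 0#
  open IsAlternatingForm public

  pf-∷∷ : ∀ A x y L → pf A (x ∷ y ∷ L) ≈ A x y * pf A L - D (A x) (D (A y) (pf A)) L
  pf-∷∷ A x y L = trans (pf-∷ A x (y ∷ L)) (+-congˡ (-‿cong (D-congʳ L (pf-∷ A y))))

  -- At the first two positions, expanding along both rows reduces a swap to antisymmetry and
  -- `D-anticomm`, and a repetition to the zero diagonal and `D-square`. Later positions follow by
  -- induction through one row expansion.
  pf-alternating : ∀ {A} → IsAlternatingForm A → Alternating (pf A)
  pf-alternating {A} form (suc (suc n)) .swap [] x y S _ = begin
    pf A (x ∷ y ∷ S)                                      ≈⟨ pf-∷∷ A x y S ⟩
    A x y * pf A S - D (A x) (D (A y) (pf A)) S           ≈⟨ sub-cong (*-congʳ (antisym form x y)) (D-anticomm _ _ _ S) ⟩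
    (- A y x) * pf A S - - D (A y) (D (A x) (pf A)) S     ≈⟨ solve 3 (λ a b c → (:- a) :* b :- (:- c) := :- (a :* b :- c)) refl _ _ _ ⟩
    - (A y x * pf A S - D (A y) (D (A x) (pf A)) S)       ≈⟨ -‿cong (pf-∷∷ A y x S) ⟨
    - pf A (y ∷ x ∷ S)                                    ∎
  pf-alternating {A} form (suc (suc n)) .swap (p ∷ P) x y S e = begin
    pf A (p ∷ P ++ x ∷ y ∷ S)           ≈⟨ pf-∷ A p (P ++ x ∷ y ∷ S) ⟩
    D (A p) (pf A) (P ++ x ∷ y ∷ S)     ≈⟨ D-alternatingAt (pf-alternating form n) .swap P x y S (ℕ.suc-injective e) ⟩
    - D (A p) (pf A) (P ++ y ∷ x ∷ S)   ≈⟨ -‿cong (pf-∷ A p (P ++ y ∷ x ∷ S)) ⟨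
    - pf A (p ∷ P ++ y ∷ x ∷ S)         ∎
  pf-alternating {A} form (suc (suc n)) .repeat [] x S _ = begin
    pf A (x ∷ x ∷ S)                                      ≈⟨ pf-∷∷ A x x S ⟩
    A x x * pf A S - D (A x) (D (A x) (pf A)) S           ≈⟨ sub-cong (*-congʳ (diagonal form x)) (D-square _ _ S) ⟩
    0# * pf A S - 0#                                      ≈⟨ solve 1 (λ a → :0 :* a :- :0 := :0) refl _ ⟩
    0#                                                    ∎
  pf-alternating {A} form (suc (suc n)) .repeat (p ∷ P) x S e =
    trans (pf-∷ A p (P ++ x ∷ x ∷ S))
          (D-alternatingAt (pf-alternating form n) .repeat P x S (ℕ.suc-injective e))
  pf-alternating form zero .swap   []          x y S ()
  pf-alternating form zero .swap   (_ ∷ _)     x y S ()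
  pf-alternating form zero .repeat []          x S ()
  pf-alternating form zero .repeat (_ ∷ _)     x S ()
  pf-alternating form (suc zero) .swap   []          x y S ()
  pf-alternating form (suc zero) .swap   (_ ∷ [])    x y S ()
  pf-alternating form (suc zero) .swap   (_ ∷ _ ∷ _) x y S ()
  pf-alternating form (suc zero) .repeat []          x S ()
  pf-alternating form (suc zero) .repeat (_ ∷ [])    x S ()
  pf-alternating form (suc zero) .repeat (_ ∷ _ ∷ _) x S ()

  -- Moves one element from either list to the front of the other: the left-hand side of the
  -- Grassmann–Plücker type relations for Pfaffians.
  B : (g h : List I → Carrier) → List I → List I → Carrier
  B g h X Y = D (λ x → h (x ∷ Y)) g X + D (λ y → g (y ∷ X)) h Y

  B-comm : ∀ g h X Y → B g h X Y ≈ B h g Y X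
  B-comm g h X Y = +-comm _ _

  B-congˡ : ∀ {g g′} h X Y → (∀ L → g L ≈ g′ L) → B g h X Y ≈ B g′ h X Y
  B-congˡ h X Y p = +-cong (D-congʳ X p) (D-congˡ Y λ y → p (y ∷ X))

  B-congʳ : ∀ g {h h′} X Y → (∀ L → h L ≈ h′ L) → B g h X Y ≈ B g h′ X Y
  B-congʳ g X Y p = trans (B-comm _ _ X Y) (trans (B-congˡ g Y X p) (B-comm _ _ Y X))

  B-+ʳ : ∀ g h h′ X Y → B g (λ L → h L + h′ L) X Y ≈ B g h X Y + B g h′ X Y
  B-+ʳ g h h′ X Y = begin
    D (λ x → h (x ∷ Y) + h′ (x ∷ Y)) g X + D k (λ L → h L + h′ L) Y
      ≈⟨ +-cong (D-congˡ X (λ x → +-cong (*-identityˡ _) (*-identityˡ _))) (sym (D-+ʳ k h h′ Y)) ⟨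
    D (λ x → 1# * h (x ∷ Y) + 1# * h′ (x ∷ Y)) g X + (D k h Y + D k h′ Y)
      ≈⟨ +-congʳ (D-linearˡ 1# 1# _ _ g X) ⟩
    1# * D (λ x → h (x ∷ Y)) g X + 1# * D (λ x → h′ (x ∷ Y)) g X + (D k h Y + D k h′ Y)
      ≈⟨ solve 4 (λ a b c d → :1 :* a :+ :1 :* b :+ (c :+ d) := a :+ c :+ (b :+ d)) refl _ _ _ _ ⟩
    B g h X Y + B g h′ X Y ∎
    where k = λ y → g (y ∷ X)

  B-+ˡ : ∀ g g′ h X Y → B (λ L → g L + g′ L) h X Y ≈ B g h X Y + B g′ h X Y
  B-+ˡ g g′ h X Y = begin
    B (λ L → g L + g′ L) h X Y    ≈⟨ B-comm _ _ X Y ⟩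
    B h (λ L → g L + g′ L) Y X    ≈⟨ B-+ʳ h g g′ Y X ⟩
    B h g Y X + B h g′ Y X        ≈⟨ +-cong (B-comm _ _ Y X) (B-comm _ _ Y X) ⟩
    B g h X Y + B g′ h X Y        ∎

  -- A derivation rule: contracting by k anticommutes with moving an element, except when the
  -- element moved from X is itself the one contracted. This exception contributes `h Y * D k g X`.
  B-Dʳ : ∀ k g h X Y → B g (D k h) X Y ≈ h Y * D k g X - D k (B g h X) Y
  B-Dʳ k g h X Y = begin
    D (λ x → k x * h Y - D k (λ M → h (x ∷ M)) Y) g X + D κ (D k h) Y
      ≈⟨ +-cong (D-congˡ X (λ x → +-congʳ (*-comm _ _))) (D-anticomm κ k h Y) ⟩
    D (λ x → h Y * k x - D k (λ M → h (x ∷ M)) Y) g X - D k (D κ h) Y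
      ≈⟨ +-congʳ (D-*-ˡ (h Y) k _ g X) ⟩
    h Y * D k g X - D (λ x → D k (λ M → h (x ∷ M)) Y) g X - D k (D κ h) Y
      ≈⟨ +-congʳ (+-congˡ (-‿cong (D-interchange k (λ x M → h (x ∷ M)) g X Y))) ⟨
    h Y * D k g X - D k (λ M → D (λ x → h (x ∷ M)) g X) Y - D k (D κ h) Y
      ≈⟨ solve 3 (λ a b c → a :- b :- c := a :- (b :+ c)) refl _ _ _ ⟩
    h Y * D k g X - (D k (λ M → D (λ x → h (x ∷ M)) g X) Y + D k (D κ h) Y)
      ≈⟨ +-congˡ (-‿cong (D-+ʳ k _ (D κ h) Y)) ⟨
    h Y * D k g X - D k (B g h X) Y ∎
    where κ = λ y → g (y ∷ X)

  B-Dˡ : ∀ k g h X Y → B (D k g) h X Y ≈ g X * D k h Y - D k (λ L → B g h L Y) X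
  B-Dˡ k g h X Y = begin
    B (D k g) h X Y                        ≈⟨ B-comm _ _ X Y ⟩
    B h (D k g) Y X                        ≈⟨ B-Dʳ k h g Y X ⟩
    g X * D k h Y - D k (B h g Y) X        ≈⟨ +-congˡ (-‿cong (D-congʳ X (λ L → B-comm _ _ Y L))) ⟩
    g X * D k h Y - D k (λ L → B g h L Y) X ∎

  module _ {A : Form} (form : IsAlternatingForm A) where

    private p = pf A

    -- Expanding along the moved element turns both sums into double sums over X and Y. They are
    -- transposes of each other and cancel by antisymmetry of A.
    B-pf : ∀ X Y → B p p X Y ≈ 0#
    B-pf X Y = begin
      D (λ x → p (x ∷ Y)) p X + D (λ y → p (y ∷ X)) p Y
        ≈⟨ +-cong (D-congˡ X (λ x → pf-∷ A x Y)) (D-congˡ Y (λ y → trans (pf-∷ A y X) (D-congˡ X (antisym form y)))) ⟩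
      D (λ x → D (A x) p Y) p X + D (λ y → D (λ x → - A x y) p X) p Y
        ≈⟨ +-cong (D-transpose A p p X Y) (D-congˡ Y (λ y → D-negˡ _ p X)) ⟩
      D κ p Y + D (λ y → - κ y) p Y
        ≈⟨ +-congˡ (D-negˡ κ p Y) ⟩
      D κ p Y - D κ p Y
        ≈⟨ -‿inverseʳ _ ⟩
      0# ∎
      where κ = λ y → D (λ x → A x y) p X

    B-pf-D : ∀ k X Y → B p (D k p) X Y ≈ p Y * D k p X
    B-pf-D k X Y = begin
      B p (D k p) X Y                  ≈⟨ B-Dʳ k p p X Y ⟩
      p Y * D k p X - D k (B p p X) Y  ≈⟨ +-congˡ (-‿cong (D-zeroʳ Y (B-pf X))) ⟩
      p Y * D k p X - 0#               ≈⟨ solve 1 (λ a → a :- :0 := a) refl _ ⟩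
      p Y * D k p X                    ∎

    B-D-pf : ∀ k X Y → B (D k p) p X Y ≈ p X * D k p Y
    B-D-pf k X Y = trans (B-comm _ _ X Y) (B-pf-D k Y X)

    B-pf-DD : ∀ k l X Y → B p (D k (D l p)) X Y ≈ D l p Y * D k p X - D l p X * D k p Y
    B-pf-DD k l X Y = begin
      B p (D k (D l p)) X Y
        ≈⟨ B-Dʳ k p (D l p) X Y ⟩
      D l p Y * D k p X - D k (B p (D l p) X) Y
        ≈⟨ +-congˡ (-‿cong (trans (D-congʳ Y (λ M → trans (B-pf-D l X M) (*-comm _ _))) (D-*ʳ k _ p Y))) ⟩
      D l p Y * D k p X - D l p X * D k p Y ∎

    B-D-D : ∀ k l X Y → B (D k p) (D l p) X Y ≈ p X * D k (D l p) Y - p Y * D k (D l p) X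
    B-D-D k l X Y = begin
      B (D k p) (D l p) X Y
        ≈⟨ B-Dˡ k p (D l p) X Y ⟩
      p X * D k (D l p) Y - D k (λ L → B p (D l p) L Y) X
        ≈⟨ +-congˡ (-‿cong (trans (D-congʳ X (λ L → B-pf-D l L Y)) (D-*ʳ k _ (D l p) X))) ⟩
      p X * D k (D l p) Y - p Y * D k (D l p) X ∎

    B-D-DD : ∀ k l X Y → B (D k p) (D k (D l p)) X Y ≈ D k (D l p) X * D k p Y
    B-D-DD k l X Y = begin
      B (D k p) (D k (D l p)) X Y
        ≈⟨ B-Dˡ k p _ X Y ⟩
      p X * D k (D k (D l p)) Y - D k (λ L → B p (D k (D l p)) L Y) X
        ≈⟨ sub-cong (*-congˡ (D-square k _ Y)) (D-congʳ X (λ L → trans (B-pf-DD k l L Y) (+-congˡ (-‿cong (*-comm _ _))))) ⟩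
      p X * 0# - D k (λ L → D l p Y * D k p L - D k p Y * D l p L) X
        ≈⟨ +-congˡ (-‿cong (D-*-ʳ k _ (D k p) _ X)) ⟩
      p X * 0# - (D l p Y * D k (D k p) X - D k (λ L → D k p Y * D l p L) X)
        ≈⟨ +-congˡ (-‿cong (sub-cong (*-congˡ (D-square k p X)) (D-*ʳ k _ (D l p) X))) ⟩
      p X * 0# - (D l p Y * 0# - D k p Y * D k (D l p) X)
        ≈⟨ solve 4 (λ a b c d → a :* :0 :- (b :* :0 :- c :* d) := d :* c) refl _ _ _ _ ⟩
      D k (D l p) X * D k p Y ∎

-- Bordered Pfaffians under a rank two change of the form.

module TauFunction {c ℓ} (R : CommutativeRing c ℓ) (I : Set) where
  open CommutativeRing R
  open RingSolver R
  open Contraction R I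
  open Pfaffian R I
  open import Data.List.Base using (List; _∷_)
  open import Data.List.Membership.Propositional using (_∈_)
  open import Data.Bool.Base using (true; false)
  import Data.Bool.Properties as Bool
  open import Data.Product.Base using (_×_; _,_; proj₁; proj₂)
  open import Relation.Binary.PropositionalEquality as ≡ using (_≡_)
  open import Relation.Binary.Reasoning.Setoid setoid

  -- The Pfaffian of the principal submatrix on L, bordered by u when L has odd length:
  -- only one of the two summands is nonzero.
  τ : Form → (I → Carrier) → List I → Carrier
  τ A u L = pf A L + D u (pf A) L

  τ-cong : ∀ {A A′} u L → (∀ {x y} → x ∈ L → y ∈ L → A x y ≈ A′ x y) → τ A u L ≈ τ A′ u L
  τ-cong u L e = +-cong (pf-cong L e) (D-cong′ L λ {_} {M} d →
    refl , pf-cong M λ x y → e (Deletion⇒⊆ d x) (Deletion⇒⊆ d y))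

  evolve : Form → (u v : I → Carrier) → Form
  evolve A u v x y = A x y + (u x * v y - v x * u y)

  evolve-alternating : ∀ {A} u v → IsAlternatingForm A → IsAlternatingForm (evolve A u v)
  evolve-alternating u v form .antisym x y = trans (+-congʳ (antisym form x y))
    (solve 5 (λ a b c d e → :- a :+ (b :* c :- d :* e) := :- (a :+ (e :* d :- c :* b))) refl _ _ _ _ _)
  evolve-alternating u v form .diagonal x = trans (+-congʳ (diagonal form x))
    (solve 2 (λ b c → :0 :+ (b :* c :- c :* b) := :0) refl _ _)

  τ-alternating : ∀ {A} u → IsAlternatingForm A → Alternating (τ A u)
  τ-alternating u form = +-alternating (pf-alternating form) (D-alternating (pf-alternating form))

  module _ (A : Form) (u v : I → Carrier) where
    private
      p   = pf A
      puv = D u (D v p)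
      q   = λ L → p L + puv L

    -- This is exp(u ∧ v) = 1 + u ∧ v: a second factor u ∧ v vanishes, since contractions by the
    -- same functional square to zero.
    pf-evolve : ∀ L → pf (evolve A u v) L ≈ p L + puv L
    pf-evolve = pf-unique (evolve A u v) (+-identityʳ 1#) λ x L → begin
      p (x ∷ L) + puv (x ∷ L)
        ≈⟨ +-cong (pf-∷ A x L) (D-D-∷ u v p x L) ⟩
      D (A x) p L + (u x * D v p L - v x * D u p L + D u (D v (λ M → p (x ∷ M))) L)
        ≈⟨ +-congˡ (+-congˡ (begin
             D u (D v (λ M → p (x ∷ M))) L   ≈⟨ D-congʳ L (λ M → D-congʳ M (pf-∷ A x)) ⟩
             D u (D v (D (A x) p)) L         ≈⟨ D-congʳ L (D-anticomm v (A x) p) ⟩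
             D u (λ M → - D (A x) (D v p) M) L ≈⟨ D-negʳ u _ L ⟩
             - D u (D (A x) (D v p)) L       ≈⟨ -‿cong (D-anticomm u (A x) _ L) ⟩
             - - D (A x) puv L               ≈⟨ solve 1 (λ a → :- (:- a) := a) refl _ ⟩
             D (A x) puv L                   ∎)) ⟩
      D (A x) p L + (u x * D v p L - v x * D u p L + D (A x) puv L)
        ≈⟨ solve 6 (λ a b c d e f → a :+ (b :* c :- d :* e :+ f) :=
             :1 :* (a :+ f) :+ :1 :* (b :* (c :+ :0) :+ (:- d) :* (e :+ :0))) refl _ _ _ _ _ _ ⟩
      1# * (D (A x) p L + D (A x) puv L) +
        1# * (u x * (D v p L + 0#) + - v x * (D u p L + 0#))
        ≈⟨ +-congˡ (*-congˡ (+-cong (*-congˡ (+-congˡ (vanish L))) (*-congˡ (+-congˡ (D-square u (D v p) L))))) ⟨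
      1# * (D (A x) p L + D (A x) puv L) +
        1# * (u x * (D v p L + D v puv L) + - v x * (D u p L + D u puv L))
        ≈⟨ +-cong (*-congˡ (D-+ʳ (A x) p puv L))
             (*-congˡ (+-cong (*-congˡ (D-+ʳ v p puv L)) (*-congˡ (D-+ʳ u p puv L)))) ⟨
      1# * D (A x) q L + 1# * (u x * D v q L + - v x * D u q L)
        ≈⟨ +-congˡ (*-congˡ (D-linearˡ _ _ v u q L)) ⟨
      1# * D (A x) q L + 1# * D (λ y → u x * v y + - v x * u y) q L
        ≈⟨ D-linearˡ 1# 1# (A x) _ q L ⟨
      D (λ y → 1# * A x y + 1# * (u x * v y + - v x * u y)) q L
        ≈⟨ D-congˡ L (λ y → solve 5 (λ a b c d e →
             :1 :* a :+ :1 :* (b :* c :+ (:- d) :* e) := a :+ (b :* c :- d :* e)) refl _ _ _ _ _) ⟩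
      D (evolve A u v x) q L ∎
      where
      vanish : ∀ L → D v puv L ≈ 0#
      vanish L = begin
        D v (D u (D v p)) L              ≈⟨ D-anticomm v u (D v p) L ⟩
        - D u (D v (D v p)) L            ≈⟨ -‿cong (D-zeroʳ L (D-square v p)) ⟩
        - 0#                             ≈⟨ solve 0 (:- :0 := :0) refl ⟩
        0#                               ∎

    τ-evolve : ∀ L → τ (evolve A u v) v L ≈ (p L + D v p L) + puv L
    τ-evolve L = begin
      pf (evolve A u v) L + D v (pf (evolve A u v)) L
        ≈⟨ +-cong (pf-evolve L) (trans (D-congʳ L pf-evolve) (D-+ʳ v p puv L)) ⟩
      (p L + puv L) + (D v p L + D v puv L)
        ≈⟨ +-congˡ (+-congˡ (trans (D-anticomm v u (D v p) L) (-‿cong (D-zeroʳ L (D-square v p))))) ⟩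
      (p L + puv L) + (D v p L - 0#)
        ≈⟨ solve 3 (λ a b c → (a :+ c) :+ (b :- :0) := a :+ b :+ c) refl _ _ _ ⟩
      (p L + D v p L) + puv L ∎

  -- Whichever the common parity of X and Y is, one of the two factors vanishes.
  product-vanishes : ∀ {g h} → VanishesOn true g → VanishesOn false h →
    ∀ X Y → parity X ≡ parity Y → g X * h Y ≈ 0#
  product-vanishes vg vh X Y e with parity Y in r
  ... | true  = trans (*-congʳ (vg X e)) (zeroˡ _)
  ... | false = trans (*-congˡ (vh Y r)) (zeroʳ _)

  module _ {A : Form} (form : IsAlternatingForm A) (u v : I → Carrier) where
    private
      p   = pf A
      A′  = evolve A u v
      T   = τ A u
      T′  = τ A′ v

      even : VanishesOn true p
      even = pf-odd A
      odd : ∀ k → VanishesOn false (D k p)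
      odd k = D-parity even
      even₂ : VanishesOn true (D u (D v p))
      even₂ = D-parity (odd v)

      altT  = τ-alternating u form
      altT′ = τ-alternating v (evolve-alternating u v form)

    -- With T = p + D u p and T′ = p + D v p + D u (D v p), bilinearity of `B` leaves six terms,
    -- each evaluated by the derivation rules.
    τ-bilinear : ∀ X Y → parity X ≡ parity Y → B T T′ X Y ≈ T X * T′ Y - T′ X * T Y
    τ-bilinear X Y e = begin
      B T T′ X Y
        ≈⟨ B-congʳ T X Y (τ-evolve A u v) ⟩
      B T (λ L → (p L + pv L) + puv L) X Y
        ≈⟨ B-+ˡ p pu _ X Y ⟩
      B p (λ L → (p L + pv L) + puv L) X Y + B pu (λ L → (p L + pv L) + puv L) X Y
        ≈⟨ +-cong (trans (B-+ʳ p _ puv X Y) (+-congʳ (B-+ʳ p p pv X Y)))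
                  (trans (B-+ʳ pu _ puv X Y) (+-congʳ (B-+ʳ pu p pv X Y))) ⟩
      (B p p X Y + B p pv X Y + B p puv X Y) + (B pu p X Y + B pu pv X Y + B pu puv X Y)
        ≈⟨ +-cong (+-cong (+-cong (B-pf form X Y) (B-pf-D form v X Y)) (B-pf-DD form u v X Y))
                  (+-cong (+-cong (B-D-pf form u X Y) (B-D-D form u v X Y)) (B-D-DD form u v X Y)) ⟩
      (0# + p Y * pv X + (pv Y * pu X - pv X * pu Y)) +
        (p X * pu Y + (p X * puv Y - p Y * puv X) + puv X * pu Y)
        -- The remainder split off here consists of products of a function vanishing on odd lists
        -- with one vanishing on even lists, which are zero as X and Y have equal parity.
        ≈⟨ solve 8 (λ pX puX pvX puvX pY puY pvY puvY →
             (:0 :+ pY :* pvX :+ (pvY :* puX :- pvX :* puY)) :+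
               (pX :* puY :+ (pX :* puvY :- pY :* puvX) :+ puvX :* puY) :=
             (pX :+ puX) :* ((pY :+ pvY) :+ puvY) :- ((pX :+ pvX) :+ puvX) :* (pY :+ puY) :+
               (((pY :* pvX :+ pY :* pvX) :+ (pX :* puY :+ pX :* puY)) :+
                (puvX :* puY :+ puvX :* puY) :- ((pX :* pvY :+ pY :* puX) :+ puvY :* puX)))
             refl _ _ _ _ _ _ _ _ ⟩
      (p X + pu X) * ((p Y + pv Y) + puv Y) - ((p X + pv X) + puv X) * (p Y + pu Y) +
        (((p Y * pv X + p Y * pv X) + (p X * pu Y + p X * pu Y)) +
         (puv X * pu Y + puv X * pu Y) - ((p X * pv Y + p Y * pu X) + puv Y * pu X))
        ≈⟨ +-cong (sub-cong (*-congˡ (sym (τ-evolve A u v Y))) (*-congʳ (sym (τ-evolve A u v X))))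
             (sub-cong (+-cong (+-cong (+-cong pYpvX pYpvX) (+-cong pXpuY pXpuY))
                               (+-cong puvXpuY puvXpuY))
                       (+-cong (+-cong pXpvY pYpuX) puvYpuX)) ⟩
      T X * T′ Y - T′ X * T Y + (((0# + 0#) + (0# + 0#)) + (0# + 0#) - ((0# + 0#) + 0#))
        ≈⟨ solve 1 (λ a → a :+ (((:0 :+ :0) :+ (:0 :+ :0)) :+ (:0 :+ :0) :- ((:0 :+ :0) :+ :0)) := a) refl _ ⟩
      T X * T′ Y - T′ X * T Y ∎
      where
      pu  = D u p
      pv  = D v p
      puv = D u pv
      e′  = ≡.sym e
      pYpvX   = product-vanishes even  (odd v) Y X e′
      pYpuX   = product-vanishes even  (odd u) Y X e′
      puvYpuX = product-vanishes even₂ (odd u) Y X e′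
      pXpuY   = product-vanishes even  (odd u) X Y e
      pXpvY   = product-vanishes even  (odd v) X Y e
      puvXpuY = product-vanishes even₂ (odd u) X Y e

    -- The bilinear identity for the lists x ∷ y ∷ J and J: moving an element of J in either
    -- direction creates a repetition, so only the moves of x and y survive.
    τ-cube : ∀ x y J →
      T (x ∷ y ∷ J) * T′ J - T′ (x ∷ y ∷ J) * T J ≈ T′ (x ∷ J) * T (y ∷ J) - T′ (y ∷ J) * T (x ∷ J)
    τ-cube x y J = begin
      T (x ∷ y ∷ J) * T′ J - T′ (x ∷ y ∷ J) * T J
        ≈⟨ τ-bilinear (x ∷ y ∷ J) J (Bool.not-involutive _) ⟨
      T′ (x ∷ J) * T (y ∷ J) - (T′ (y ∷ J) * T (x ∷ J) - D (λ z → T′ (z ∷ J)) _ J) +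
        D (λ z → T (z ∷ x ∷ y ∷ J)) T′ J
        ≈⟨ +-cong (+-congˡ (-‿cong (+-congˡ (-‿cong (D-zeroˡ J (alternating-repeat altT′))))))
                  (D-zeroˡ J λ d → alternating-repeat altT (there (there d))) ⟩
      T′ (x ∷ J) * T (y ∷ J) - (T′ (y ∷ J) * T (x ∷ J) - 0#) + 0#
        ≈⟨ solve 2 (λ a b → a :- (b :- :0) :+ :0 := a :- b) refl _ _ ⟩
      T′ (x ∷ J) * T (y ∷ J) - T′ (y ∷ J) * T (x ∷ J) ∎

    -- The functionals k ↦ `D k T X` and k ↦ `D k T′ X`, for X = a ∷ Y, are proportional. To see
    -- this, the bilinear identity is contracted by k in X. The exceptional term has the factor
    -- `T X`, and the remaining `B` vanishes: every move creates a repetition, except that of a,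
    -- which produces `T′ X`.
    τ-kernel-evolve : ∀ k a Y → T (a ∷ Y) ≈ 0# → T′ (a ∷ Y) ≈ 0# →
      T′ Y * D k T (a ∷ Y) ≈ T Y * D k T′ (a ∷ Y)
    τ-kernel-evolve k a Y TX T′X = begin
      T′ Y * D k T X
        ≈⟨ solve 2 (λ a b → a := b :+ (a :- b)) refl _ _ ⟩
      T Y * D k T′ X + (T′ Y * D k T X - T Y * D k T′ X)
        ≈⟨ +-congˡ (begin
          T′ Y * D k T X - T Y * D k T′ X
            ≈⟨ +-congˡ (-‿cong (D-*ʳ k (T Y) T′ X)) ⟨
          T′ Y * D k T X - D k (λ L → T Y * T′ L) X
            ≈⟨ D-*-ʳ k (T′ Y) T (λ L → T Y * T′ L) X ⟨
          D k (λ L → T′ Y * T L - T Y * T′ L) X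
            ≈⟨ D-cong′ X (λ {_} {L} d → refl , trans (τ-bilinear L Y (Bool.not-injective (Deletion-parity d)))
                 (sub-cong (*-comm _ _) (*-comm _ _))) ⟨
          D k (λ L → B T T′ L Y) X
            ≈⟨ solve 2 (λ a b → b := a :- (a :- b)) refl _ _ ⟩
          T X * D k T′ Y - (T X * D k T′ Y - D k (λ L → B T T′ L Y) X)
            ≈⟨ sub-cong (*-congʳ TX) (sym (B-Dˡ k T T′ X Y)) ⟩
          0# * D k T′ Y - B (D k T) T′ X Y
            ≈⟨ +-congˡ (-‿cong (+-cong (D-zeroˡ {g = D k T} X first)
                 (D-zeroˡ {g = T′} Y λ d → alternating-repeat {g = D k T} (D-alternating altT) (there d)))) ⟩
          0# * D k T′ Y - (0# + 0#)
            ≈⟨ solve 1 (λ a → :0 :* a :- (:0 :+ :0) := :0) refl _ ⟩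
          0# ∎) ⟩
      T Y * D k T′ X + 0#
        ≈⟨ +-identityʳ _ ⟩
      T Y * D k T′ X ∎
      where
      X = a ∷ Y
      first : ∀ {x M} → Deletion x M X → T′ (x ∷ Y) ≈ 0#
      first here      = T′X
      first (there d) = alternating-repeat altT′ d

  module _ {A : Form} (form : IsAlternatingForm A) (u : I → Carrier) where
    private
      p = pf A
      T = τ A u

    τ-summands : ∀ X → T X ≈ 0# → p X ≈ 0# × D u p X ≈ 0#
    τ-summands X TX with parity X in r
    ... | true  = pX , trans (sym (trans (+-congʳ pX) (+-identityˡ _))) TX
      where pX = pf-odd A X r
    ... | false = trans (sym (trans (+-congˡ puX) (+-identityʳ _))) TX , puX
      where puX = D-parity (pf-odd A) X r

    τ-kernel-border : ∀ X → T X ≈ 0# → D u T X ≈ 0#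
    τ-kernel-border X TX = begin
      D u T X                    ≈⟨ D-+ʳ u p (D u p) X ⟩
      D u p X + D u (D u p) X    ≈⟨ +-cong (proj₂ (τ-summands X TX)) (D-square u p X) ⟩
      0# + 0#                    ≈⟨ +-identityˡ 0# ⟩
      0#                         ∎

    -- As y occurs in X, both `p` and `D u p` vanish on y ∷ X; expanding them along y leaves the
    -- contraction by the row of y.
    τ-kernel-row : ∀ {y M} X → T X ≈ 0# → Deletion y M X → D (A y) T X ≈ 0#
    τ-kernel-row {y} X TX d = begin
      D (A y) T X
        ≈⟨ D-+ʳ (A y) p (D u p) X ⟩
      D (A y) p X + D (A y) (D u p) X
        ≈⟨ +-cong (sym (pf-∷ A y X)) (D-anticomm (A y) u p X) ⟩
      p (y ∷ X) - D u (D (A y) p) X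
        ≈⟨ sub-cong (alternating-repeat alt d) (D-congʳ X (λ M → sym (pf-∷ A y M))) ⟩
      0# - D u (λ M → p (y ∷ M)) X
        ≈⟨ solve 2 (λ a b → :0 :- b := (a :- b) :- a) refl (u y * p X) _ ⟩
      D u p (y ∷ X) - u y * p X
        ≈⟨ sub-cong (alternating-repeat (D-alternating alt) d) (*-congˡ (proj₁ (τ-summands X TX))) ⟩
      0# - u y * 0#
        ≈⟨ solve 1 (λ a → :0 :- a :* :0 := :0) refl _ ⟩
      0# ∎
      where alt = pf-alternating form

    -- Isolates the dependence on z: a linear combination of the entries of row z at members of L
    -- and of the border entry `u z`.
    τ-∷ : ∀ z L → T (z ∷ L) ≈ 1# * D (A z) T L + p L * u z
    τ-∷ z L = begin
      p (z ∷ L) + (u z * p L - D u (λ M → p (z ∷ M)) L)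
        ≈⟨ +-cong (pf-∷ A z L) (+-congˡ (-‿cong (trans (D-congʳ L (pf-∷ A z)) (D-anticomm u (A z) p L)))) ⟩
      D (A z) p L + (u z * p L - - D (A z) (D u p) L)
        ≈⟨ solve 4 (λ a b c d → a :+ (b :* c :- (:- d)) := :1 :* (a :+ d) :+ c :* b) refl _ _ _ _ ⟩
      1# * (D (A z) p L + D (A z) (D u p) L) + p L * u z
        ≈⟨ +-congʳ (*-congˡ (D-+ʳ (A z) p (D u p) L)) ⟨
      1# * D (A z) T L + p L * u z ∎

    -- By `τ-∷`, a vector on X orthogonal to the border and to the rows of the members of L is
    -- orthogonal to z ↦ `T (z ∷ L)`. Antisymmetry exchanges rows and columns.
    τ-row-relation : ∀ g X L → D u g X ≈ 0# → (∀ {y M} → Deletion y M L → D (A y) g X ≈ 0#) →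
      D (λ z → T (z ∷ L)) g X ≈ 0#
    τ-row-relation g X L border rows = begin
      D (λ z → T (z ∷ L)) g X
        ≈⟨ D-congˡ X (λ z → τ-∷ z L) ⟩
      D (λ z → 1# * D (A z) T L + p L * u z) g X
        ≈⟨ D-linearˡ 1# (p L) _ u g X ⟩
      1# * D (λ z → D (A z) T L) g X + p L * D u g X
        ≈⟨ +-cong (*-congˡ (D-transpose A g T X L)) (*-congˡ border) ⟩
      1# * D (λ y → D (λ x → A x y) g X) T L + p L * 0#
        ≈⟨ +-congʳ (*-congˡ (D-zeroˡ L λ {y} d →
             trans (D-congˡ X λ x → antisym form x y)
               (trans (D-negˡ (A y) g X) (trans (-‿cong (rows d)) (solve 0 (:- :0 := :0) refl))))) ⟩
      1# * 0# + p L * 0#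
        ≈⟨ solve 1 (λ a → :1 :* :0 :+ a :* :0 := :0) refl _ ⟩
      0# ∎

-- The inverse of 0# is unspecified.
record DiscreteField c ℓ : Set (Level.suc (c Level.⊔ ℓ)) where
  infix 8 _⁻¹
  field commutativeRing : CommutativeRing c ℓ
  open CommutativeRing commutativeRing public
  field
    1≉0        : ¬ 1# ≈ 0#
    zero?      : ∀ x → Dec (x ≈ 0#)
    _⁻¹        : Carrier → Carrier
    ⁻¹-inverse : ∀ {x} → ¬ x ≈ 0# → x ⁻¹ * x ≈ 1#

  open RingSolver commutativeRing
  open import Relation.Binary.Reasoning.Setoid setoid

  *-cancelˡ-0 : ∀ {x y} → ¬ x ≈ 0# → x * y ≈ 0# → y ≈ 0#
  *-cancelˡ-0 {x} {y} x≉0 xy≈0 = begin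
    y                ≈⟨ *-identityˡ y ⟨
    1# * y           ≈⟨ *-congʳ (⁻¹-inverse x≉0) ⟨
    (x ⁻¹ * x) * y   ≈⟨ *-assoc _ _ _ ⟩
    x ⁻¹ * (x * y)   ≈⟨ *-congˡ xy≈0 ⟩
    x ⁻¹ * 0#        ≈⟨ zeroʳ _ ⟩
    0#               ∎

  *-cancelˡ : ∀ {x y z} → ¬ x ≈ 0# → x * y ≈ x * z → y ≈ z
  *-cancelˡ {x} {y} {z} x≉0 e = begin
    y           ≈⟨ solve 2 (λ y z → y := (y :- z) :+ z) refl y z ⟩
    (y - z) + z ≈⟨ +-congʳ (*-cancelˡ-0 x≉0 (begin
      x * (y - z)     ≈⟨ solve 3 (λ x y z → x :* (y :- z) := x :* y :- x :* z) refl x y z ⟩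
      x * y - x * z   ≈⟨ +-congʳ e ⟩
      x * z - x * z   ≈⟨ -‿inverseʳ _ ⟩
      0#              ∎)) ⟩
    0# + z      ≈⟨ +-identityˡ z ⟩
    z           ∎

  *-nonzero : ∀ {x y} → ¬ x ≈ 0# → ¬ y ≈ 0# → ¬ x * y ≈ 0#
  *-nonzero x≉0 y≉0 e = y≉0 (*-cancelˡ-0 x≉0 e)

-- Finitely generated spaces of functions.

module Spans {c ℓ} (R : CommutativeRing c ℓ) where
  open CommutativeRing R
  open RingSolver R
  open import Data.List.Base using (List; []; _∷_; map)
  open import Data.List.Membership.Propositional using (_∈_)
  open import Data.List.Relation.Unary.Any using (here; there)
  open import Data.Product.Base using (Σ; _,_)
  open import Level using (_⊔_)
  open import Relation.Binary.PropositionalEquality as ≡ using (_≡_)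
  open import Relation.Binary.Reasoning.Setoid setoid

  module _ {S : Set} where
    -- The recursive form exposes the coefficient of the first generator, which is what elimination
    -- of generators acts on.
    Span : List (S → Carrier) → (S → Carrier) → Set (c ⊔ ℓ)
    Span []       f = Level.Lift c (∀ s → f s ≈ 0#)
    Span (b ∷ bs) f = Σ Carrier λ α → Span bs (λ s → f s - α * b s)

    Span-resp : ∀ bs {f g} → (∀ s → f s ≈ g s) → Span bs f → Span bs g
    Span-resp []       e (Level.lift p) = Level.lift λ s → trans (sym (e s)) (p s)
    Span-resp (b ∷ bs) e (α , p)        = α , Span-resp bs (λ s → +-congʳ (e s)) p

    Span-linear : ∀ bs {f g} x y → Span bs f → Span bs g → Span bs (λ s → x * f s + y * g s)
    Span-linear []       x y (Level.lift p) (Level.lift q) = Level.lift λ s →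
      trans (+-cong (*-congˡ (p s)) (*-congˡ (q s))) (solve 2 (λ x y → x :* :0 :+ y :* :0 := :0) refl x y)
    Span-linear (b ∷ bs) x y (α , p) (β , q) = x * α + y * β , Span-resp bs
      (λ s → solve 7 (λ x y f g α β b →
        x :* (f :- α :* b) :+ y :* (g :- β :* b) := x :* f :+ y :* g :- (x :* α :+ y :* β) :* b)
        refl x y _ _ α β _)
      (Span-linear bs x y p q)

    Span-zero : ∀ bs → Span bs (λ _ → 0#)
    Span-zero []       = Level.lift λ _ → refl
    Span-zero (b ∷ bs) = 0# , Span-resp bs (λ s → solve 1 (λ b → :0 := :0 :- :0 :* b) refl _) (Span-zero bs)

    Span-scale : ∀ bs {f} x → Span bs f → Span bs (λ s → x * f s)
    Span-scale bs x p = Span-resp bs (λ s → solve 2 (λ x f → x :* f :+ :0 :* :0 := x :* f) refl _ _)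
      (Span-linear bs x 0# p (Span-zero bs))

    Span-generator : ∀ {b} bs → b ∈ bs → Span bs b
    Span-generator (b ∷ bs) (here ≡.refl) = 1# ,
      Span-resp bs (λ s → solve 1 (λ b → :0 := b :- :1 :* b) refl _) (Span-zero bs)
    Span-generator (b′ ∷ bs) (there e) = 0# ,
      Span-resp bs (λ s → solve 2 (λ b c → b := b :- :0 :* c) refl _ _) (Span-generator bs e)

  Span-map : ∀ {S S′ : Set} (h : S′ → Carrier) (p : S′ → S) bs {f} → Span bs f →
    Span (map (λ b s → h s * b (p s)) bs) (λ s → h s * f (p s))
  Span-map h p []       (Level.lift e) = Level.lift λ s → trans (*-congˡ (e (p s))) (zeroʳ _)
  Span-map h p (b ∷ bs) (α , q) = α , Span-resp (map _ bs)
    (λ s → solve 4 (λ h f α b → h :* (f :- α :* b) := h :* f :- α :* (h :* b)) refl _ _ α _)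
    (Span-map h p bs q)

  module _ {I S : Set} where
    open Contraction R I

    Span-D : ∀ bs (Φ : I → S → Carrier) g L → (∀ {x} → x ∈ L → Span bs (Φ x)) →
      Span bs (λ s → D (λ x → Φ x s) g L)
    Span-D bs Φ g []      p = Span-zero bs
    Span-D bs Φ g (x ∷ L) p = Span-resp bs
      (λ s → solve 3 (λ a b c → b :* a :+ :- :1 :* c := a :* b :- c) refl _ _ _)
      (Span-linear bs (g L) (- 1#) (p (here ≡.refl)) (Span-D bs Φ _ L λ e → p (there e)))

-- Solution of the cube recurrence in a strip by tau functions.

module CubeStrip {c ℓ} (K : DiscreteField c ℓ) where
  open DiscreteField K
  open RingSolver commutativeRing
  open import Data.Nat.Base as ℕ using (ℕ; zero; suc; s≤s)
  open import Relation.Binary.Reasoning.Setoid setoid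
  open import Relation.Binary.PropositionalEquality as ≡ using (_≡_)

  -- In coordinates with v = (c - a, a - b, b - c), t = a + b + c and c = a + i,
  -- φ i a b is the value of the cube recurrence at (v , t); it is continued by 0 to i = m + 1.
  record IsCubeStrip (m : ℕ) (φ : ℕ → ℕ → ℕ → Carrier) : Set ℓ where
    field
      left    : ∀ a b → φ 0 a b ≈ 1#
      outside : ∀ a b → φ (suc m) a b ≈ 0#
      nonzero : ∀ i a b → i ℕ.≤ m → ¬ φ i a b ≈ 0#
      cube    : ∀ i a b → suc i ℕ.≤ m →
        φ (suc i) a b * φ (suc i) (suc a) (suc b) ≈
          φ (suc i) a (suc b) * φ (suc i) (suc a) b +
          φ i (suc a) b * φ (2 ℕ.+ i) a (suc b) +
          φ (2 ℕ.+ i) a b * φ i (suc a) (suc b)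

  sgn : ℕ → Carrier
  sgn zero    = 1#
  sgn (suc n) = - sgn n

  sgn-square : ∀ n → sgn n * sgn n ≈ 1#
  sgn-square zero    = *-identityˡ 1#
  sgn-square (suc n) = trans (solve 1 (λ a → (:- a) :* (:- a) := a :* a) refl _) (sgn-square n)

  -- Signs for which gauge · φ satisfies an equation of the shape of the Pfaffian identity τ-cube.
  gauge : ℕ → ℕ → Carrier
  gauge zero          b       = 1#
  gauge (suc zero)    zero    = 1#
  gauge (suc zero)    (suc b) = sgn b * gauge 1 b
  gauge (suc (suc i)) b       = sgn (suc (i ℕ.+ b)) * gauge i b

  square-* : ∀ {x y} → x * x ≈ 1# → y * y ≈ 1# → (x * y) * (x * y) ≈ 1#
  square-* p q = trans (solve 2 (λ x y → (x :* y) :* (x :* y) := (x :* x) :* (y :* y)) refl _ _)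
    (trans (*-cong p q) (*-identityˡ 1#))

  gauge-square : ∀ i b → gauge i b * gauge i b ≈ 1#
  gauge-square zero          b       = *-identityˡ 1#
  gauge-square (suc zero)    zero    = *-identityˡ 1#
  gauge-square (suc zero)    (suc b) = square-* (sgn-square b) (gauge-square 1 b)
  gauge-square (suc (suc i)) b       = square-* (sgn-square (suc (i ℕ.+ b))) (gauge-square i b)

  gauge-suc² : ∀ i b → gauge (2 ℕ.+ i) (suc b) ≈ sgn (i ℕ.+ b) * gauge i (suc b)
  gauge-suc² i b = *-congʳ (trans (reflexive (≡.cong (λ k → - sgn k) (ℕ.+-suc i b)))
      (solve 1 (λ a → :- (:- a) := a) refl _))
    where import Data.Nat.Properties as ℕ

  -- The sign by which the product of two consecutive gauges changes from i to i + 1. It is the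
  -- common factor which makes the three products of `t-cube` compatible.
  gauge-ratio : ∀ i b →
    gauge (suc i) b * gauge (suc i) (suc b) ≈ sgn (i ℕ.+ b) * (gauge i b * gauge i (suc b))
  gauge-ratio zero    b = begin
    gauge 1 b * (sgn b * gauge 1 b)   ≈⟨ solve 2 (λ g s → g :* (s :* g) := s :* (g :* g)) refl _ _ ⟩
    sgn b * (gauge 1 b * gauge 1 b)   ≈⟨ *-congˡ (trans (gauge-square 1 b) (sym (*-identityˡ 1#))) ⟩
    sgn b * (1# * 1#)                 ∎
  gauge-ratio (suc i) b = begin
    (- s * g) * gauge (2 ℕ.+ i) (suc b)   ≈⟨ *-congˡ (gauge-suc² i b) ⟩
    (- s * g) * (s * g′)                  ≈⟨ solve 3 (λ s g h → (:- s :* g) :* (s :* h) := (:- s) :* (s :* (g :* h))) refl _ _ _ ⟩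
    - s * (s * (g * g′))                  ≈⟨ *-congˡ (gauge-ratio i b) ⟨
    - s * (gauge (suc i) b * gauge (suc i) (suc b)) ∎
    where
    s  = sgn (i ℕ.+ b)
    g  = gauge i b
    g′ = gauge i (suc b)

  module Solution {m : ℕ} {φ : ℕ → ℕ → ℕ → Carrier} (isCube : IsCubeStrip m φ) where
    open IsCubeStrip isCube
    open Contraction commutativeRing ℕ
    open Pfaffian commutativeRing ℕ
    open TauFunction commutativeRing ℕ
    open Spans commutativeRing
    open import Data.Empty using (⊥-elim)
    open import Data.List.Base using (List; []; _∷_; _++_; length; map; concatMap)
    open import Data.List.Membership.Propositional using (_∈_; lose)
    open import Data.List.Membership.Propositional.Properties using (∈-++⁺ˡ; ∈-++⁺ʳ; ∈-++⁻; ∈-concatMap⁺; ∈-map⁺)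
    open import Data.List.Properties using (++-identityʳ; length-++)
    open import Data.List.Relation.Binary.Subset.Propositional using (_⊆_)
    open import Data.List.Relation.Unary.Any using (here; there)
    import Data.Nat.Properties as ℕ
    open import Data.Product.Base using (∃; _×_; _,_; proj₁; proj₂)
    open import Data.Sum.Base using (inj₁; inj₂)
    open import Relation.Nullary using (yes; no)

    t : ℕ → ℕ → ℕ → Carrier
    t i a b = gauge i b * φ i a b

    t-left : ∀ a b → t 0 a b ≈ 1#
    t-left a b = trans (*-identityˡ _) (left a b)

    t-outside : ∀ a b → t (suc m) a b ≈ 0#
    t-outside a b = trans (*-congˡ (outside a b)) (zeroʳ _)

    t-nonzero : ∀ i a b → i ℕ.≤ m → ¬ t i a b ≈ 0#
    t-nonzero i a b i≤m = *-nonzero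
      (λ g≈0 → 1≉0 (trans (sym (gauge-square i b)) (trans (*-congʳ g≈0) (zeroˡ _))))
      (nonzero i a b i≤m)

    -- The signs turn the recurrence, a sum of three products, into an equation between two
    -- differences, the form of `τ-cube` on the window x ∷ J ++ y.
    t-cube : ∀ i a b → suc i ℕ.≤ m →
      t (2 ℕ.+ i) a b * t i (suc a) (suc b) - t (2 ℕ.+ i) a (suc b) * t i (suc a) b ≈
      t (suc i) a (suc b) * t (suc i) (suc a) b - t (suc i) (suc a) (suc b) * t (suc i) a b
    t-cube i a b i<m = begin
      (- s * g * φ₁) * (g′ * φ₂) - (gauge (2 ℕ.+ i) (suc b) * φ₃) * (g * φ₄)
        ≈⟨ +-congˡ (-‿cong (*-congʳ (*-congʳ (gauge-suc² i b)))) ⟩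
      (- s * g * φ₁) * (g′ * φ₂) - (s * g′ * φ₃) * (g * φ₄)
        ≈⟨ solve 7 (λ s g g′ φ₁ φ₂ φ₃ φ₄ →
             (:- s :* g :* φ₁) :* (g′ :* φ₂) :- (s :* g′ :* φ₃) :* (g :* φ₄) :=
             (s :* (g :* g′)) :* (:- (φ₄ :* φ₃) :- φ₁ :* φ₂)) refl _ _ _ _ _ _ _ ⟩
      (s * (g * g′)) * (- (φ₄ * φ₃) - φ₁ * φ₂)
        ≈⟨ *-congʳ (gauge-ratio i b) ⟨
      (h * h′) * (- (φ₄ * φ₃) - φ₁ * φ₂)
        ≈⟨ *-congˡ (solve 3 (λ x y z → (:- y) :- z := x :- (x :+ y :+ z)) refl (φ₅ * φ₆) _ _) ⟩
      (h * h′) * (φ₅ * φ₆ - (φ₅ * φ₆ + φ₄ * φ₃ + φ₁ * φ₂))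
        ≈⟨ *-congˡ (+-congˡ (-‿cong (cube i a b i<m))) ⟨
      (h * h′) * (φ₅ * φ₆ - φ₇ * φ₈)
        ≈⟨ solve 6 (λ h h′ φ₅ φ₆ φ₇ φ₈ →
             (h :* h′) :* (φ₅ :* φ₆ :- φ₇ :* φ₈) :=
             (h′ :* φ₅) :* (h :* φ₆) :- (h′ :* φ₈) :* (h :* φ₇)) refl _ _ _ _ _ _ ⟩
      t (suc i) a (suc b) * t (suc i) (suc a) b - t (suc i) (suc a) (suc b) * t (suc i) a b ∎
      where
      s  = sgn (i ℕ.+ b)
      g  = gauge i b
      g′ = gauge i (suc b)
      h  = gauge (suc i) b
      h′ = gauge (suc i) (suc b)
      φ₁ = φ (2 ℕ.+ i) a b
      φ₂ = φ i (suc a) (suc b)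
      φ₃ = φ (2 ℕ.+ i) a (suc b)
      φ₄ = φ i (suc a) b
      φ₅ = φ (suc i) a (suc b)
      φ₆ = φ (suc i) (suc a) b
      φ₇ = φ (suc i) a b
      φ₈ = φ (suc i) (suc a) (suc b)

    window : ℕ → ℕ → List ℕ
    window a zero    = []
    window a (suc i) = a ∷ window (suc a) i

    window-snoc : ∀ a i → window a (suc i) ≡ window a i ++ (i ℕ.+ a) ∷ []
    window-snoc a zero    = ≡.refl
    window-snoc a (suc i) = ≡.cong (a ∷_) (≡.trans (window-snoc (suc a) i)
      (≡.cong (λ k → window (suc a) i ++ k ∷ []) (ℕ.+-suc i a)))

    window-bounds : ∀ a i {x} → x ∈ window a i → a ℕ.≤ x × x ℕ.< i ℕ.+ a
    window-bounds a (suc i) (here ≡.refl) = ℕ.≤-refl , s≤s (ℕ.m≤n+m a i)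
    window-bounds a (suc i) {x} (there e) with window-bounds (suc a) i e
    ... | p , q = ℕ.<⇒≤ p , ≡.subst (x ℕ.<_) (ℕ.+-suc i a) q

    window-mono : ∀ {k l} → k ℕ.≤ l → ∀ a → window a k ⊆ window a l
    window-mono (s≤s p) a (here e)  = here e
    window-mono (s≤s p) a (there e) = there (window-mono p (suc a) e)

    -- The initial skew form, with prescribed tau functions on windows.

    u : ℕ → ℕ → Carrier
    u b x = t 1 x b

    δ : ℕ → ℕ → Carrier
    δ x y with x ℕ.≟ y
    ... | yes _ = 1#
    ... | no _  = 0#

    δ-refl : ∀ x → δ x x ≈ 1#
    δ-refl x with x ℕ.≟ x
    ... | yes _  = refl
    ... | no x≢x = ⊥-elim (x≢x ≡.refl)

    δ-≢ : ∀ {x y} → ¬ x ≡ y → δ x y ≈ 0#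
    δ-≢ {x} {y} x≢y with x ℕ.≟ y
    ... | yes x≡y = ⊥-elim (x≢y x≡y)
    ... | no _    = refl

    -- V g is supported on pairs at distance at most g. The entry at distance suc g is chosen such
    -- that the tau function of a window of length 2 + g has the prescribed value; it enters this
    -- tau function with the coefficient t g (suc x) 0, up to sign.
    mutual
      V : ℕ → Form
      V zero    x y = 0#
      V (suc g) x y = V g x y + (δ (g ℕ.+ suc x) y * entry g x - δ (g ℕ.+ suc y) x * entry g y)

      entry : ℕ → ℕ → Carrier
      entry g x = (sign J * t (2 ℕ.+ g) x 0 - τ (V g) (u 0) (x ∷ g ℕ.+ suc x ∷ J)) * t g (suc x) 0 ⁻¹
        where J = window (suc x) g

    V-alternating : ∀ g → IsAlternatingForm (V g)
    V-alternating zero    .antisym  x y = solve 0 (:0 := :- :0) refl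
    V-alternating zero    .diagonal x   = refl
    V-alternating (suc g) .antisym  x y = trans (+-congʳ (V-alternating g .antisym x y))
      (solve 3 (λ a b c → :- a :+ (b :- c) := :- (a :+ (c :- b))) refl _ _ _)
    V-alternating (suc g) .diagonal x = trans (+-congʳ (V-alternating g .diagonal x))
      (solve 1 (λ a → :0 :+ (a :- a) := :0) refl _)

    far : ∀ g a {x y} → x ∈ window a (suc g) → y ∈ window a (suc g) → ¬ g ℕ.+ suc x ≡ y
    far g a x∈ y∈ ≡.refl = ℕ.<⇒≱ (proj₂ (window-bounds a (suc g) y∈))
      (≡.subst (suc g ℕ.+ a ℕ.≤_) (≡.sym (ℕ.+-suc g _)) (s≤s (ℕ.+-monoʳ-≤ g (proj₁ (window-bounds a (suc g) x∈)))))

    V-stable : ∀ g a {x y} → x ∈ window a (suc g) → y ∈ window a (suc g) → V (suc g) x y ≈ V g x y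
    V-stable g a {x} {y} x∈ y∈ = trans
      (+-congˡ (sub-cong (*-congʳ (δ-≢ (far g a x∈ y∈))) (*-congʳ (δ-≢ (far g a y∈ x∈)))))
      (solve 3 (λ a b c → a :+ (:0 :* b :- :0 :* c) := a) refl _ _ _)

    V-entry : ∀ g x → V (suc g) x (g ℕ.+ suc x) ≈ V g x (g ℕ.+ suc x) + entry g x
    V-entry g x = trans (+-congˡ (sub-cong (*-congʳ (δ-refl (g ℕ.+ suc x))) (*-congʳ (δ-≢ ≢))))
      (solve 3 (λ a b c → a :+ (:1 :* b :- :0 :* c) := a :+ b) refl _ _ _)
      where
      ≢ : ¬ g ℕ.+ suc (g ℕ.+ suc x) ≡ x
      ≢ e = ℕ.<⇒≢ (ℕ.≤-trans (ℕ.m≤n+m (suc x) g) (ℕ.≤-trans (ℕ.n≤1+n _) (ℕ.m≤n+m _ g))) (≡.sym e)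

    window-⊆-snoc : ∀ a i → window a i ⊆ window a (suc i)
    window-⊆-snoc a i e = ≡.subst (_ ∈_) (≡.sym (window-snoc a i)) (∈-++⁺ˡ e)

    last∈window : ∀ a i → i ℕ.+ a ∈ window a (suc i)
    last∈window a i = ≡.subst (_ ∈_) (≡.sym (window-snoc a i)) (∈-++⁺ʳ (window a i) (here ≡.refl))

    -- Brings the last element of a window to the second place, since `τ-cube` and `τ-extend`
    -- concern lists x ∷ y ∷ J with J the interior of the window.
    split-window : ∀ {f} → Alternating f → ∀ x g →
      f (window x (2 ℕ.+ g)) ≈ sign (window (suc x) g) * f (x ∷ g ℕ.+ suc x ∷ window (suc x) g)
    split-window {f} alt x g = trans (reflexive (≡.cong (λ L → f (x ∷ L)) (window-snoc (suc x) g)))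
      (alternating-back (alternating-∷ x alt) (window (suc x) g) (g ℕ.+ suc x))

    -- Within this window only the entry at (x, y) differs between the two forms. In the expansion
    -- along row x it multiplies the tau function of the interior J, on which the forms agree.
    τ-extend : ∀ g x → let J = window (suc x) g; y = g ℕ.+ suc x in
      τ (V (suc g)) (u 0) (x ∷ y ∷ J) ≈ τ (V g) (u 0) (x ∷ y ∷ J) + entry g x * τ (V g) (u 0) J
    τ-extend g x = begin
      T′ (x ∷ y ∷ J)
        ≈⟨ τ-∷ (V-alternating (suc g)) (u 0) x (y ∷ J) ⟩
      1# * (V (suc g) x y * T′ J - D (V (suc g) x) (λ M → T′ (y ∷ M)) J) + pf (V (suc g)) (y ∷ J) * u 0 x
        ≈⟨ +-cong (*-congˡ (sub-cong (*-cong (V-entry g x) (τ-cong (u 0) J (stable JX)))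
             (D-cong′ J (λ {_} {M} d → V-stable g x (here ≡.refl) (there (Deletion⇒∈ d)) ,
               τ-cong (u 0) (y ∷ M) (stable (yM d))))))
             (*-congʳ (pf-cong (y ∷ J) (stable (yJ (λ e → e))))) ⟩
      1# * ((V g x y + entry g x) * T J - D (V g x) (λ M → T (y ∷ M)) J) + pf (V g) (y ∷ J) * u 0 x
        ≈⟨ solve 5 (λ v e t d r → :1 :* ((v :+ e) :* t :- d) :+ r :=
             :1 :* (v :* t :- d) :+ r :+ e :* t) refl _ _ _ _ _ ⟩
      1# * D (V g x) T (y ∷ J) + pf (V g) (y ∷ J) * u 0 x + entry g x * T J
        ≈⟨ +-congʳ (τ-∷ (V-alternating g) (u 0) x (y ∷ J)) ⟨
      T (x ∷ y ∷ J) + entry g x * T J ∎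
      where
      J  = window (suc x) g
      y  = g ℕ.+ suc x
      T  = τ (V g) (u 0)
      T′ = τ (V (suc g)) (u 0)
      JX : J ⊆ window (suc x) (suc g)
      JX = window-⊆-snoc (suc x) g
      yJ : ∀ {M} → M ⊆ J → y ∷ M ⊆ window (suc x) (suc g)
      yJ M⊆J (here ≡.refl) = last∈window (suc x) g
      yJ M⊆J (there e)     = JX (M⊆J e)
      yM : ∀ {z M} → Deletion z M J → y ∷ M ⊆ window (suc x) (suc g)
      yM d = yJ (Deletion⇒⊆ d)
      stable : ∀ {L} → L ⊆ window (suc x) (suc g) → ∀ {z w} → z ∈ L → w ∈ L → V (suc g) z w ≈ V g z w
      stable L⊆ z w = V-stable g (suc x) (L⊆ z) (L⊆ w)

    τ-singleton : ∀ A b a → τ A (u b) (a ∷ []) ≈ t 1 a b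
    τ-singleton A b a = solve 1 (λ x → :0 :+ (x :* :1 :- :0) := x) refl _

    τ-empty : ∀ A b a → τ A (u b) [] ≈ t 0 a b
    τ-empty A b a = trans (+-identityʳ 1#) (sym (t-left a b))

    -- Shorter windows contain no pair at the distance changed last. For the longest one, `entry` is
    -- the solution of the affine equation of `τ-extend`, whose leading coefficient is nonzero.
    τ-initial : ∀ g i a → i ℕ.≤ suc g → i ℕ.≤ suc m → τ (V g) (u 0) (window a i) ≈ t i a 0
    τ-initial g       zero          a _ _ = τ-empty (V g) 0 a
    τ-initial g       (suc zero)    a _ _ = τ-singleton (V g) 0 a
    τ-initial (suc g) (suc (suc i)) a i≤ (s≤s i<m) with ℕ.m≤n⇒m<n∨m≡n i≤
    ... | inj₁ (s≤s i<) = trans (τ-cong (u 0) (window a (2 ℕ.+ i)) (λ x y → V-stable g a (inside x) (inside y)))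
                                (τ-initial g (2 ℕ.+ i) a i< (s≤s i<m))
      where
      inside : window a (2 ℕ.+ i) ⊆ window a (suc g)
      inside = window-mono i< a
    ... | inj₂ ≡.refl = begin
      T′ (window a (2 ℕ.+ g))
        ≈⟨ split-window (τ-alternating (u 0) (V-alternating (suc g))) a g ⟩
      sign J * T′ (a ∷ y ∷ J)
        ≈⟨ *-congˡ (trans (τ-extend g a) (+-congˡ (*-congˡ (τ-initial g g (suc a) (ℕ.n≤1+n g) (ℕ.m≤n⇒m≤1+n g≤m))))) ⟩
      sign J * (T (a ∷ y ∷ J) + (sign J * t (2 ℕ.+ g) a 0 - T (a ∷ y ∷ J)) * r ⁻¹ * r)
        ≈⟨ *-congˡ (+-congˡ (trans (*-assoc _ _ _) (*-congˡ (⁻¹-inverse (t-nonzero g (suc a) 0 g≤m))))) ⟩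
      sign J * (T (a ∷ y ∷ J) + (sign J * t (2 ℕ.+ g) a 0 - T (a ∷ y ∷ J)) * 1#)
        ≈⟨ solve 3 (λ s t τ → s :* (τ :+ (s :* t :- τ) :* :1) := (s :* s) :* t) refl _ _ _ ⟩
      sign J * sign J * t (2 ℕ.+ g) a 0
        ≈⟨ trans (*-congʳ (sign-square J)) (*-identityˡ _) ⟩
      t (2 ℕ.+ g) a 0 ∎
      where
      J   = window (suc a) g
      y   = g ℕ.+ suc a
      T   = τ (V g) (u 0)
      T′  = τ (V (suc g)) (u 0)
      r   = t g (suc a) 0
      g≤m = ℕ.<⇒≤ i<m
    τ-initial zero (suc (suc i)) a (s≤s ()) _

    -- Evolution of the form in b.

    W : ℕ → Form
    -- `V m` has the prescribed values on windows of length up to m + 1, and for length m + 1 this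
    -- value is zero.
    W zero    = V m
    W (suc b) = evolve (W b) (u b) (u (suc b))

    T : ℕ → List ℕ → Carrier
    T b = τ (W b) (u b)

    W-alternating : ∀ b → IsAlternatingForm (W b)
    W-alternating zero    = V-alternating m
    W-alternating (suc b) = evolve-alternating (u b) (u (suc b)) (W-alternating b)

    T-alternating : ∀ b → Alternating (T b)
    T-alternating b = τ-alternating (u b) (W-alternating b)

    -- `τ-cube` and `t-cube` are the same equation for a window of length i + 2. All its other
    -- values are known by induction on b and i, and the unknown one has the nonzero coefficient
    -- `t i (suc a) b`.
    T-window : ∀ b i a → i ℕ.≤ suc m → T b (window a i) ≈ t i a b
    T-window zero    i             a i≤ = τ-initial m i a i≤ i≤
    T-window (suc b) zero          a _  = τ-empty (W (suc b)) (suc b) a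
    T-window (suc b) (suc zero)    a _  = τ-singleton (W (suc b)) (suc b) a
    T-window (suc b) (suc (suc i)) a (s≤s i<m) = *-cancelˡ (t-nonzero i (suc a) b i≤m) (begin
      t i (suc a) b * T′ X
        ≈⟨ solve 3 (λ t x y → t :* x := y :- (y :- x :* t)) refl _ _ (t (2 ℕ.+ i) a b * t i (suc a) (suc b)) ⟩
      t₂ - (t₂ - T′ X * t i (suc a) b)
        ≈⟨ +-congˡ (-‿cong (begin
          t (2 ℕ.+ i) a b * t i (suc a) (suc b) - T′ X * t i (suc a) b
            ≈⟨ sub-cong (*-cong (T-window b (2 ℕ.+ i) a (s≤s i<m)) (T-window (suc b) i (suc a) i≤))
                        (*-congˡ (T-window b i (suc a) i≤)) ⟨
          T₀ X * T′ J - T′ X * T₀ J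
            ≈⟨ sub-cong (*-congʳ (split-window (T-alternating b) a i)) (*-congʳ (split-window (T-alternating (suc b)) a i)) ⟩
          (sign J * T₀ (a ∷ y ∷ J)) * T′ J - (sign J * T′ (a ∷ y ∷ J)) * T₀ J
            ≈⟨ solve 5 (λ s a b c d → (s :* a) :* b :- (s :* c) :* d := s :* (a :* b :- c :* d)) refl _ _ _ _ _ ⟩
          sign J * (T₀ (a ∷ y ∷ J) * T′ J - T′ (a ∷ y ∷ J) * T₀ J)
            ≈⟨ *-congˡ (τ-cube (W-alternating b) (u b) (u (suc b)) a y J) ⟩
          sign J * (T′ (a ∷ J) * T₀ (y ∷ J) - T′ (y ∷ J) * T₀ (a ∷ J))
            ≈⟨ solve 5 (λ s a b c d → s :* (a :* b :- c :* d) := a :* (s :* b) :- (s :* c) :* d) refl _ _ _ _ _ ⟩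
          T′ (a ∷ J) * (sign J * T₀ (y ∷ J)) - (sign J * T′ (y ∷ J)) * T₀ (a ∷ J)
            ≈⟨ sub-cong (*-congˡ (back b)) (*-congʳ (back (suc b))) ⟨
          T′ (a ∷ J) * T₀ (window (suc a) (suc i)) - T′ (window (suc a) (suc i)) * T₀ (a ∷ J)
            ≈⟨ sub-cong (*-cong (T-window (suc b) (suc i) a i<) (T-window b (suc i) (suc a) i<))
                        (*-cong (T-window (suc b) (suc i) (suc a) i<) (T-window b (suc i) a i<)) ⟩
          t (suc i) a (suc b) * t (suc i) (suc a) b - t (suc i) (suc a) (suc b) * t (suc i) a b
            ≈⟨ t-cube i a b i<m ⟨
          t₂ - t (2 ℕ.+ i) a (suc b) * t i (suc a) b ∎)) ⟩
      t₂ - (t₂ - t (2 ℕ.+ i) a (suc b) * t i (suc a) b)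
        ≈⟨ solve 3 (λ t x y → y :- (y :- x :* t) := t :* x) refl _ _ _ ⟩
      t i (suc a) b * t (2 ℕ.+ i) a (suc b) ∎)
      where
      J   = window (suc a) i
      y   = i ℕ.+ suc a
      X   = window a (2 ℕ.+ i)
      T₀  = T b
      T′  = T (suc b)
      t₂  = t (2 ℕ.+ i) a b * t i (suc a) (suc b)
      i≤m = ℕ.<⇒≤ i<m
      i<  = ℕ.m≤n⇒m≤1+n i<m
      i≤  = ℕ.m≤n⇒m≤1+n i≤m
      back : ∀ b → T b (window (suc a) (suc i)) ≈ sign J * T b (y ∷ J)
      back b = trans (reflexive (≡.cong (T b) (window-snoc (suc a) i))) (alternating-back (T-alternating b) J y)

    -- Relations between rows, with coefficients independent of b.

    module _ (a : ℕ) where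
      private
        Y = window (suc a) m
        X = a ∷ Y

      T-X : ∀ b → T b X ≈ 0#
      T-X b = trans (T-window b (suc m) a ℕ.≤-refl) (t-outside a b)

      -- Goes down in b along the proportionality of `τ-kernel-evolve`; the factor cancelled is the
      -- value on Y, a window of length m, which is nonzero.
      kernel-initial : ∀ k b → D k (T b) X ≈ 0# → D k (T 0) X ≈ 0#
      kernel-initial k zero    e = e
      kernel-initial k (suc b) e = kernel-initial k b (*-cancelˡ-0
        (λ z → t-nonzero m (suc a) (suc b) ℕ.≤-refl
          (trans (sym (T-window (suc b) m (suc a) (ℕ.n≤1+n m))) z))
        (trans (τ-kernel-evolve (W-alternating b) (u b) (u (suc b)) k a Y (T-X b) (T-X (suc b)))
               (trans (*-congˡ e) (zeroʳ _))))

      -- The coefficients of the linear functional k ↦ D k (T 0) X do not depend on b.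
      T-relation : ∀ b L → L ⊆ X → D (λ z → T b (z ∷ L)) (T 0) X ≈ 0#
      T-relation b L L⊆X = τ-row-relation (W-alternating b) (u b) (T 0) X L
        (kernel-initial (u b) b (τ-kernel-border (W-alternating b) (u b) X (T-X b)))
        (λ {y} d → kernel-initial (W b y) b
          (τ-kernel-row (W-alternating b) (u b) X (T-X b) (proj₂ (∈⇒Deletion (L⊆X (Deletion⇒∈ d))))))

      P₀ : List ℕ
      P₀ = window a m

      -- In `T-relation` the last element m + a of X has the coefficient `± T 0 P₀`, that is
      -- `± t m a 0`, which is nonzero. Solving for this term gives a factor κ independent of b and
      -- L.
      T-last : ∃ λ κ → ∀ b L → L ⊆ X →
        T b (m ℕ.+ a ∷ L) ≈ κ * D (λ z → T b (z ∷ L)) (λ M → T 0 (M ++ m ℕ.+ a ∷ [])) P₀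
      T-last = - sign P₀ * t m a 0 ⁻¹ , λ b L L⊆X → let
          f = λ z → T b (z ∷ L)
          E = D f (λ M → T 0 (M ++ m ℕ.+ a ∷ [])) P₀
          r = t m a 0
        in begin
          f (m ℕ.+ a)
            ≈⟨ solve 1 (λ x → x := (:1 :* :1) :* x) refl _ ⟩
          (1# * 1#) * f (m ℕ.+ a)
            ≈⟨ *-congʳ (*-cong (sign-square P₀) (⁻¹-inverse (t-nonzero m a 0 ℕ.≤-refl))) ⟨
          ((sign P₀ * sign P₀) * (r ⁻¹ * r)) * f (m ℕ.+ a)
            ≈⟨ solve 5 (λ s q r f e → ((s :* s) :* (q :* r)) :* f :=
                 (s :* q) :* (e :+ s :* (f :* r)) :+ (:- s :* q) :* e) refl _ _ _ _ E ⟩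
          (sign P₀ * r ⁻¹) * (E + sign P₀ * (f (m ℕ.+ a) * r)) + (- sign P₀ * r ⁻¹) * E
            ≈⟨ +-congʳ (*-congˡ (begin
              E + sign P₀ * (f (m ℕ.+ a) * r)
                ≈⟨ +-congˡ (*-congˡ (*-congˡ (T-window 0 m a (ℕ.n≤1+n m)))) ⟨
              E + sign P₀ * (f (m ℕ.+ a) * T 0 P₀)
                ≈⟨ D-snoc f (T 0) P₀ (m ℕ.+ a) ⟨
              D f (T 0) (P₀ ++ m ℕ.+ a ∷ [])
                ≡⟨ ≡.cong (D f (T 0)) (window-snoc a m) ⟨
              D f (T 0) X
                ≈⟨ T-relation b L L⊆X ⟩
              0# ∎)) ⟩
          (sign P₀ * r ⁻¹) * 0# + (- sign P₀ * r ⁻¹) * E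
            ≈⟨ solve 2 (λ s x → s :* :0 :+ x := x) refl _ _ ⟩
          (- sign P₀ * r ⁻¹) * E ∎

    -- Reduction of all windows to the initial one.

    words : List ℕ → ℕ → List (List ℕ)
    words xs zero    = [] ∷ []
    words xs (suc i) = concatMap (λ x → map (x ∷_) (words xs i)) xs

    ∈-words : ∀ {xs} L → L ⊆ xs → L ∈ words xs (length L)
    ∈-words         []      _  = here ≡.refl
    ∈-words {xs} (x ∷ L) L⊆ = ∈-concatMap⁺ (λ x → map (x ∷_) (words xs (length L)))
      (lose (L⊆ (here ≡.refl)) (∈-map⁺ (x ∷_) (∈-words L (λ e → L⊆ (there e)))))

    generators : ℕ → List (ℕ → Carrier)
    generators i = map (λ L b → T b L) (words (window 0 m) i)

    -- Induction on a: a list in the window at a + 1 is rewritten as a combination of lists in the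
    -- window at a. `reduce` treats its elements one by one, P being the part already inside the
    -- earlier window.
    T-span : ∀ a i L → L ⊆ window a m → length L ≡ i → Span (generators i) (λ b → T b L)
    T-span zero    i L L⊆ ≡.refl = Span-generator (generators i) (∈-map⁺ _ (∈-words L L⊆))
    T-span (suc a) i L L⊆ e      = reduce [] L (λ ()) (λ x → there (L⊆ x)) e
      where
      P₁ : List ℕ
      P₁ = window a m
      into : P₁ ⊆ window a (suc m)
      into = window-⊆-snoc a m

      reduce : ∀ P Q → P ⊆ P₁ → Q ⊆ window a (suc m) → length (P ++ Q) ≡ i →
        Span (generators i) (λ b → T b (P ++ Q))
      reduce P []      P⊆ _  e = T-span a i (P ++ []) (λ x → P⊆ (≡.subst (_ ∈_) (++-identityʳ P) x)) e
      reduce P (z ∷ Q) P⊆ Q⊆ e = Span-resp (generators i)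
        (λ b → sym (alternating-front (T-alternating b) P z Q))
        (Span-scale (generators i) (sign P) front)
        where
        length′ : ∀ z → length (z ∷ P ++ Q) ≡ i
        length′ z = ≡.trans (≡.cong suc (length-++ P)) (≡.trans (≡.sym (ℕ.+-suc _ _))
          (≡.trans (≡.sym (length-++ P)) e))
        inner : ∀ {z} → z ∈ P₁ → Span (generators i) (λ b → T b (z ∷ P ++ Q))
        inner {z} z∈ = reduce (z ∷ P) Q (λ { (here ≡.refl) → z∈ ; (there x) → P⊆ x })
          (λ x → Q⊆ (there x)) (length′ z)
        PQ⊆ : P ++ Q ⊆ window a (suc m)
        PQ⊆ x with ∈-++⁻ P x
        ... | inj₁ p = into (P⊆ p)
        ... | inj₂ q = Q⊆ (there q)
        front : Span (generators i) (λ b → T b (z ∷ P ++ Q))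
        front with ∈-++⁻ P₁ (≡.subst (z ∈_) (window-snoc a m) (Q⊆ (here ≡.refl)))
        ... | inj₁ z∈            = inner z∈
        -- Here z = m + a, the only member of the window of length m + 1 that lies outside `P₁`.
        ... | inj₂ (here ≡.refl) = let κ , relation = T-last a in
          Span-resp (generators i) (λ b → sym (relation b (P ++ Q) PQ⊆))
            (Span-scale (generators i) κ
              (Span-D (generators i) (λ z b → T b (z ∷ P ++ Q)) _ P₁ inner))

    length-window : ∀ a i → length (window a i) ≡ i
    length-window a zero    = ≡.refl
    length-window a (suc i) = ≡.cong suc (length-window (suc a) i)

    basis : ℕ → List (ℕ → Carrier)
    basis i = map (λ f b → gauge i b * f b) (generators i)

    φ-span : ∀ i a → i ℕ.≤ m → Span (basis i) (φ i a)
    φ-span i a i≤m = Span-resp (basis i)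
      (λ b → begin
        gauge i b * T b (window a i)           ≈⟨ *-congˡ (T-window b i a (ℕ.m≤n⇒m≤1+n i≤m)) ⟩
        gauge i b * (gauge i b * φ i a b)      ≈⟨ *-assoc _ _ _ ⟨
        (gauge i b * gauge i b) * φ i a b      ≈⟨ *-congʳ (gauge-square i b) ⟩
        1# * φ i a b                           ≈⟨ *-identityˡ _ ⟩
        φ i a b                                ∎)
      (Span-map (gauge i) (λ b → b) (generators i)
        (T-span a i (window a i) (window-mono i≤m a) (length-window a i)))

-- Linear dependence and linear recurrences.

module LinearRecurrence {c ℓ} (K : DiscreteField c ℓ) where
  open DiscreteField K hiding (zero)
  open RingSolver commutativeRing
  open Spans commutativeRing
  open import Data.Empty using (⊥-elim)
  open import Data.Fin.Base as Fin using (Fin; toℕ; fromℕ)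
  open import Data.List.Base using (List; []; _∷_; _++_; map; replicate)
  open import Data.List.Relation.Unary.Any using (Any; here; there)
  open import Data.Nat.Base as ℕ using (ℕ; zero; suc; s≤s)
  open import Data.Nat.DivMod using (_%_; _/_; m≡m%n+[m/n]*n; m%n<n)
  import Data.Nat.Properties as ℕ
  open import Data.Nat.Solver using (module +-*-Solver)
  open import Data.Product.Base using (Σ; ∃; _×_; _,_; proj₁; proj₂)
  open import Data.Sum.Base using (_⊎_; inj₁; inj₂)
  open import Relation.Binary.PropositionalEquality as ≡ using (_≡_)
  open import Relation.Binary.Reasoning.Setoid setoid
  open import Relation.Nullary using (yes; no)

  combine : List Carrier → (ℕ → Carrier) → Carrier
  combine []       f = 0#
  combine (c ∷ cs) f = c * f 0 + combine cs (λ k → f (suc k))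

  Nontrivial : List Carrier → Set _
  Nontrivial = Any (λ c → ¬ c ≈ 0#)

  private
    double : ℕ → ℕ
    double zero    = zero
    double (suc k) = suc (suc (double k))

    interleave : List Carrier → (p q : ℕ → Carrier) → List Carrier
    interleave []       p q = []
    interleave (c ∷ cs) p q = c * p 0 ∷ c * q 0 ∷ interleave cs (λ k → p (suc k)) (λ k → q (suc k))

    combine-interleave : ∀ cs p q f →
      combine (interleave cs p q) f ≈ combine cs (λ k → p k * f (double k) + q k * f (suc (double k)))
    combine-interleave []       p q f = refl
    combine-interleave (c ∷ cs) p q f = trans
      (+-congˡ (+-congˡ (combine-interleave cs (λ k → p (suc k)) (λ k → q (suc k)) (λ k → f (suc (suc k))))))
      (solve 6 (λ c p f q g r → c :* p :* f :+ (c :* q :* g :+ r) := c :* (p :* f :+ q :* g) :+ r) refl _ _ _ _ _ _)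

    interleave-nontrivial : ∀ cs p q → (∀ k → ¬ p k ≈ 0# ⊎ ¬ q k ≈ 0#) →
      Nontrivial cs → Nontrivial (interleave cs p q)
    interleave-nontrivial (c ∷ cs) p q pq (there e) =
      there (there (interleave-nontrivial cs _ _ (λ k → pq (suc k)) e))
    interleave-nontrivial (c ∷ cs) p q pq (here c≉0) with pq 0
    ... | inj₁ p≉0 = here (*-nonzero c≉0 p≉0)
    ... | inj₂ q≉0 = there (here (*-nonzero c≉0 q≉0))

  module _ {S : Set} where

    -- Eliminates the generators one at a time: a suitable combination of the members 2k and 2k + 1
    -- of the sequence no longer involves the first generator.
    dependent : ∀ bs (f : ℕ → S → Carrier) → (∀ k → Span bs (f k)) →
      ∃ λ cs → Nontrivial cs × (∀ s → combine cs (λ k → f k s) ≈ 0#)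
    dependent []       f p = 1# ∷ [] , here 1≉0 , λ s →
      trans (+-identityʳ _) (trans (*-identityˡ _) (Level.lower (p 0) s))
    dependent (b ∷ bs) f p =
      let cs , nontrivial , e = dependent bs f′ span
      in interleave cs x y , interleave-nontrivial cs x y (λ k → proj₁ (proj₂ (proj₂ (weights k)))) nontrivial ,
         λ s → trans (combine-interleave cs x y (λ k → f k s)) (e s)
      where
      α : ℕ → Carrier
      α k = proj₁ (p k)

      -- That the weights do not both vanish keeps the resulting dependence nontrivial; hence the
      -- case distinction on the first coefficient.
      weights : ∀ k → Σ Carrier λ x → Σ Carrier λ y → (¬ x ≈ 0# ⊎ ¬ y ≈ 0#) ×
        x * α (double k) + y * α (suc (double k)) ≈ 0#
      weights k with zero? (α (double k))
      ... | yes α≈0 = 1# , 0# , inj₁ 1≉0 , trans (+-congʳ (*-congˡ α≈0))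
        (solve 1 (λ a → :1 :* :0 :+ :0 :* a := :0) refl _)
      ... | no α≉0 = α (suc (double k)) , - α (double k) ,
        inj₂ (λ e → α≉0 (trans (solve 1 (λ a → a := :- (:- a)) refl _)
          (trans (-‿cong e) (solve 0 (:- :0 := :0) refl)))) ,
        solve 2 (λ a b → b :* a :+ (:- a) :* b := :0) refl _ _

      x y : ℕ → Carrier
      x k = proj₁ (weights k)
      y k = proj₁ (proj₂ (weights k))

      f′ : ℕ → S → Carrier
      f′ k s = x k * f (double k) s + y k * f (suc (double k)) s

      span : ∀ k → Span bs (f′ k)
      span k = Span-resp bs (λ s → trans
        (solve 7 (λ x y f g α β b →
          x :* (f :- α :* b) :+ y :* (g :- β :* b) := x :* f :+ y :* g :- (x :* α :+ y :* β) :* b)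
          refl (x k) (y k) _ _ (α (double k)) (α (suc (double k))) (b s))
        (trans (+-congˡ (-‿cong (*-congʳ (proj₂ (proj₂ (proj₂ (weights k)))))))
          (solve 2 (λ z b → z :- :0 :* b := z) refl _ (b s))))
        (Span-linear bs (x k) (y k) (proj₂ (p (double k))) (proj₂ (p (suc (double k)))))

    Span-++ˡ : ∀ bs cs {f : S → Carrier} → Span bs f → Span (bs ++ cs) f
    Span-++ˡ []       cs (Level.lift p) = Span-resp cs (λ s → sym (p s)) (Span-zero cs)
    Span-++ˡ (b ∷ bs) cs (α , p)        = α , Span-++ˡ bs cs p

    Span-++ʳ : ∀ bs cs {f : S → Carrier} → Span cs f → Span (bs ++ cs) f
    Span-++ʳ []       cs p = p
    Span-++ʳ (b ∷ bs) cs p = 0# , Span-resp (bs ++ cs)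
      (λ s → solve 2 (λ f b → f := f :- :0 :* b) refl _ (b s)) (Span-++ʳ bs cs p)

  sumFin : ∀ k → (Fin k → Carrier) → Carrier
  sumFin zero    f = 0#
  sumFin (suc k) f = f Fin.zero + sumFin k (λ i → f (Fin.suc i))

  private
    trimTrailing : ∀ cs → (∀ f → combine cs f ≈ 0#) ⊎
      (Σ ℕ λ M → Σ (Fin (suc M) → Carrier) λ h → ¬ h (fromℕ M) ≈ 0# ×
        (∀ f → combine cs f ≈ sumFin (suc M) (λ i → h i * f (toℕ i))))
    trimTrailing []       = inj₁ λ f → refl
    trimTrailing (c ∷ cs) with trimTrailing cs
    ... | inj₂ (M , h , last , e) = inj₂ (suc M , (λ { Fin.zero → c ; (Fin.suc i) → h i }) , last ,
      λ f → +-congˡ (e (λ k → f (suc k))))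
    ... | inj₁ e with zero? c
    ...   | yes c≈0 = inj₁ λ f → trans (+-cong (trans (*-congʳ c≈0) (zeroˡ _)) (e _)) (+-identityˡ _)
    ...   | no c≉0  = inj₂ (0 , (λ _ → c) , c≉0 , λ f → +-congˡ (e _))

  -- A recurrence must have nonzero first and last coefficients, so zeros are removed at both ends;
  -- k counts those removed in front and becomes a shift of the sequence.
  trim : ∀ cs → Nontrivial cs → Σ ℕ λ k → Σ ℕ λ M → Σ (Fin (suc M) → Carrier) λ h →
    ¬ h Fin.zero ≈ 0# × ¬ h (fromℕ M) ≈ 0# ×
    (∀ f → combine cs f ≈ sumFin (suc M) (λ i → h i * f (k ℕ.+ toℕ i)))
  trim (c ∷ cs) nontrivial with zero? c
  trim (c ∷ cs) (here c≉0) | yes c≈0 = ⊥-elim (c≉0 c≈0)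
  trim (c ∷ cs) (there nt) | yes c≈0 =
    let k , M , h , first , last , e = trim cs nt
    in suc k , M , h , first , last , λ f →
      trans (+-cong (trans (*-congʳ c≈0) (zeroˡ _)) (e (λ k → f (suc k)))) (+-identityˡ _)
  trim (c ∷ cs) _ | no c≉0 with trimTrailing cs
  ... | inj₁ e                  = 0 , 0 , (λ _ → c) , c≉0 , c≉0 , λ f → +-congˡ (e _)
  ... | inj₂ (M , h , last , e) = 0 , suc M , (λ { Fin.zero → c ; (Fin.suc i) → h i }) , c≉0 , last ,
    λ f → +-congˡ (e (λ k → f (suc k)))

  private
    combine-zeros : ∀ n cs f → combine (replicate n 0# ++ cs) f ≈ combine cs (λ k → f (n ℕ.+ k))
    combine-zeros zero    cs f = refl
    combine-zeros (suc n) cs f = trans (+-cong (zeroˡ _) (combine-zeros n cs (λ k → f (suc k)))) (+-identityˡ _)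

    spread : ℕ → List Carrier → List Carrier
    spread n []       = []
    spread n (c ∷ cs) = c ∷ replicate n 0# ++ spread n cs

    combine-spread : ∀ n cs f → combine (spread n cs) f ≈ combine cs (λ k → f (k ℕ.* suc n))
    combine-spread n []       f = refl
    combine-spread n (c ∷ cs) f = +-congˡ (trans (combine-zeros n (spread n cs) (λ k → f (suc k)))
      (combine-spread n cs (λ k → f (suc (n ℕ.+ k)))))

    ++-nontrivial : ∀ n {cs} → Nontrivial cs → Nontrivial (replicate n 0# ++ cs)
    ++-nontrivial zero    nt = nt
    ++-nontrivial (suc n) nt = there (++-nontrivial n nt)

    spread-nontrivial : ∀ n {cs} → Nontrivial cs → Nontrivial (spread n cs)
    spread-nontrivial n (here c≉0) = here c≉0
    spread-nontrivial n (there nt) = there (++-nontrivial n (spread-nontrivial n nt))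

  -- From a common span and a period to a recurrence along the diagonal.

  module _ (φ : ℕ → ℕ → Carrier) (n : ℕ) (period : ∀ a b → φ (suc n ℕ.+ a) b ≈ φ a (2 ℕ.* suc n ℕ.+ b))
           (bs : List (ℕ → Carrier)) (span : ∀ a → Span bs (φ a)) where

    private
      N : ℕ
      N = 2 ℕ.* suc n

      period* : ∀ j a b → φ (j ℕ.* suc n ℕ.+ a) b ≈ φ a (j ℕ.* N ℕ.+ b)
      period* zero    a b = refl
      period* (suc j) a b = begin
        φ (suc n ℕ.+ j ℕ.* suc n ℕ.+ a) b       ≡⟨ ≡.cong (λ k → φ k b) (ℕ.+-assoc (suc n) (j ℕ.* suc n) a) ⟩
        φ (suc n ℕ.+ (j ℕ.* suc n ℕ.+ a)) b     ≈⟨ period _ b ⟩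
        φ (j ℕ.* suc n ℕ.+ a) (N ℕ.+ b)         ≈⟨ period* j a (N ℕ.+ b) ⟩
        φ a (j ℕ.* N ℕ.+ (N ℕ.+ b))             ≡⟨ ≡.cong (φ a) (solve′ 3 (λ j N b → j ⊗ N ⊕ (N ⊕ b) ⊜ N ⊕ j ⊗ N ⊕ b) ≡.refl (j) N b) ⟩
        φ a (N ℕ.+ j ℕ.* N ℕ.+ b)               ∎
        where open +-*-Solver using () renaming (solve to solve′; _:+_ to _⊕_; _:*_ to _⊗_; _:=_ to _⊜_)

    module _ (a b : ℕ) where
      private
        δ : ℕ → ℕ → Carrier
        δ x y with x ℕ.≟ y
        ... | yes _ = 1#
        ... | no _  = 0#

        r β : ℕ → ℕ
        r t = t % N
        β t = 6 ℕ.* suc n ℕ.* (t / N) ℕ.+ (r t ℕ.+ b)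

        Φ : ℕ → ℕ → ℕ → Carrier
        Φ k ρ t = φ (3 ℕ.* suc n ℕ.* k ℕ.+ (ρ ℕ.+ a)) (β t)

        -- The period is used twice: to move the part of the second coordinate that depends on k
        -- to the first coordinate, and then the part of the first one that depends on t / N back.
        diagonal : ∀ k t → φ (t ℕ.+ k ℕ.* N ℕ.+ a) (t ℕ.+ k ℕ.* N ℕ.+ b) ≈ Φ k (r t) t
        diagonal k t = begin
          φ (t ℕ.+ k ℕ.* N ℕ.+ a) (t ℕ.+ k ℕ.* N ℕ.+ b)
            ≡⟨ ≡.cong₂ (λ x y → φ (x ℕ.+ k ℕ.* N ℕ.+ a) (y ℕ.+ k ℕ.* N ℕ.+ b)) (m≡m%n+[m/n]*n t N) (m≡m%n+[m/n]*n t N) ⟩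
          φ (r t ℕ.+ q ℕ.* N ℕ.+ k ℕ.* N ℕ.+ a) (r t ℕ.+ q ℕ.* N ℕ.+ k ℕ.* N ℕ.+ b)
            ≡⟨ ≡.cong₂ φ
                (solve′ 5 (λ r q k n a → r ⊕ q ⊗ (con′ 2 ⊗ n) ⊕ k ⊗ (con′ 2 ⊗ n) ⊕ a ⊜
                  con′ 2 ⊗ (q ⊕ k) ⊗ n ⊕ (r ⊕ a)) ≡.refl (r t) q k (suc n) a)
                (solve′ 5 (λ r q k n b → r ⊕ q ⊗ (con′ 2 ⊗ n) ⊕ k ⊗ (con′ 2 ⊗ n) ⊕ b ⊜
                  k ⊗ (con′ 2 ⊗ n) ⊕ (q ⊗ (con′ 2 ⊗ n) ⊕ (r ⊕ b))) ≡.refl (r t) q k (suc n) b) ⟩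
          φ a₀ (k ℕ.* N ℕ.+ (q ℕ.* N ℕ.+ (r t ℕ.+ b)))
            ≈⟨ period* k a₀ _ ⟨
          φ (k ℕ.* suc n ℕ.+ a₀) b₀
            ≡⟨ ≡.cong (λ x → φ x b₀)
                (solve′ 5 (λ r q k n a → k ⊗ n ⊕ (con′ 2 ⊗ (q ⊕ k) ⊗ n ⊕ (r ⊕ a)) ⊜
                  con′ 2 ⊗ q ⊗ n ⊕ (con′ 3 ⊗ n ⊗ k ⊕ (r ⊕ a))) ≡.refl (r t) q k (suc n) a) ⟩
          φ (2 ℕ.* q ℕ.* suc n ℕ.+ (3 ℕ.* suc n ℕ.* k ℕ.+ (r t ℕ.+ a))) b₀
            ≈⟨ period* (2 ℕ.* q) _ b₀ ⟩
          φ (3 ℕ.* suc n ℕ.* k ℕ.+ (r t ℕ.+ a)) (2 ℕ.* q ℕ.* N ℕ.+ b₀)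
            ≡⟨ ≡.cong (φ (3 ℕ.* suc n ℕ.* k ℕ.+ (r t ℕ.+ a)))
                (solve′ 4 (λ r q n b → con′ 2 ⊗ q ⊗ (con′ 2 ⊗ n) ⊕ (q ⊗ (con′ 2 ⊗ n) ⊕ (r ⊕ b)) ⊜
                  con′ 6 ⊗ n ⊗ q ⊕ (r ⊕ b)) ≡.refl (r t) q (suc n) b) ⟩
          Φ k (r t) t ∎
          where
          open +-*-Solver using () renaming (solve to solve′; _:+_ to _⊕_; _:*_ to _⊗_; _:=_ to _⊜_; con to con′)
          q  = t / N
          a₀ = 2 ℕ.* (q ℕ.+ k) ℕ.* suc n ℕ.+ (r t ℕ.+ a)
          b₀ = q ℕ.* N ℕ.+ (r t ℕ.+ b)

        -- While t stays in one residue class modulo N, the first coordinate in `Φ k (r t) t`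
        -- depends only on k, so `span` applies. The indicator of the class cuts the generators down
        -- to it, and there are only N classes.
        pulled : ℕ → List (ℕ → Carrier)
        pulled ρ = map (λ f t → δ (r t) ρ * f (β t)) bs

        residues : ℕ → List (ℕ → Carrier)
        residues zero    = []
        residues (suc R) = residues R ++ pulled R

        partial : ℕ → ℕ → ℕ → Carrier
        partial k zero    t = 0#
        -- The factors `1#` give this the form of `Span-linear`.
        partial k (suc R) t = 1# * partial k R t + 1# * (δ (r t) R * Φ k R t)

        partial-span : ∀ k R → Span (residues R) (partial k R)
        partial-span k zero    = Span-zero []
        partial-span k (suc R) = Span-linear (residues R ++ pulled R) 1# 1#
          (Span-++ˡ (residues R) (pulled R) (partial-span k R))
          (Span-++ʳ (residues R) (pulled R) (Span-map (λ t → δ (r t) R) β bs (span _)))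

        partial-above : ∀ k R t → R ℕ.≤ r t → partial k R t ≈ 0#
        partial-above k zero    t _  = refl
        partial-above k (suc R) t R≤ with r t ℕ.≟ R
        ... | yes e = ⊥-elim (ℕ.<⇒≢ R≤ (≡.sym e))
        ... | no _  = trans (+-congʳ (*-congˡ (partial-above k R t (ℕ.<⇒≤ R≤))))
          (solve 1 (λ x → :1 :* :0 :+ :1 :* (:0 :* x) := :0) refl _)

        partial-below : ∀ k R t → r t ℕ.< R → partial k R t ≈ Φ k (r t) t
        partial-below k (suc R) t (s≤s r≤R) with r t ℕ.≟ R
        ... | yes e = trans (+-cong (*-congˡ (partial-above k R t (ℕ.≤-reflexive (≡.sym e))))
            (*-congˡ (*-congˡ (reflexive (≡.cong (λ ρ → Φ k ρ t) (≡.sym e))))))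
          (solve 1 (λ x → :1 :* :0 :+ :1 :* (:1 :* x) := x) refl _)
        ... | no ≢  = trans (+-congʳ (*-congˡ (partial-below k R t (ℕ.≤∧≢⇒< r≤R ≢))))
          (solve 2 (λ x y → :1 :* x :+ :1 :* (:0 :* y) := x) refl _ _)

      diagonal-recurrence : Σ ℕ λ k → Σ ℕ λ M → Σ (Fin (suc M) → Carrier) λ h →
        ¬ h Fin.zero ≈ 0# × ¬ h (fromℕ M) ≈ 0# ×
        (∀ t → sumFin (suc M) (λ i → h i * φ (t ℕ.+ (k ℕ.+ toℕ i) ℕ.+ a) (t ℕ.+ (k ℕ.+ toℕ i) ℕ.+ b)) ≈ 0#)
      diagonal-recurrence =
        let cs , nt , e = dependent (residues N) (λ k t → φ (t ℕ.+ k ℕ.* N ℕ.+ a) (t ℕ.+ k ℕ.* N ℕ.+ b))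
              (λ k → Span-resp (residues N)
                (λ t → trans (partial-below k N t (m%n<n t N)) (sym (diagonal k t))) (partial-span k N))
            -- The dependence is between members N apart, so N - 1 zeros are inserted between its
            -- coefficients; the sum is N - 1 in the form to which `2 * suc n` reduces.
            k , M , h , first , last , e′ = trim (spread (n ℕ.+ suc (n ℕ.+ 0)) cs) (spread-nontrivial _ nt)
        in k , M , h , first , last , λ t →
          trans (sym (e′ (λ k → φ (t ℕ.+ k ℕ.+ a) (t ℕ.+ k ℕ.+ b))))
          (trans (combine-spread _ cs (λ k → φ (t ℕ.+ k ℕ.+ a) (t ℕ.+ k ℕ.+ b))) (e t))

-- Lexicographic orders compatible with addition.

module Lexicographic where
  open import Data.Sum.Base using (_⊎_; inj₁; inj₂)
  open import Data.Vec.Base using (Vec; []; _∷_; zipWith)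
  open import Relation.Binary.PropositionalEquality using (_≡_; refl; cong)

  record IsOrdered {A : Set} (_∙_ : A → A → A) (_<_ : A → A → Set) : Set where
    field
      compare : ∀ x y → x < y ⊎ x ≡ y ⊎ y < x
      irrefl  : ∀ {x} → ¬ x < x
      trans   : ∀ {x y z} → x < y → y < z → x < z
      monoʳ   : ∀ z {x y} → x < y → (z ∙ x) < (z ∙ y)

  data Lex {A : Set} (_<_ : A → A → Set) : ∀ {n} → Vec A n → Vec A n → Set where
    this : ∀ {n x y} {xs ys : Vec A n} → x < y → Lex _<_ (x ∷ xs) (y ∷ ys)
    next : ∀ {n x} {xs ys : Vec A n} → Lex _<_ xs ys → Lex _<_ (x ∷ xs) (x ∷ ys)

  lex-isOrdered : ∀ {A : Set} {_∙_ : A → A → A} {_<_ : A → A → Set} → IsOrdered _∙_ _<_ →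
    ∀ {n} → IsOrdered (zipWith _∙_) (Lex _<_ {n})
  lex-isOrdered {A} {_∙_} {_<_} ordered = record
    { compare = compare′ ; irrefl = irrefl′ ; trans = trans′ ; monoʳ = monoʳ′ }
    where
    open IsOrdered ordered
    compare′ : ∀ {n} (xs ys : Vec A n) → Lex _<_ xs ys ⊎ xs ≡ ys ⊎ Lex _<_ ys xs
    compare′ []       []       = inj₂ (inj₁ refl)
    compare′ (x ∷ xs) (y ∷ ys) with compare x y
    ... | inj₁ x<y         = inj₁ (this x<y)
    ... | inj₂ (inj₂ y<x)  = inj₂ (inj₂ (this y<x))
    ... | inj₂ (inj₁ refl) with compare′ xs ys
    ...   | inj₁ l        = inj₁ (next l)
    ...   | inj₂ (inj₁ e) = inj₂ (inj₁ (cong (x ∷_) e))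
    ...   | inj₂ (inj₂ g) = inj₂ (inj₂ (next g))
    irrefl′ : ∀ {n} {xs : Vec A n} → ¬ Lex _<_ xs xs
    irrefl′ (this p) = irrefl p
    irrefl′ (next p) = irrefl′ p
    trans′ : ∀ {n} {xs ys zs : Vec A n} → Lex _<_ xs ys → Lex _<_ ys zs → Lex _<_ xs zs
    trans′ (this p) (this q) = this (trans p q)
    trans′ (this p) (next q) = this p
    trans′ (next p) (this q) = this q
    trans′ (next p) (next q) = next (trans′ p q)
    monoʳ′ : ∀ {n} (zs : Vec A n) {xs ys} → Lex _<_ xs ys → Lex _<_ (zipWith _∙_ zs xs) (zipWith _∙_ zs ys)
    monoʳ′ (z ∷ zs) (this p) = this (monoʳ z p)
    monoʳ′ (z ∷ zs) (next p) = next (monoʳ′ zs p)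

-- The ring of Laurent polynomials.

module LaurentRing (r c : Data.Nat.Base.ℕ) where
  open Lexicographic
  open import Data.Empty using (⊥-elim)
  open import Data.Integer.Base as ℤ using (ℤ; +_; 0ℤ; 1ℤ; _+_; _*_; -_; _-_)
  import Data.Integer.Properties as ℤ
  open import Data.Integer.Solver using (module +-*-Solver)
  open +-*-Solver
  open import Data.List.Base using (List; []; _∷_; map)
  open import Data.List.Membership.Propositional using (_∈_)
  open import Data.List.Relation.Unary.Any using (here; there)
  open import Data.Product.Base using (∃; _×_; _,_; proj₁; proj₂)
  open import Data.Sum.Base using (_⊎_; inj₁; inj₂; [_,_]′)
  import Data.Vec.Properties as Vec
  open import Level using (0ℓ)
  open import Relation.Binary.PropositionalEquality
  open import Relation.Nullary using (yes; no)
  open ≡-Reasoning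

  private
    L = Laurent r c
    E = Exp r c

  +E-comm : ∀ (e f : E) → e +E f ≡ f +E e
  +E-comm = Vec.zipWith-comm (Vec.zipWith-comm ℤ.+-comm)

  +E-assoc : ∀ (e f g : E) → (e +E f) +E g ≡ e +E (f +E g)
  +E-assoc = Vec.zipWith-assoc (Vec.zipWith-assoc ℤ.+-assoc)

  +E-identityˡ : ∀ (e : E) → 0E +E e ≡ e
  +E-identityˡ = Vec.zipWith-identityˡ (Vec.zipWith-identityˡ ℤ.+-identityˡ)

  -- The linear functional with arbitrary values φ on monomials; `coeff` is the case of a Kronecker
  -- delta.
  eval : (E → ℤ) → L → ℤ
  eval φ []            = 0ℤ
  eval φ ((a , e) ∷ p) = a * φ e + eval φ p

  δ : E → E → ℤ
  δ e g with e ≟E g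
  ... | yes _ = 1ℤ
  ... | no _  = 0ℤ

  δ-refl : ∀ e → δ e e ≡ 1ℤ
  δ-refl e with e ≟E e
  ... | yes _  = refl
  ... | no e≢e = ⊥-elim (e≢e refl)

  δ-≢ : ∀ {e g} → e ≢ g → δ e g ≡ 0ℤ
  δ-≢ {e} {g} e≢g with e ≟E g
  ... | yes e≡g = ⊥-elim (e≢g e≡g)
  ... | no _    = refl

  coeff-eval : ∀ p g → coeff p g ≡ eval (λ e → δ e g) p
  coeff-eval []            g = refl
  coeff-eval ((a , e) ∷ p) g with e ≟E g
  ... | yes _ = cong₂ _+_ (sym (ℤ.*-identityʳ a)) (coeff-eval p g)
  ... | no _  = trans (coeff-eval p g) (solve 2 (λ a x → x := a :* con 0ℤ :+ x) refl a _)

  eval-cong : ∀ {φ ψ} → (∀ e → φ e ≡ ψ e) → ∀ p → eval φ p ≡ eval ψ p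
  eval-cong φ≡ψ []            = refl
  eval-cong φ≡ψ ((a , e) ∷ p) = cong₂ _+_ (cong (a *_) (φ≡ψ e)) (eval-cong φ≡ψ p)

  eval-linear : ∀ x y φ ψ p → eval (λ e → x * φ e + y * ψ e) p ≡ x * eval φ p + y * eval ψ p
  eval-linear x y φ ψ []            = solve 2 (λ x y → con 0ℤ := x :* con 0ℤ :+ y :* con 0ℤ) refl x y
  eval-linear x y φ ψ ((a , e) ∷ p) = trans (cong (_+_ (a * (x * φ e + y * ψ e))) (eval-linear x y φ ψ p))
    (solve 7 (λ x y a f g u v → a :* (x :* f :+ y :* g) :+ (x :* u :+ y :* v) :=
      x :* (a :* f :+ u) :+ y :* (a :* g :+ v)) refl x y a (φ e) (ψ e) _ _)

  eval-scale : ∀ x φ p → eval (λ e → x * φ e) p ≡ x * eval φ p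
  eval-scale x φ p = begin
    eval (λ e → x * φ e) p             ≡⟨ eval-cong (λ e → solve 2 (λ x f → x :* f := x :* f :+ con 0ℤ :* f) refl x (φ e)) p ⟩
    eval (λ e → x * φ e + 0ℤ * φ e) p  ≡⟨ eval-linear x 0ℤ φ φ p ⟩
    x * eval φ p + 0ℤ * eval φ p       ≡⟨ ℤ.+-identityʳ _ ⟩
    x * eval φ p                       ∎

  -- Induction on the list. Replacing φ by φ′, which vanishes at the head exponent, removes the head
  -- and keeps the hypothesis for the tail; the part subtracted evaluates to the coefficient at that
  -- exponent times `φ e₀`.
  eval-vanish : ∀ φ p → (∀ e → coeff p e * φ e ≡ 0ℤ) → eval φ p ≡ 0ℤ
  eval-vanish φ []             v = refl
  eval-vanish φ ((a , e₀) ∷ p) v = begin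
    eval φ ((a , e₀) ∷ p)
      ≡⟨ eval-cong (λ e → solve 3 (λ f g d → f := con 1ℤ :* (f :- g :* d) :+ g :* d) refl (φ e) (φ e₀) (δ e e₀)) ((a , e₀) ∷ p) ⟩
    eval (λ e → 1ℤ * φ′ e + φ e₀ * δ e e₀) ((a , e₀) ∷ p)
      ≡⟨ eval-linear 1ℤ (φ e₀) φ′ (λ e → δ e e₀) ((a , e₀) ∷ p) ⟩
    1ℤ * (a * φ′ e₀ + eval φ′ p) + φ e₀ * eval (λ e → δ e e₀) ((a , e₀) ∷ p)
      ≡⟨ cong₂ _+_ (cong (1ℤ *_) (cong₂ (λ x y → a * x + y) φ′e₀ (eval-vanish φ′ p v′)))
           (trans (cong (φ e₀ *_) (sym (coeff-eval ((a , e₀) ∷ p) e₀))) (trans (ℤ.*-comm (φ e₀) _) (v e₀))) ⟩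
    1ℤ * (a * 0ℤ + 0ℤ) + 0ℤ
      ≡⟨ solve 1 (λ a → con 1ℤ :* (a :* con 0ℤ :+ con 0ℤ) :+ con 0ℤ := con 0ℤ) refl a ⟩
    0ℤ ∎
    where
    φ′ : E → ℤ
    φ′ e = φ e - φ e₀ * δ e e₀
    φ′e₀ : φ′ e₀ ≡ 0ℤ
    φ′e₀ = trans (cong (λ d → φ e₀ - φ e₀ * d) (δ-refl e₀)) (solve 1 (λ f → f :- f :* con 1ℤ := con 0ℤ) refl (φ e₀))
    v′ : ∀ e → coeff p e * φ′ e ≡ 0ℤ
    v′ e with e₀ ≟E e | v e
    ... | yes refl | _  = trans (cong (coeff p e₀ *_) φ′e₀) (ℤ.*-zeroʳ (coeff p e₀))
    ... | no e₀≢e  | ve = trans (cong (λ d → coeff p e * (φ e - φ e₀ * d)) (δ-≢ (λ e≡ → e₀≢e (sym e≡))))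
      (trans (cong (coeff p e *_) (solve 2 (λ f g → f :- g :* con 0ℤ := f) refl (φ e) (φ e₀))) ve)

  eval-+ : ∀ φ p q → eval φ (p +L q) ≡ eval φ p + eval φ q
  eval-+ φ []            q = sym (ℤ.+-identityˡ _)
  eval-+ φ ((a , e) ∷ p) q = trans (cong (_+_ (a * φ e)) (eval-+ φ p q)) (sym (ℤ.+-assoc (a * φ e) _ _))

  -L_ : L → L
  -L_ = map (λ t → - proj₁ t , proj₂ t)

  eval-neg : ∀ φ p → eval φ (-L p) ≡ - eval φ p
  eval-neg φ []            = refl
  eval-neg φ ((a , e) ∷ p) = trans (cong (_+_ (- a * φ e)) (eval-neg φ p))
    (solve 3 (λ a f x → (:- a) :* f :+ (:- x) := :- (a :* f :+ x)) refl a (φ e) _)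

  eval-* : ∀ φ p q → eval φ (p *L q) ≡ eval (λ e → eval (λ f → φ (e +E f)) q) p
  eval-* φ []            q = refl
  eval-* φ ((a , e) ∷ p) q = trans (eval-+ φ (map _ q) (p *L q)) (cong₂ _+_ (monomial q) (eval-* φ p q))
    where
    monomial : ∀ q → eval φ (map (λ s → a * proj₁ s , e +E proj₂ s) q) ≡ a * eval (λ f → φ (e +E f)) q
    monomial []            = sym (ℤ.*-zeroʳ a)
    monomial ((b , f) ∷ q) = trans (cong (_+_ (a * b * φ (e +E f))) (monomial q))
      (solve 4 (λ a b f x → a :* b :* f :+ a :* x := a :* (b :* f :+ x)) refl a b (φ (e +E f)) _)

  eval-swap : ∀ (Φ : E → E → ℤ) p q → eval (λ e → eval (Φ e) q) p ≡ eval (λ f → eval (λ e → Φ e f) p) q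
  eval-swap Φ []            q = sym (eval-vanish _ q λ e → ℤ.*-zeroʳ (coeff q e))
  eval-swap Φ ((a , e) ∷ p) q = begin
    a * eval (Φ e) q + eval (λ e → eval (Φ e) q) p
      ≡⟨ cong (_+_ (a * eval (Φ e) q)) (trans (eval-swap Φ p q) (sym (ℤ.*-identityˡ _))) ⟩
    a * eval (Φ e) q + 1ℤ * eval (λ f → eval (λ e → Φ e f) p) q
      ≡⟨ eval-linear a 1ℤ (Φ e) _ q ⟨
    eval (λ f → a * Φ e f + 1ℤ * eval (λ e → Φ e f) p) q
      ≡⟨ eval-cong (λ f → cong (_+_ (a * Φ e f)) (ℤ.*-identityˡ _)) q ⟩
    eval (λ f → a * Φ e f + eval (λ e → Φ e f) p) q ∎

  -- Equality of all evaluations, which is equivalent to _≈L_ and makes the ring laws immediate.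
  infix 4 _≋_
  _≋_ : L → L → Set
  p ≋ q = ∀ φ → eval φ p ≡ eval φ q

  ≋⇒≈ : ∀ {p q} → p ≋ q → p ≈L q
  ≋⇒≈ {p} {q} e g = trans (coeff-eval p g) (trans (e _) (sym (coeff-eval q g)))

  coeff-+ : ∀ p q g → coeff (p +L q) g ≡ coeff p g + coeff q g
  coeff-+ p q g = trans (coeff-eval (p +L q) g) (trans (eval-+ _ p q)
    (cong₂ _+_ (sym (coeff-eval p g)) (sym (coeff-eval q g))))

  coeff-neg : ∀ p g → coeff (-L p) g ≡ - coeff p g
  coeff-neg p g = trans (coeff-eval (-L p) g) (trans (eval-neg _ p) (cong -_ (sym (coeff-eval p g))))

  ≈⇒≋ : ∀ {p q} → p ≈L q → p ≋ q
  ≈⇒≋ {p} {q} p≈q φ = begin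
    eval φ p                         ≡⟨ solve 2 (λ x y → x := (x :+ (:- y)) :+ y) refl (eval φ p) (eval φ q) ⟩
    (eval φ p + - eval φ q) + eval φ q ≡⟨ cong (_+ eval φ q) (trans (cong (_+_ (eval φ p)) (sym (eval-neg φ q)))
                                          (trans (sym (eval-+ φ p (-L q))) (eval-vanish φ (p +L (-L q)) vanish))) ⟩
    0ℤ + eval φ q                    ≡⟨ ℤ.+-identityˡ _ ⟩
    eval φ q                         ∎
    where
    vanish : ∀ e → coeff (p +L (-L q)) e * φ e ≡ 0ℤ
    vanish e = trans (cong (_* φ e) (trans (coeff-+ p (-L q) e) (trans (cong₂ _+_ (p≈q e) (coeff-neg q e)) (ℤ.+-inverseʳ (coeff q e)))))
      (ℤ.*-zeroˡ (φ e))

  commutativeRing : CommutativeRing 0ℓ 0ℓ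
  commutativeRing = record
    { Carrier = L ; _≈_ = _≈L_ ; _+_ = _+L_ ; _*_ = _*L_ ; -_ = -L_ ; 0# = 0L ; 1# = 1L
    ; isCommutativeRing = record
      { isRing = record
        { +-isAbelianGroup = record
          { isGroup = record
            { isMonoid = record
              { isSemigroup = record
                { isMagma = record
                  { isEquivalence = record
                    { refl = λ _ → refl ; sym = λ e g → sym (e g) ; trans = λ e f g → trans (e g) (f g) }
                  ; ∙-cong = λ {p} {p′} {q} {q′} e f g →
                      trans (coeff-+ p q g) (trans (cong₂ _+_ (e g) (f g)) (sym (coeff-+ p′ q′ g)))
                  }
                ; assoc = λ p q s g → begin
                    coeff ((p +L q) +L s) g              ≡⟨ trans (coeff-+ (p +L q) s g) (cong (_+ coeff s g) (coeff-+ p q g)) ⟩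
                    coeff p g + coeff q g + coeff s g    ≡⟨ ℤ.+-assoc (coeff p g) (coeff q g) (coeff s g) ⟩
                    coeff p g + (coeff q g + coeff s g)  ≡⟨ trans (coeff-+ p (q +L s) g) (cong (_+_ (coeff p g)) (coeff-+ q s g)) ⟨
                    coeff (p +L (q +L s)) g              ∎
                }
              ; identity = (λ p g → refl) , λ p g → trans (coeff-+ p 0L g) (ℤ.+-identityʳ _)
              }
            ; inverse = (λ p g → trans (coeff-+ (-L p) p g) (trans (cong (_+ coeff p g) (coeff-neg p g)) (ℤ.+-inverseˡ (coeff p g)))) ,
                        (λ p g → trans (coeff-+ p (-L p) g) (trans (cong (_+_ (coeff p g)) (coeff-neg p g)) (ℤ.+-inverseʳ (coeff p g))))
            ; ⁻¹-cong = λ {p} {q} e g → trans (coeff-neg p g) (trans (cong -_ (e g)) (sym (coeff-neg q g)))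
            }
          ; comm = λ p q g → trans (coeff-+ p q g) (trans (ℤ.+-comm (coeff p g) (coeff q g)) (sym (coeff-+ q p g)))
          }
        ; *-cong = λ {p} {p′} {q} {q′} e f → ≋⇒≈ {p *L q} {p′ *L q′} λ φ → begin
            eval φ (p *L q)                                ≡⟨ eval-* φ p q ⟩
            eval (λ e → eval (λ f → φ (e +E f)) q) p       ≡⟨ ≈⇒≋ {p} {p′} e _ ⟩
            eval (λ e → eval (λ f → φ (e +E f)) q) p′      ≡⟨ eval-cong (λ e → ≈⇒≋ {q} {q′} f _) p′ ⟩
            eval (λ e → eval (λ f → φ (e +E f)) q′) p′     ≡⟨ eval-* φ p′ q′ ⟨
            eval φ (p′ *L q′)                              ∎
        ; *-assoc = λ p q s → ≋⇒≈ {(p *L q) *L s} {p *L (q *L s)} (*-assoc p q s)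
        ; *-identity = (λ p → ≋⇒≈ {1L *L p} {p} (*-identityˡ p)) ,
                       (λ p → ≋⇒≈ {p *L 1L} {p} λ φ → trans (*-comm p 1L φ) (*-identityˡ p φ))
        ; distrib = (λ p q s → ≋⇒≈ {p *L (q +L s)} {(p *L q) +L (p *L s)} λ φ →
                      trans (*-comm p (q +L s) φ) (trans (distribʳ p q s φ)
                        (trans (eval-+ φ (q *L p) (s *L p)) (trans (cong₂ _+_ (*-comm q p φ) (*-comm s p φ)) (sym (eval-+ φ (p *L q) (p *L s))))))) ,
                    (λ p q s → ≋⇒≈ {(q +L s) *L p} {(q *L p) +L (s *L p)} (distribʳ p q s))
        }
      ; *-comm = λ p q → ≋⇒≈ {p *L q} {q *L p} (*-comm p q)
      }
    }
    where
    *-comm : ∀ p q → (p *L q) ≋ (q *L p)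
    *-comm p q φ = begin
      eval φ (p *L q)                             ≡⟨ eval-* φ p q ⟩
      eval (λ e → eval (λ f → φ (e +E f)) q) p    ≡⟨ eval-swap (λ e f → φ (e +E f)) p q ⟩
      eval (λ f → eval (λ e → φ (e +E f)) p) q    ≡⟨ eval-cong (λ f → eval-cong (λ e → cong φ (+E-comm e f)) p) q ⟩
      eval (λ f → eval (λ e → φ (f +E e)) p) q    ≡⟨ eval-* φ q p ⟨
      eval φ (q *L p)                             ∎
    *-identityˡ : ∀ p → (1L *L p) ≋ p
    *-identityˡ p φ = begin
      eval φ (1L *L p)                                ≡⟨ eval-* φ 1L p ⟩
      1ℤ * eval (λ f → φ (0E +E f)) p + 0ℤ            ≡⟨ trans (ℤ.+-identityʳ _) (ℤ.*-identityˡ _) ⟩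
      eval (λ f → φ (0E +E f)) p                      ≡⟨ eval-cong (λ f → cong φ (+E-identityˡ f)) p ⟩
      eval φ p                                        ∎
    *-assoc : ∀ p q s → ((p *L q) *L s) ≋ (p *L (q *L s))
    *-assoc p q s φ = begin
      eval φ ((p *L q) *L s)
        ≡⟨ trans (eval-* φ (p *L q) s) (eval-* _ p q) ⟩
      eval (λ e → eval (λ f → eval (λ g → φ ((e +E f) +E g)) s) q) p
        ≡⟨ eval-cong (λ e → eval-cong (λ f → eval-cong (λ g → cong φ (+E-assoc e f g)) s) q) p ⟩
      eval (λ e → eval (λ f → eval (λ g → φ (e +E (f +E g))) s) q) p
        ≡⟨ trans (eval-* φ p (q *L s)) (eval-cong (λ e → eval-* _ q s) p) ⟨
      eval φ (p *L (q *L s)) ∎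
    distribʳ : ∀ p q s → ((q +L s) *L p) ≋ ((q *L p) +L (s *L p))
    distribʳ p q s φ = begin
      eval φ ((q +L s) *L p)           ≡⟨ trans (eval-* φ (q +L s) p) (eval-+ _ q s) ⟩
      eval _ q + eval _ s              ≡⟨ cong₂ _+_ (eval-* φ q p) (eval-* φ s p) ⟨
      eval φ (q *L p) + eval φ (s *L p) ≡⟨ eval-+ φ (q *L p) (s *L p) ⟨
      eval φ ((q *L p) +L (s *L p))    ∎

  -- Leading terms and absence of zero divisors.

  private
    _<E_ : E → E → Set
    _<E_ = Lex (Lex ℤ._<_)

    ordered : IsOrdered _+E_ _<E_
    ordered = lex-isOrdered (lex-isOrdered record
      { compare = λ x y → case-cmp (ℤ.<-cmp x y)
      ; irrefl  = ℤ.<-irrefl refl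
      ; trans   = ℤ.<-trans
      ; monoʳ   = λ z → ℤ.+-monoʳ-< z
      })
      where
      open import Relation.Binary.Definitions using (Tri; tri<; tri≈; tri>)
      case-cmp : ∀ {x y} → Tri (x ℤ.< y) (x ≡ y) (y ℤ.< x) → x ℤ.< y ⊎ x ≡ y ⊎ y ℤ.< x
      case-cmp (tri< a _ _) = inj₁ a
      case-cmp (tri≈ _ b _) = inj₂ (inj₁ b)
      case-cmp (tri> _ _ c) = inj₂ (inj₂ c)
    open IsOrdered ordered using (compare; irrefl; monoʳ) renaming (trans to <-trans)

    monoˡ : ∀ z {x y} → x <E y → (x +E z) <E (y +E z)
    monoˡ z {x} {y} x<y = subst₂ _<E_ (+E-comm z x) (+E-comm z y) (monoʳ z x<y)

    Leading : L → E → Set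
    Leading p e = coeff p e ≢ 0ℤ × (∀ f → e <E f → coeff p f ≡ 0ℤ)

    coeff-support : ∀ (p : L) e → coeff p e ≢ 0ℤ → e ∈ map proj₂ p
    coeff-support []            e ≢0 = ⊥-elim (≢0 refl)
    coeff-support ((a , f) ∷ p) e ≢0 with f ≟E e
    ... | yes refl = here refl
    ... | no _     = there (coeff-support p e ≢0)

    -- Terms of a list may cancel, so only exponents with nonzero coefficient compete.
    maximum : ∀ p es → (∀ {f} → f ∈ es → coeff p f ≡ 0ℤ) ⊎
      ∃ λ e → coeff p e ≢ 0ℤ × (∀ {f} → f ∈ es → e <E f → coeff p f ≡ 0ℤ)
    maximum p []       = inj₁ λ ()
    maximum p (e ∷ es) with coeff p e ℤ.≟ 0ℤ | maximum p es
    ... | yes z | inj₁ v            = inj₁ λ { (here refl) → z ; (there i) → v i }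
    ... | yes z | inj₂ (d , d≢ , v) = inj₂ (d , d≢ , λ { (here refl) _ → z ; (there i) → v i })
    ... | no e≢ | inj₁ v            = inj₂ (e , e≢ , λ { (here refl) e<e → ⊥-elim (irrefl e<e) ; (there i) _ → v i })
    ... | no e≢ | inj₂ (d , d≢ , v) with compare d e
    ...   | inj₁ d<e         = inj₂ (e , e≢ , λ { (here refl) e<e → ⊥-elim (irrefl e<e) ; (there i) e<f → v i (<-trans d<e e<f) })
    ...   | inj₂ (inj₁ refl) = inj₂ (d , d≢ , λ { (here refl) e<e → ⊥-elim (irrefl e<e) ; (there i) → v i })
    ...   | inj₂ (inj₂ e<d)  = inj₂ (d , d≢ , λ { (here refl) d<e → ⊥-elim (irrefl (<-trans e<d d<e)) ; (there i) → v i })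

    leading : ∀ p → p ≈L 0L ⊎ ∃ (Leading p)
    leading p with maximum p (map proj₂ p)
    ... | inj₁ v = inj₁ (support v)
      where
      support : (∀ {f} → f ∈ map proj₂ p → coeff p f ≡ 0ℤ) → p ≈L 0L
      support v f with coeff p f ℤ.≟ 0ℤ
      ... | yes z = z
      ... | no ≢0 = v (coeff-support p f ≢0)
    ... | inj₂ (e , e≢ , v) = inj₂ (e , e≢ , support)
      where
      support : ∀ f → e <E f → coeff p f ≡ 0ℤ
      support f e<f with coeff p f ℤ.≟ 0ℤ
      ... | yes z = z
      ... | no ≢0 = v (coeff-support p f ≢0) e<f

  ≈0? : ∀ p → Dec (p ≈L 0L)
  ≈0? p with leading p
  ... | inj₁ p≈0           = yes p≈0
  ... | inj₂ (e , e≢ , _)  = no λ p≈0 → e≢ (p≈0 e)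

  private
    eval-single : ∀ φ p e → (∀ f → f ≢ e → coeff p f * φ f ≡ 0ℤ) → eval φ p ≡ coeff p e * φ e
    eval-single φ p e v = begin
      eval φ p
        ≡⟨ eval-cong (λ f → solve 3 (λ f g d → f := con 1ℤ :* (f :- g :* d) :+ g :* d) refl (φ f) (φ e) (δ f e)) p ⟩
      eval (λ f → 1ℤ * (φ f - φ e * δ f e) + φ e * δ f e) p
        ≡⟨ eval-linear 1ℤ (φ e) _ _ p ⟩
      1ℤ * eval (λ f → φ f - φ e * δ f e) p + φ e * eval (λ f → δ f e) p
        ≡⟨ cong₂ (λ x y → 1ℤ * x + φ e * y) (eval-vanish _ p vanish) (sym (coeff-eval p e)) ⟩
      1ℤ * 0ℤ + φ e * coeff p e
        ≡⟨ solve 2 (λ f c → con 1ℤ :* con 0ℤ :+ f :* c := c :* f) refl (φ e) (coeff p e) ⟩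
      coeff p e * φ e ∎
      where
      vanish : ∀ f → coeff p f * (φ f - φ e * δ f e) ≡ 0ℤ
      vanish f with f ≟E e
      ... | yes refl = solve 2 (λ c f → c :* (f :- f :* con 1ℤ) := con 0ℤ) refl (coeff p f) (φ f)
      ... | no f≢e   = trans (solve 3 (λ c f g → c :* (f :- g :* con 0ℤ) := c :* f) refl (coeff p f) (φ f) (φ e)) (v f f≢e)

    zero-* : ∀ {x} y → x ≡ 0ℤ → x * y ≡ 0ℤ
    zero-* y refl = ℤ.*-zeroˡ y

    *-zero : ∀ x {y} → y ≡ 0ℤ → x * y ≡ 0ℤ
    *-zero x refl = ℤ.*-zeroʳ x

    -- An exponent above e or f has coefficient zero, and lowering either of them strictly lowers
    -- the sum. Hence e + f arises only from the two leading terms.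
    coeff-leading : ∀ p q e f → Leading p e → Leading q f →
      coeff (p *L q) (e +E f) ≡ coeff p e * coeff q f
    coeff-leading p q e f (_ , p-top) (_ , q-top) = begin
      coeff (p *L q) (e +E f)        ≡⟨ trans (coeff-eval (p *L q) (e +E f)) (eval-* _ p q) ⟩
      eval ψ p                       ≡⟨ eval-single ψ p e (λ e′ ≢ → p-term e′ (compare e e′) ≢) ⟩
      coeff p e * ψ e                ≡⟨ cong (coeff p e *_) (eval-single _ q f (λ f′ ≢ → q-term f′ (compare f f′) ≢)) ⟩
      coeff p e * (coeff q f * δ (e +E f) (e +E f)) ≡⟨ cong (λ d → coeff p e * (coeff q f * d)) (δ-refl (e +E f)) ⟩
      coeff p e * (coeff q f * 1ℤ)   ≡⟨ cong (coeff p e *_) (ℤ.*-identityʳ (coeff q f)) ⟩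
      coeff p e * coeff q f          ∎
      where
      ψ : E → ℤ
      ψ e′ = eval (λ f′ → δ (e′ +E f′) (e +E f)) q
      <⇒≢ : ∀ {x y} → x <E y → x ≢ y
      <⇒≢ x<y refl = irrefl x<y
      q-term : ∀ f′ → f <E f′ ⊎ f ≡ f′ ⊎ f′ <E f → f′ ≢ f → coeff q f′ * δ (e +E f′) (e +E f) ≡ 0ℤ
      q-term f′ (inj₁ f<f′)        _ = zero-* _ (q-top f′ f<f′)
      q-term f′ (inj₂ (inj₁ refl)) ≢ = ⊥-elim (≢ refl)
      q-term f′ (inj₂ (inj₂ f′<f)) _ = *-zero (coeff q f′) (δ-≢ (<⇒≢ (monoʳ e f′<f)))
      below : ∀ e′ → e′ <E e → ∀ f′ → f <E f′ ⊎ f ≡ f′ ⊎ f′ <E f → coeff q f′ * δ (e′ +E f′) (e +E f) ≡ 0ℤ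
      below e′ e′<e f′ (inj₁ f<f′)        = zero-* _ (q-top f′ f<f′)
      below e′ e′<e f′ (inj₂ (inj₁ refl)) = *-zero (coeff q f′) (δ-≢ (<⇒≢ (monoˡ f e′<e)))
      below e′ e′<e f′ (inj₂ (inj₂ f′<f)) = *-zero (coeff q f′) (δ-≢ (<⇒≢ (<-trans (monoˡ f′ e′<e) (monoʳ e f′<f))))
      p-term : ∀ e′ → e <E e′ ⊎ e ≡ e′ ⊎ e′ <E e → e′ ≢ e → coeff p e′ * ψ e′ ≡ 0ℤ
      p-term e′ (inj₁ e<e′)        _ = zero-* _ (p-top e′ e<e′)
      p-term e′ (inj₂ (inj₁ refl)) ≢ = ⊥-elim (≢ refl)
      p-term e′ (inj₂ (inj₂ e′<e)) _ = *-zero (coeff p e′)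
        (eval-vanish _ q λ f′ → below e′ e′<e f′ (compare f f′))

  *-nonzero : ∀ {p q} → ¬ p ≈L 0L → ¬ q ≈L 0L → ¬ (p *L q) ≈L 0L
  *-nonzero {p} {q} p≉0 q≉0 pq≈0 with leading p | leading q
  ... | inj₁ p≈0 | _        = p≉0 p≈0
  ... | inj₂ _   | inj₁ q≈0 = q≉0 q≈0
  ... | inj₂ (e , lp) | inj₂ (f , lq) =
    [ proj₁ lp , proj₁ lq ]′ (ℤ.i*j≡0⇒i≡0∨j≡0 (coeff p e) (trans (sym (coeff-leading p q e f lp lq)) (pq≈0 (e +E f))))

  -- The value at x = (1, …, 1).
  augmentation : L → ℤ
  augmentation = eval (λ _ → 1ℤ)

  augmentation-* : ∀ p q → augmentation (p *L q) ≡ augmentation p * augmentation q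
  augmentation-* p q = begin
    augmentation (p *L q)                        ≡⟨ eval-* _ p q ⟩
    eval (λ _ → augmentation q) p                ≡⟨ eval-cong (λ _ → sym (ℤ.*-identityʳ _)) p ⟩
    eval (λ _ → augmentation q * 1ℤ) p           ≡⟨ eval-scale (augmentation q) _ p ⟩
    augmentation q * augmentation p              ≡⟨ ℤ.*-comm (augmentation q) _ ⟩
    augmentation p * augmentation q              ∎

  augmentation-nonzero : ∀ {p} → augmentation p ≢ 0ℤ → ¬ p ≈L 0L
  augmentation-nonzero {p} ≢0 p≈0 = ≢0 (≈⇒≋ {p} {0L} p≈0 _)

-- Fraction fields of domains with decidable equality to zero.

record IsDiscreteDomain {c ℓ} (R : CommutativeRing c ℓ) : Set (c Level.⊔ ℓ) where
  open CommutativeRing R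
  field
    1≉0       : ¬ 1# ≈ 0#
    ≈0?       : ∀ x → Dec (x ≈ 0#)
    *-nonzero : ∀ {x y} → ¬ x ≈ 0# → ¬ y ≈ 0# → ¬ x * y ≈ 0#

module FractionField {c ℓ} (R : CommutativeRing c ℓ) (isDomain : IsDiscreteDomain R) where
  open CommutativeRing R
  open IsDiscreteDomain isDomain
  open RingSolver R
  open import Data.Empty using (⊥-elim)
  open import Data.Fin.Base as Fin using (Fin)
  open import Data.Nat.Base as ℕ using (ℕ)
  open import Data.Product.Base using (∃; _×_; _,_)
  open import Relation.Binary.Reasoning.Setoid setoid
  open import Relation.Nullary using (yes; no)

  ≈-cancelˡ : ∀ {x y z} → ¬ x ≈ 0# → x * y ≈ x * z → y ≈ z
  ≈-cancelˡ {x} {y} {z} x≉0 e with ≈0? (y - z)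
  ... | yes y-z≈0 = begin
    y           ≈⟨ solve 2 (λ y z → y := (y :- z) :+ z) refl y z ⟩
    (y - z) + z ≈⟨ +-congʳ y-z≈0 ⟩
    0# + z      ≈⟨ +-identityˡ z ⟩
    z           ∎
  ... | no y-z≉0 = ⊥-elim (*-nonzero x≉0 y-z≉0 (begin
    x * (y - z)     ≈⟨ solve 3 (λ x y z → x :* (y :- z) := x :* y :- x :* z) refl x y z ⟩
    x * y - x * z   ≈⟨ +-congʳ e ⟩
    x * z - x * z   ≈⟨ -‿inverseʳ _ ⟩
    0#              ∎))

  record Fraction : Set (c Level.⊔ ℓ) where
    constructor fraction
    field
      num   : Carrier
      den   : Carrier
      den≉0 : ¬ den ≈ 0#
  open Fraction public

  infix 4 _≃_
  record _≃_ (x y : Fraction) : Set ℓ where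
    constructor cross
    field uncross : num x * den y ≈ num y * den x
  open _≃_ public

  private
    infixl 6 _⊕_
    infixl 7 _⊗_
    _⊕_ _⊗_ : Fraction → Fraction → Fraction
    x ⊕ y = fraction (num x * den y + num y * den x) (den x * den y) (*-nonzero (den≉0 x) (den≉0 y))
    x ⊗ y = fraction (num x * num y) (den x * den y) (*-nonzero (den≉0 x) (den≉0 y))

    ⊖_ : Fraction → Fraction
    ⊖ x = fraction (- num x) (den x) (den≉0 x)

  embedding : Carrier → Fraction
  embedding x = fraction x 1# 1≉0

  private
    inv : Fraction → Fraction
    inv x with ≈0? (num x)
    ... | yes _  = embedding 0#
    ... | no x≉0 = fraction (den x) (num x) x≉0

    ≃-trans : ∀ {x y z} → x ≃ y → y ≃ z → x ≃ z
    ≃-trans {x} {y} {z} (cross p) (cross q) = cross (≈-cancelˡ (den≉0 y) (begin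
      den y * (num x * den z)   ≈⟨ solve 3 (λ a b c → b :* (a :* c) := a :* b :* c) refl _ _ _ ⟩
      (num x * den y) * den z   ≈⟨ *-congʳ p ⟩
      (num y * den x) * den z   ≈⟨ solve 3 (λ a b c → a :* b :* c := a :* c :* b) refl _ _ _ ⟩
      (num y * den z) * den x   ≈⟨ *-congʳ q ⟩
      (num z * den y) * den x   ≈⟨ solve 3 (λ a b c → a :* b :* c := b :* (a :* c)) refl _ _ _ ⟩
      den y * (num z * den x)   ∎))

    ⊕-cong : ∀ {x x′ y y′} → x ≃ x′ → y ≃ y′ → x ⊕ y ≃ x′ ⊕ y′
    ⊕-cong {x} {x′} {y} {y′} (cross p) (cross q) = cross (begin
      (num x * den y + num y * den x) * (den x′ * den y′)
        ≈⟨ solve 6 (λ a b c d e f → (a :* d :+ c :* b) :* (e :* f) :=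
             (a :* e) :* (d :* f) :+ (c :* f) :* (b :* e)) refl _ _ _ _ _ _ ⟩
      (num x * den x′) * (den y * den y′) + (num y * den y′) * (den x * den x′)
        ≈⟨ +-cong (*-congʳ p) (*-congʳ q) ⟩
      (num x′ * den x) * (den y * den y′) + (num y′ * den y) * (den x * den x′)
        ≈⟨ solve 6 (λ a b c d e f → (a :* b) :* (d :* f) :+ (c :* d) :* (b :* e) :=
             (a :* f :+ c :* e) :* (b :* d)) refl _ _ _ _ _ _ ⟩
      (num x′ * den y′ + num y′ * den x′) * (den x * den y) ∎)

    ⊗-cong : ∀ {x x′ y y′} → x ≃ x′ → y ≃ y′ → x ⊗ y ≃ x′ ⊗ y′
    ⊗-cong {x} {x′} {y} {y′} (cross p) (cross q) = cross (begin
      (num x * num y) * (den x′ * den y′)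
        ≈⟨ solve 4 (λ a b c d → (a :* b) :* (c :* d) := (a :* c) :* (b :* d)) refl _ _ _ _ ⟩
      (num x * den x′) * (num y * den y′)
        ≈⟨ *-cong p q ⟩
      (num x′ * den x) * (num y′ * den y)
        ≈⟨ solve 4 (λ a b c d → (a :* b) :* (c :* d) := (a :* c) :* (b :* d)) refl _ _ _ _ ⟩
      (num x′ * num y′) * (den x * den y) ∎)

  num≈0⇒≃0 : ∀ {x} → num x ≈ 0# → x ≃ embedding 0#
  num≈0⇒≃0 {x} e = cross (begin
    num x * 1#   ≈⟨ *-congʳ e ⟩
    0# * 1#      ≈⟨ solve 1 (λ d → :0 :* :1 := :0 :* d) refl _ ⟩
    0# * den x   ∎)

  ≃0⇒num≈0 : ∀ {x} → x ≃ embedding 0# → num x ≈ 0#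
  ≃0⇒num≈0 {x} (cross e) = begin
    num x        ≈⟨ *-identityʳ _ ⟨
    num x * 1#   ≈⟨ e ⟩
    0# * den x   ≈⟨ zeroˡ _ ⟩
    0#           ∎

  fractionField : DiscreteField (c Level.⊔ ℓ) ℓ
  fractionField = record
    { commutativeRing = record
      { Carrier = Fraction ; _≈_ = _≃_ ; _+_ = _⊕_ ; _*_ = _⊗_ ; -_ = ⊖_
      ; 0# = embedding 0# ; 1# = embedding 1#
      ; isCommutativeRing = record
        { isRing = record
          { +-isAbelianGroup = record
            { isGroup = record
              { isMonoid = record
                { isSemigroup = record
                  { isMagma = record
                    { isEquivalence = record
                      { refl = cross refl ; sym = λ e → cross (sym (uncross e)) ; trans = ≃-trans }
                    ; ∙-cong = ⊕-cong
                    }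
                  ; assoc = λ x y z → cross (solve 6 (λ a b c d e f →
                      ((a :* d :+ c :* b) :* f :+ e :* (b :* d)) :* (b :* (d :* f)) :=
                      (a :* (d :* f) :+ (c :* f :+ e :* d) :* b) :* (b :* d :* f))
                      refl (num x) (den x) (num y) (den y) (num z) (den z))
                  }
                ; identity =
                    (λ x → cross (solve 2 (λ a b → (:0 :* b :+ a :* :1) :* b := a :* (:1 :* b)) refl (num x) (den x))) ,
                    (λ x → cross (solve 2 (λ a b → (a :* :1 :+ :0 :* b) :* b := a :* (b :* :1)) refl (num x) (den x)))
                }
              ; inverse =
                  (λ x → cross (solve 2 (λ a b → ((:- a) :* b :+ a :* b) :* :1 := :0 :* (b :* b)) refl (num x) (den x))) ,
                  (λ x → cross (solve 2 (λ a b → (a :* b :+ (:- a) :* b) :* :1 := :0 :* (b :* b)) refl (num x) (den x)))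
              ; ⁻¹-cong = λ {x} {y} (cross e) → cross (begin
                  - num x * den y     ≈⟨ solve 2 (λ a b → (:- a) :* b := :- (a :* b)) refl _ _ ⟩
                  - (num x * den y)   ≈⟨ -‿cong e ⟩
                  - (num y * den x)   ≈⟨ solve 2 (λ a b → :- (a :* b) := (:- a) :* b) refl _ _ ⟩
                  - num y * den x     ∎)
              }
            ; comm = λ x y → cross (solve 4 (λ a b c d →
                (a :* d :+ c :* b) :* (d :* b) := (c :* b :+ a :* d) :* (b :* d))
                refl (num x) (den x) (num y) (den y))
            }
          ; *-cong = ⊗-cong
          ; *-assoc = λ x y z → cross (solve 6 (λ a b c d e f →
              (a :* c :* e) :* (b :* (d :* f)) := (a :* (c :* e)) :* (b :* d :* f))
              refl (num x) (den x) (num y) (den y) (num z) (den z))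
          ; *-identity =
              (λ x → cross (solve 2 (λ a b → (:1 :* a) :* b := a :* (:1 :* b)) refl (num x) (den x))) ,
              (λ x → cross (solve 2 (λ a b → (a :* :1) :* b := a :* (b :* :1)) refl (num x) (den x)))
          ; distrib =
              (λ x y z → cross (solve 6 (λ a b c d e f →
                (a :* (c :* f :+ e :* d)) :* ((b :* d) :* (b :* f)) :=
                ((a :* c) :* (b :* f) :+ (a :* e) :* (b :* d)) :* (b :* (d :* f)))
                refl (num x) (den x) (num y) (den y) (num z) (den z))) ,
              (λ x y z → cross (solve 6 (λ a b c d e f →
                ((c :* f :+ e :* d) :* a) :* ((d :* b) :* (f :* b)) :=
                ((c :* a) :* (f :* b) :+ (e :* a) :* (d :* b)) :* ((d :* f) :* b))
                refl (num x) (den x) (num y) (den y) (num z) (den z)))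
          }
        ; *-comm = λ x y → cross (solve 4 (λ a b c d → (a :* c) :* (d :* b) := (c :* a) :* (b :* d))
            refl (num x) (den x) (num y) (den y))
        }
      }
    ; 1≉0 = λ e → 1≉0 (≃0⇒num≈0 {embedding 1#} e)
    ; zero? = decide
    ; _⁻¹ = inv
    ; ⁻¹-inverse = λ {x} → inverse x
    }
    where
    decide : ∀ x → Dec (x ≃ embedding 0#)
    decide x with ≈0? (num x)
    ... | yes e = yes (num≈0⇒≃0 {x} e)
    ... | no ≢  = no λ e → ≢ (≃0⇒num≈0 {x} e)
    inverse : ∀ x → ¬ x ≃ embedding 0# → inv x ⊗ x ≃ embedding 1#
    inverse x x≄0 with ≈0? (num x)
    ... | yes e = ⊥-elim (x≄0 (num≈0⇒≃0 {x} e))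
    ... | no _  = cross (solve 2 (λ a b → (b :* a) :* :1 := :1 :* (a :* b)) refl (num x) (den x))

  private module K = DiscreteField fractionField

  embedding-cong : ∀ {p q} → p ≈ q → embedding p ≃ embedding q
  embedding-cong p≈q = cross (*-congʳ p≈q)

  embedding-* : ∀ p q → embedding (p * q) ≃ embedding p K.* embedding q
  embedding-* p q = cross (solve 2 (λ p q → (p :* q) :* (:1 :* :1) := (p :* q) :* :1) refl p q)

  embedding-+ : ∀ p q → embedding (p + q) ≃ embedding p K.+ embedding q
  embedding-+ p q = cross (solve 2 (λ p q → (p :+ q) :* (:1 :* :1) := (p :* :1 :+ q :* :1) :* :1) refl p q)

  embedding-nonzero : ∀ {p} → ¬ p ≈ 0# → ¬ embedding p ≃ embedding 0#
  embedding-nonzero {p} p≉0 e = p≉0 (≃0⇒num≈0 {embedding p} e)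

  -- d is the product of all denominators.
  clearDenominators : ∀ k (h : Fin k → Fraction) → ∃ λ d → ¬ d ≈ 0# ×
    ∃ λ (H : Fin k → Carrier) → ∀ i → embedding (H i) ≃ embedding d K.* h i
  clearDenominators ℕ.zero    h = 1# , 1≉0 , (λ ()) , λ ()
  clearDenominators (ℕ.suc k) h =
    let d , d≉0 , H , e = clearDenominators k (λ i → h (Fin.suc i))
        p = num (h Fin.zero)
        q = den (h Fin.zero)
    in q * d , *-nonzero (den≉0 (h Fin.zero)) d≉0 ,
       (λ { Fin.zero → p * d ; (Fin.suc i) → q * H i }) ,
       λ { Fin.zero → cross (solve 3 (λ p q d → (p :* d) :* (:1 :* q) := ((q :* d) :* p) :* :1) refl p q d)
         ; (Fin.suc i) → K.trans (embedding-* q (H i)) (K.trans (K.*-congˡ {embedding q} (e i))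
             (K.trans (K.sym (K.*-assoc (embedding q) (embedding d) (h (Fin.suc i))))
               (K.*-congʳ {h (Fin.suc i)} (K.sym (embedding-* q d))))) }

  -- Pairs with second component 0 are sent to 0.
  toFraction : Carrier × Carrier → Fraction
  toFraction (p , q) with ≈0? q
  ... | yes _  = embedding 0#
  ... | no q≉0 = fraction p q q≉0

  toFraction-≃ : ∀ {p q p′ q′} → ¬ q ≈ 0# → ¬ q′ ≈ 0# → p * q′ ≈ p′ * q →
    toFraction (p , q) ≃ toFraction (p′ , q′)
  toFraction-≃ {p} {q} {p′} {q′} vx vy e with ≈0? q | ≈0? q′
  ... | yes z | _     = ⊥-elim (vx z)
  ... | no _  | yes z = ⊥-elim (vy z)
  ... | no _  | no _  = cross e

  toFraction-≃⁻ : ∀ {p q p′ q′} → ¬ q ≈ 0# → ¬ q′ ≈ 0# → toFraction (p , q) ≃ toFraction (p′ , q′) →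
    p * q′ ≈ p′ * q
  toFraction-≃⁻ {p} {q} {p′} {q′} vx vy e with ≈0? q | ≈0? q′
  ... | yes z | _     = ⊥-elim (vx z)
  ... | no _  | yes z = ⊥-elim (vy z)
  ... | no _  | no _  = uncross e

  toFraction-* : ∀ {p q p′ q′} → ¬ q ≈ 0# → ¬ q′ ≈ 0# →
    toFraction (p * p′ , q * q′) ≃ toFraction (p , q) K.* toFraction (p′ , q′)
  toFraction-* {p} {q} {p′} {q′} vx vy with ≈0? q | ≈0? q′ | ≈0? (q * q′)
  ... | yes z | _     | _     = ⊥-elim (vx z)
  ... | no _  | yes z | _     = ⊥-elim (vy z)
  ... | no _  | no _  | yes z = ⊥-elim (*-nonzero vx vy z)
  ... | no _  | no _  | no _  = cross refl

  toFraction-+ : ∀ {p q p′ q′} → ¬ q ≈ 0# → ¬ q′ ≈ 0# →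
    toFraction (p * q′ + p′ * q , q * q′) ≃ toFraction (p , q) K.+ toFraction (p′ , q′)
  toFraction-+ {p} {q} {p′} {q′} vx vy with ≈0? q | ≈0? q′ | ≈0? (q * q′)
  ... | yes z | _     | _     = ⊥-elim (vx z)
  ... | no _  | yes z | _     = ⊥-elim (vy z)
  ... | no _  | no _  | yes z = ⊥-elim (*-nonzero vx vy z)
  ... | no _  | no _  | no _  = cross refl

  toFraction-embedding : ∀ p → toFraction (p , 1#) ≃ embedding p
  toFraction-embedding p with ≈0? 1#
  ... | yes z = ⊥-elim (1≉0 z)
  ... | no _  = cross refl

-- Quotients of elements of a set P of nonzero elements closed under addition and multiplication.
-- The numerator by which such a quotient is given need not be in P itself.
module PositiveQuotients {c ℓ c′} (K : DiscreteField c ℓ) (A : Set c′) (_⊞_ _⊠_ : A → A → A) (1ᴬ : A)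
  (ι : A → DiscreteField.Carrier K) (P : A → Set) where
  open DiscreteField K
  open RingSolver commutativeRing
  open import Data.Product.Base using (∃₂; _×_; _,_)
  open import Relation.Binary.Reasoning.Setoid setoid

  record IsPositiveCone : Set (c Level.⊔ ℓ Level.⊔ c′) where
    field
      ι-+     : ∀ p q → ι (p ⊞ q) ≈ ι p + ι q
      ι-*     : ∀ p q → ι (p ⊠ q) ≈ ι p * ι q
      ι-1     : ι 1ᴬ ≈ 1#
      nonzero : ∀ {p} → P p → ¬ ι p ≈ 0#
      P-+     : ∀ p q → P p → P q → P (p ⊞ q)
      P-*     : ∀ p q → P p → P q → P (p ⊠ q)
      P-1     : P 1ᴬ

  Positive : Carrier → Set (c′ Level.⊔ ℓ)
  Positive x = ∃₂ λ p q → P p × P q × x * ι q ≈ ι p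

  module _ (isCone : IsPositiveCone) where
    open IsPositiveCone isCone

    positive-resp : ∀ {x y} → x ≈ y → Positive x → Positive y
    positive-resp e (p , q , pp , pq , h) = p , q , pp , pq , trans (*-congʳ (sym e)) h

    positive-ι : ∀ p → P p → Positive (ι p)
    positive-ι p pp = p , 1ᴬ , pp , P-1 , trans (*-congˡ ι-1) (*-identityʳ (ι p))

    positive-nonzero : ∀ {x} → Positive x → ¬ x ≈ 0#
    positive-nonzero (p , q , pp , pq , h) e = nonzero pp (trans (sym h) (trans (*-congʳ e) (zeroˡ _)))

    positive-* : ∀ {x y} → Positive x → Positive y → Positive (x * y)
    positive-* {x} {y} (p , q , pp , pq , h) (p′ , q′ , pp′ , pq′ , h′) =
      p ⊠ p′ , q ⊠ q′ , P-* p p′ pp pp′ , P-* q q′ pq pq′ , (begin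
        (x * y) * ι (q ⊠ q′)      ≈⟨ *-congˡ (ι-* q q′) ⟩
        (x * y) * (ι q * ι q′)    ≈⟨ solve 4 (λ x y q r → (x :* y) :* (q :* r) := (x :* q) :* (y :* r)) refl x y _ _ ⟩
        (x * ι q) * (y * ι q′)    ≈⟨ *-cong h h′ ⟩
        ι p * ι p′                ≈⟨ ι-* p p′ ⟨
        ι (p ⊠ p′)                ∎)

    positive-+ : ∀ {x y} → Positive x → Positive y → Positive (x + y)
    positive-+ {x} {y} (p , q , pp , pq , h) (p′ , q′ , pp′ , pq′ , h′) =
      (p ⊠ q′) ⊞ (p′ ⊠ q) , q ⊠ q′ ,
      P-+ _ _ (P-* p q′ pp pq′) (P-* p′ q pp′ pq) , P-* q q′ pq pq′ , (begin
        (x + y) * ι (q ⊠ q′)                ≈⟨ *-congˡ (ι-* q q′) ⟩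
        (x + y) * (ι q * ι q′)              ≈⟨ solve 4 (λ x y q r → (x :+ y) :* (q :* r) := (x :* q) :* r :+ (y :* r) :* q) refl x y _ _ ⟩
        (x * ι q) * ι q′ + (y * ι q′) * ι q ≈⟨ +-cong (*-congʳ h) (*-congʳ h′) ⟩
        ι p * ι q′ + ι p′ * ι q             ≈⟨ +-cong (ι-* p q′) (ι-* p′ q) ⟨
        ι (p ⊠ q′) + ι (p′ ⊠ q)             ≈⟨ ι-+ _ _ ⟨
        ι ((p ⊠ q′) ⊞ (p′ ⊠ q))             ∎)

    -- Serves the step of the recurrence, where the new value x times an old value y is a sum z of
    -- products of old values.
    positive-/ : ∀ {x y z} → x * y ≈ z → Positive y → Positive z → Positive x
    positive-/ {x} {y} {z} e (p , q , pp , pq , h) (p′ , q′ , pp′ , pq′ , h′) =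
      p′ ⊠ q , p ⊠ q′ , P-* p′ q pp′ pq , P-* p q′ pp pq′ , (begin
        x * ι (p ⊠ q′)              ≈⟨ *-congˡ (ι-* p q′) ⟩
        x * (ι p * ι q′)            ≈⟨ *-congˡ (*-congʳ h) ⟨
        x * (y * ι q * ι q′)        ≈⟨ solve 4 (λ x y q r → x :* (y :* q :* r) := ((x :* y) :* r) :* q) refl x y _ _ ⟩
        ((x * y) * ι q′) * ι q      ≈⟨ *-congʳ (trans (*-congʳ e) h′) ⟩
        ι p′ * ι q                  ≈⟨ ι-* p′ q ⟨
        ι (p′ ⊠ q)                  ∎)

-- Remainders of integers.

module IntegerRemainder where
  open import Data.Empty using (⊥-elim)
  open import Data.Integer.Base
  open import Data.Integer.DivMod using (n%ℕd<d; a≡a%ℕn+[a/ℕn]*n)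
  import Data.Integer.Properties as ℤ
  open import Data.Integer.Solver using (module +-*-Solver)
  open +-*-Solver
  import Data.Nat.Base as ℕ
  import Data.Nat.Properties as ℕ
  open import Relation.Binary.PropositionalEquality
  open ≡-Reasoning

  private
    unique⁺ : ∀ {r s} k d → r ℕ.< d → + r ≡ + s + + k * + d → r ≡ s
    unique⁺ {r} {s} ℕ.zero d r<d e = ℤ.+-injective (trans e (trans (cong (_+_ (+ s)) (ℤ.*-zeroˡ (+ d))) (ℤ.+-identityʳ (+ s))))
    unique⁺ {r} {s} (ℕ.suc k) d r<d e = ⊥-elim (ℕ.<⇒≱ r<d (subst (d ℕ.≤_) (sym r≡)
        (ℕ.≤-trans (ℕ.m≤m+n d (k ℕ.* d)) (ℕ.m≤n+m _ s))))
      where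
      r≡ : r ≡ s ℕ.+ (d ℕ.+ k ℕ.* d)
      r≡ = ℤ.+-injective (trans e (cong (_+_ (+ s)) (sym (ℤ.pos-* (ℕ.suc k) d))))

    unique : ∀ {r s} z d → r ℕ.< d → s ℕ.< d → + r ≡ + s + z * + d → r ≡ s
    unique (+ k)    d r<d s<d e = unique⁺ k d r<d e
    unique {r} {s} -[1+ k ] d r<d s<d e = sym (unique⁺ (ℕ.suc k) d s<d (begin
      + s                                                ≡⟨ solve 3 (λ s z d → s := s :+ (:- z) :* d :+ z :* d) refl (+ s) (+ ℕ.suc k) (+ d) ⟩
      + s + - (+ ℕ.suc k) * + d + + ℕ.suc k * + d        ≡⟨ cong (λ r → r + + ℕ.suc k * + d) e ⟨
      + r + + ℕ.suc k * + d                              ∎))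

  %ℕ-shift : ∀ x y d .{{_ : ℕ.NonZero d}} → (x + y * + d) %ℕ d ≡ x %ℕ d
  %ℕ-shift x y d = unique (y + x /ℕ d - (x + y * + d) /ℕ d) d (n%ℕd<d (x + y * + d) d) (n%ℕd<d x d) (begin
    + ((x + y * + d) %ℕ d)
      ≡⟨ solve 2 (λ r s → r := (r :+ s) :- s) refl (+ ((x + y * + d) %ℕ d)) (q * + d) ⟩
    (+ ((x + y * + d) %ℕ d) + q * + d) - q * + d
      ≡⟨ cong (λ z → z - q * + d) (sym (a≡a%ℕn+[a/ℕn]*n (x + y * + d) d)) ⟩
    x + y * + d - q * + d
      ≡⟨ cong (λ z → z + y * + d - q * + d) (a≡a%ℕn+[a/ℕn]*n x d) ⟩
    + (x %ℕ d) + x /ℕ d * + d + y * + d - q * + d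
      ≡⟨ solve 5 (λ r p y d q → r :+ p :* d :+ y :* d :- q :* d := r :+ (y :+ p :- q) :* d) refl
           (+ (x %ℕ d)) (x /ℕ d) y (+ d) q ⟩
    + (x %ℕ d) + (y + x /ℕ d - q) * + d ∎)
    where q = (x + y * + d) /ℕ d

-- The field of rational functions, with its positive elements.

module RationalFunctionFields where
  open import Data.Fin.Base using (Fin)
  open import Data.Integer.Base using (1ℤ)
  open import Data.List.Base using ([]; _∷_)
  open import Data.Product.Base using (∃; _×_; _,_)

  -- Abstract, since unfolding the arithmetic of fractions is prohibitively expensive.
  record RationalFunctionField (r c : Data.Nat.Base.ℕ) : Set₁ where
    field K : DiscreteField Level.zero Level.zero
    open DiscreteField K hiding (zero)
    field
      toField    : Frac r c → Carrier
      toField-≈  : ∀ x y → ValidF x → ValidF y → x ≈F y → toField x ≈ toField y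
      toField-≈⁻ : ∀ x y → ValidF x → ValidF y → toField x ≈ toField y → x ≈F y
      toField-*  : ∀ x y → ValidF x → ValidF y → toField (x *F y) ≈ toField x * toField y
      toField-+  : ∀ x y → ValidF x → ValidF y → toField (x +F y) ≈ toField x + toField y
      toField-0  : toField 0F ≈ 0#
      toField-1  : toField 1F ≈ 1#
      valid-*    : ∀ (x y : Frac r c) → ValidF x → ValidF y → ValidF (x *F y)
      valid-embed : ∀ p → ValidF {r} {c} (embed p)
      embed-nonzero  : ∀ p → ¬ p ≈L 0L → ¬ toField (embed p) ≈ 0#
      embed-nonzero⁻ : ∀ p → ¬ toField (embed p) ≈ 0# → ¬ p ≈L 0L
      clearDenominators : ∀ k (h : Fin k → Carrier) → ∃ λ d → ¬ d ≈L 0L ×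
        ∃ λ (H : Fin k → Laurent r c) → ∀ i → toField (embed (H i)) ≈ toField (embed d) * h i
      Positive         : Carrier → Set
      positive-resp    : ∀ {x y} → x ≈ y → Positive x → Positive y
      positive-1       : Positive 1#
      positive-*       : ∀ {x y} → Positive x → Positive y → Positive (x * y)
      positive-+       : ∀ {x y} → Positive x → Positive y → Positive (x + y)
      positive-/       : ∀ {x y z} → x * y ≈ z → Positive y → Positive z → Positive x
      positive-nonzero : ∀ {x} → Positive x → ¬ x ≈ 0#
      positive-monomial : ∀ e → Positive (toField (embed ((1ℤ , e) ∷ [])))

module RationalFunctions (r c : Data.Nat.Base.ℕ) where
  open RationalFunctionFields
  open import Data.Integer.Base as ℤ using (ℤ; +_; 0ℤ)
  open import Data.List.Base using ([]; _∷_)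
  open import Data.Nat.Base as ℕ using (ℕ; suc)
  open import Data.Product.Base using (∃; _,_)
  open import Relation.Binary.PropositionalEquality as ≡ using (_≡_)

  private module L = LaurentRing r c

  isDomain : IsDiscreteDomain L.commutativeRing
  isDomain = record
    { 1≉0       = L.augmentation-nonzero {1L} (λ ())
    ; ≈0?       = L.≈0?
    ; *-nonzero = λ {p} {q} → L.*-nonzero {p} {q}
    }

  open FractionField L.commutativeRing isDomain public
  open DiscreteField fractionField public hiding (zero)

  PositiveValue : Laurent r c → Set
  PositiveValue p = ∃ λ k → L.augmentation p ≡ + suc k

  private
    positiveValue-* : ∀ p q → PositiveValue p → PositiveValue q → PositiveValue (p *L q)
    positiveValue-* p q (k , e) (l , f) = l ℕ.+ k ℕ.* suc l ,
      ≡.trans (L.augmentation-* p q) (≡.cong₂ ℤ._*_ e f)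

    positiveValue-+ : ∀ p q → PositiveValue p → PositiveValue q → PositiveValue (p +L q)
    positiveValue-+ p q (k , e) (l , f) = k ℕ.+ suc l ,
      ≡.trans (L.eval-+ _ p q) (≡.cong₂ ℤ._+_ e f)

    positiveValue-nonzero : ∀ {p} → PositiveValue p → ¬ p ≈L 0L
    positiveValue-nonzero {p} (k , e) = L.augmentation-nonzero {p} λ z → case (≡.trans (≡.sym z) e)
      where
      case : ∀ {k} → ¬ 0ℤ ≡ + suc k
      case ()

  open PositiveQuotients fractionField (Laurent r c) _+L_ _*L_ 1L embedding PositiveValue public

  isPositiveCone : IsPositiveCone
  isPositiveCone = record
    { ι-+     = embedding-+
    ; ι-*     = embedding-*
    ; ι-1     = refl {embedding 1L}
    ; nonzero = λ {p} pp → embedding-nonzero {p} (positiveValue-nonzero {p} pp)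
    ; P-+     = positiveValue-+
    ; P-*     = positiveValue-*
    ; P-1     = 0 , ≡.refl
    }

  rationalFunctionField : RationalFunctionField r c
  rationalFunctionField = record
    { K                 = fractionField
    ; toField           = toFraction
    ; toField-≈         = λ { (p , q) (p′ , q′) → toFraction-≃ {p} {q} {p′} {q′} }
    ; toField-≈⁻        = λ { (p , q) (p′ , q′) → toFraction-≃⁻ {p} {q} {p′} {q′} }
    ; toField-*         = λ { (p , q) (p′ , q′) → toFraction-* {p} {q} {p′} {q′} }
    ; toField-+         = λ { (p , q) (p′ , q′) → toFraction-+ {p} {q} {p′} {q′} }
    ; toField-0         = toFraction-embedding 0L
    ; toField-1         = toFraction-embedding 1L
    ; valid-*           = λ { (_ , q) (_ , q′) → L.*-nonzero {q} {q′} }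
    ; valid-embed       = λ _ → IsDiscreteDomain.1≉0 isDomain
    ; embed-nonzero     = λ p p≉0 e → embedding-nonzero {p} p≉0
        (trans {embedding p} {toFraction (p , 1L)} {0#} (sym {toFraction (p , 1L)} {embedding p} (toFraction-embedding p)) e)
    ; embed-nonzero⁻    = λ p ≄0 p≈0 → ≄0
        (trans {toFraction (p , 1L)} {embedding p} {0#} (toFraction-embedding p) (embedding-cong {p} {0L} p≈0))
    ; clearDenominators = λ k h → let d , d≉0 , H , e = clearDenominators k h in d , d≉0 , H , λ i →
        trans {toFraction (H i , 1L)} {embedding (H i)} {toFraction (d , 1L) * h i} (toFraction-embedding (H i))
          (trans {embedding (H i)} {embedding d * h i} {toFraction (d , 1L) * h i} (e i)
            (*-congʳ {h i} {embedding d} {toFraction (d , 1L)} (sym {toFraction (d , 1L)} {embedding d} (toFraction-embedding d))))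
    ; Positive          = Positive
    ; positive-resp     = λ {x} {y} → positive-resp isPositiveCone {x} {y}
    ; positive-1        = positive-ι isPositiveCone 1L (0 , ≡.refl)
    ; positive-*        = λ {x} {y} → positive-* isPositiveCone {x} {y}
    ; positive-+        = λ {x} {y} → positive-+ isPositiveCone {x} {y}
    ; positive-/        = λ {x} {y} {z} → positive-/ isPositiveCone {x} {y} {z}
    ; positive-nonzero  = λ {x} → positive-nonzero isPositiveCone {x}
    ; positive-monomial = λ e → let p = (+ 1 , e) ∷ [] in
        positive-resp isPositiveCone {embedding p} {toFraction (p , 1L)}
          (sym {toFraction (p , 1L)} {embedding p} (toFraction-embedding p)) (positive-ι isPositiveCone p (0 , ≡.refl))
    }

open RationalFunctionFields

-- The cube recurrence in the cylinder as a cube strip.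

module Cylinder (n₁ m₁ : Data.Nat.Base.ℕ)
  (𝔽 : RationalFunctionField m₁ (3 Data.Nat.Base.* Data.Nat.Base.suc n₁))
  (F : Vertex → Data.Integer.Base.ℤ → RatFun (Data.Nat.Base.suc m₁) (Data.Nat.Base.suc n₁))
  (isCube : IsCubeRecurrence (Data.Nat.Base.suc m₁) (Data.Nat.Base.suc n₁) F) where

  open IsCubeRecurrence isCube
  open IntegerRemainder
  open import Data.Empty using (⊥-elim)
  open import Data.Integer.Base as ℤ using (ℤ; +_; -[1+_]; 0ℤ; 1ℤ)
  open import Data.Integer.DivMod using (_%ℕ_)
  import Data.Integer.Properties as ℤ
  import Data.Integer.Solver
  open import Data.Nat.Base as ℕ using (ℕ; suc; z≤n; s≤s)
  import Data.Nat.Properties as ℕ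
  open import Data.Product.Base using (∃; ∃₂; _×_; _,_; proj₁; proj₂)
  open import Data.Sum.Base using (inj₁; inj₂)
  open import Relation.Binary.PropositionalEquality as ≡ using (_≡_)
  open import Relation.Nullary using (yes; no)
  open RationalFunctionField 𝔽
  open DiscreteField K hiding (zero)

  open import Relation.Binary.Reasoning.Setoid setoid
  module I = Data.Integer.Solver.+-*-Solver

  n m : ℕ
  n = suc n₁
  m = suc m₁

  vertex : ℕ → ℤ → ℤ → Vertex
  vertex i a b = + i , a ℤ.- b , b ℤ.- (a ℤ.+ + i)

  time : ℕ → ℤ → ℤ → ℤ
  time i a b = a ℤ.+ b ℤ.+ (a ℤ.+ + i)

  value : ℕ → ℤ → ℤ → Carrier
  value i a b = toField (F (vertex i a b) (time i a b))

  vertex∈P₀ : ∀ i a b → InP0 (vertex i a b)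
  vertex∈P₀ i a b = I.solve 3 (λ i a b → i I.:+ (a I.:- b) I.:+ (b I.:- (a I.:+ i)) I.:= I.con 0ℤ) ≡.refl (+ i) a b

  -- The time and the difference of the last two coordinates of the vertex differ by 3 b.
  vertex-color : ∀ i a b → time i a b %ℕ 3 ≡ color (vertex i a b)
  vertex-color i a b = ≡.trans
    (≡.cong (_%ℕ 3) (I.solve 3 (λ i a b → a I.:+ b I.:+ (a I.:+ i) I.:=
      ((a I.:- b) I.:- (b I.:- (a I.:+ i))) I.:+ b I.:* I.con (+ 3)) ≡.refl (+ i) a b))
    (%ℕ-shift ((a ℤ.- b) ℤ.- (b ℤ.- (a ℤ.+ + i))) b 3)

  vertex∈strip : ∀ i a b → i ℕ.≤ m → InStrip m (vertex i a b)
  vertex∈strip i a b i≤m = vertex∈P₀ i a b , ℤ.+≤+ z≤n , ℤ.+≤+ i≤m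

  vertex-valid : ∀ i a b → i ℕ.≤ m → ValidF (F (vertex i a b) (time i a b))
  vertex-valid i a b i≤m = valid _ _ (vertex∈strip i a b i≤m) (vertex-color i a b)

  value-left : ∀ a b → value 0 a b ≈ 1#
  value-left a b = trans (toField-≈ _ 1F (vertex-valid 0 a b z≤n) (valid-embed 1L)
    (boundary _ _ (vertex∈P₀ 0 a b , inj₁ ≡.refl) (vertex-color 0 a b))) toField-1

  value-right : ∀ a b → value m a b ≈ 1#
  value-right a b = trans (toField-≈ _ 1F (vertex-valid m a b ℕ.≤-refl) (valid-embed 1L)
    (boundary _ _ (vertex∈P₀ m a b , inj₂ ≡.refl) (vertex-color m a b))) toField-1

  private
    vertex-≡ : ∀ {i i′ j j′ k k′ : ℤ} → i ≡ i′ → j ≡ j′ → k ≡ k′ → _≡_ {A = Vertex} (i , j , k) (i′ , j′ , k′)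
    vertex-≡ ≡.refl ≡.refl ≡.refl = ≡.refl

    module _ (i : ℕ) (a b : ℤ) where
      open I renaming (solve to isolve)
      private
        eq : ∀ {v v′ t t′} → v ≡ v′ → t ≡ t′ → F v t ≡ F v′ t′
        eq = ≡.cong₂ F
        1I : ∀ {k} → I.Polynomial k
        1I = con 1ℤ

      next-≡ : F (vertex (suc i) a b) (time (suc i) a b ℤ.+ + 3) ≡
        F (vertex (suc i) (1ℤ ℤ.+ a) (1ℤ ℤ.+ b)) (time (suc i) (1ℤ ℤ.+ a) (1ℤ ℤ.+ b))
      next-≡ = eq (vertex-≡ ≡.refl
          (isolve 2 (λ a b → a :- b := (1I :+ a) :- (1I :+ b)) ≡.refl a b)
          (isolve 3 (λ i a b → b :- (a :+ i) := (1I :+ b) :- ((1I :+ a) :+ i)) ≡.refl (+ suc i) a b))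
        (isolve 3 (λ i a b → a :+ b :+ (a :+ i) :+ con (+ 3) :=
          (1I :+ a) :+ (1I :+ b) :+ ((1I :+ a) :+ i)) ≡.refl (+ suc i) a b)

      e12⁺-≡ : F (vertex (suc i) a b +V e12) (time (suc i) a b ℤ.+ + 2) ≡
        F (vertex (2 ℕ.+ i) a (1ℤ ℤ.+ b)) (time (2 ℕ.+ i) a (1ℤ ℤ.+ b))
      e12⁺-≡ = eq (vertex-≡ (isolve 1 (λ i → 1I :+ i :+ 1I := 1I :+ (1I :+ i)) ≡.refl (+ i))
          (isolve 2 (λ a b → a :- b :+ (:- 1I) := a :- (1I :+ b)) ≡.refl a b)
          (isolve 3 (λ i a b → b :- (a :+ (1I :+ i)) :+ con 0ℤ := (1I :+ b) :- (a :+ (1I :+ (1I :+ i)))) ≡.refl (+ i) a b))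
        (isolve 3 (λ i a b → a :+ b :+ (a :+ (1I :+ i)) :+ con (+ 2) :=
          a :+ (1I :+ b) :+ (a :+ (1I :+ (1I :+ i)))) ≡.refl (+ i) a b)

      e12⁻-≡ : F (vertex (suc i) a b -V e12) (time (suc i) a b ℤ.+ 1ℤ) ≡
        F (vertex i (1ℤ ℤ.+ a) b) (time i (1ℤ ℤ.+ a) b)
      e12⁻-≡ = eq (vertex-≡ (isolve 1 (λ i → 1I :+ i :- 1I := i) ≡.refl (+ i))
          (isolve 2 (λ a b → a :- b :- (:- 1I) := (1I :+ a) :- b) ≡.refl a b)
          (isolve 3 (λ i a b → b :- (a :+ (1I :+ i)) :- con 0ℤ := b :- ((1I :+ a) :+ i)) ≡.refl (+ i) a b))
        (isolve 3 (λ i a b → a :+ b :+ (a :+ (1I :+ i)) :+ 1I :=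
          (1I :+ a) :+ b :+ ((1I :+ a) :+ i)) ≡.refl (+ i) a b)

      e23⁺-≡ : F (vertex (suc i) a b +V e23) (time (suc i) a b ℤ.+ + 2) ≡
        F (vertex (suc i) (1ℤ ℤ.+ a) b) (time (suc i) (1ℤ ℤ.+ a) b)
      e23⁺-≡ = eq (vertex-≡ (ℤ.+-identityʳ (+ suc i))
          (isolve 2 (λ a b → a :- b :+ 1I := (1I :+ a) :- b) ≡.refl a b)
          (isolve 3 (λ i a b → b :- (a :+ i) :+ (:- 1I) := b :- ((1I :+ a) :+ i)) ≡.refl (+ suc i) a b))
        (isolve 3 (λ i a b → a :+ b :+ (a :+ i) :+ con (+ 2) :=
          (1I :+ a) :+ b :+ ((1I :+ a) :+ i)) ≡.refl (+ suc i) a b)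

      e23⁻-≡ : F (vertex (suc i) a b -V e23) (time (suc i) a b ℤ.+ 1ℤ) ≡
        F (vertex (suc i) a (1ℤ ℤ.+ b)) (time (suc i) a (1ℤ ℤ.+ b))
      e23⁻-≡ = eq (vertex-≡ (ℤ.+-identityʳ (+ suc i))
          (isolve 2 (λ a b → a :- b :- 1I := a :- (1I :+ b)) ≡.refl a b)
          (isolve 3 (λ i a b → b :- (a :+ i) :- (:- 1I) := (1I :+ b) :- (a :+ i)) ≡.refl (+ suc i) a b))
        (isolve 3 (λ i a b → a :+ b :+ (a :+ i) :+ 1I :=
          a :+ (1I :+ b) :+ (a :+ i)) ≡.refl (+ suc i) a b)

      e31⁺-≡ : F (vertex (suc i) a b +V e31) (time (suc i) a b ℤ.+ + 2) ≡
        F (vertex i (1ℤ ℤ.+ a) (1ℤ ℤ.+ b)) (time i (1ℤ ℤ.+ a) (1ℤ ℤ.+ b))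
      e31⁺-≡ = eq (vertex-≡ (isolve 1 (λ i → 1I :+ i :+ (:- 1I) := i) ≡.refl (+ i))
          (isolve 2 (λ a b → a :- b :+ con 0ℤ := (1I :+ a) :- (1I :+ b)) ≡.refl a b)
          (isolve 3 (λ i a b → b :- (a :+ (1I :+ i)) :+ 1I := (1I :+ b) :- ((1I :+ a) :+ i)) ≡.refl (+ i) a b))
        (isolve 3 (λ i a b → a :+ b :+ (a :+ (1I :+ i)) :+ con (+ 2) :=
          (1I :+ a) :+ (1I :+ b) :+ ((1I :+ a) :+ i)) ≡.refl (+ i) a b)

      e31⁻-≡ : F (vertex (suc i) a b -V e31) (time (suc i) a b ℤ.+ 1ℤ) ≡
        F (vertex (2 ℕ.+ i) a b) (time (2 ℕ.+ i) a b)
      e31⁻-≡ = eq (vertex-≡ (isolve 1 (λ i → 1I :+ i :- (:- 1I) := 1I :+ (1I :+ i)) ≡.refl (+ i))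
          (isolve 2 (λ a b → a :- b :- con 0ℤ := a :- b) ≡.refl a b)
          (isolve 3 (λ i a b → b :- (a :+ (1I :+ i)) :- 1I := b :- (a :+ (1I :+ (1I :+ i)))) ≡.refl (+ i) a b))
        (isolve 3 (λ i a b → a :+ b :+ (a :+ (1I :+ i)) :+ 1I :=
          a :+ b :+ (a :+ (1I :+ (1I :+ i)))) ≡.refl (+ i) a b)

  cubeTerms : ℕ → ℤ → ℤ → Carrier
  cubeTerms i a b =
    value (2 ℕ.+ i) a (1ℤ ℤ.+ b) * value i (1ℤ ℤ.+ a) b +
    (value (suc i) (1ℤ ℤ.+ a) b * value (suc i) a (1ℤ ℤ.+ b) +
     value i (1ℤ ℤ.+ a) (1ℤ ℤ.+ b) * value (2 ℕ.+ i) a b)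

  value-cube : ∀ i a b → suc i ℕ.< m →
    value (suc i) (1ℤ ℤ.+ a) (1ℤ ℤ.+ b) * value (suc i) a b ≈ cubeTerms i a b
  value-cube i a b i<m = begin
    toField f₁ * toField f₀
      ≈⟨ toField-* f₁ f₀ v₁ v₀ ⟨
    toField (f₁ *F f₀)
      ≈⟨ toField-≈ (f₁ *F f₀) ((g₁ *F g₂) +F ((g₃ *F g₄) +F (g₅ *F g₆)))
           (valid-* f₁ f₀ v₁ v₀)
           (valid-* (g₁ *F g₂) ((g₃ *F g₄) +F (g₅ *F g₆)) (valid-* g₁ g₂ w₁ w₂)
             (valid-* (g₃ *F g₄) (g₅ *F g₆) (valid-* g₃ g₄ w₃ w₄) (valid-* g₅ g₆ w₅ w₆))) relation ⟩
    toField ((g₁ *F g₂) +F ((g₃ *F g₄) +F (g₅ *F g₆)))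
      ≈⟨ toField-+ (g₁ *F g₂) ((g₃ *F g₄) +F (g₅ *F g₆)) (valid-* g₁ g₂ w₁ w₂)
           (valid-* (g₃ *F g₄) (g₅ *F g₆) (valid-* g₃ g₄ w₃ w₄) (valid-* g₅ g₆ w₅ w₆)) ⟩
    toField (g₁ *F g₂) + toField ((g₃ *F g₄) +F (g₅ *F g₆))
      ≈⟨ +-cong (toField-* g₁ g₂ w₁ w₂) (trans (toField-+ (g₃ *F g₄) (g₅ *F g₆) (valid-* g₃ g₄ w₃ w₄) (valid-* g₅ g₆ w₅ w₆))
           (+-cong (toField-* g₃ g₄ w₃ w₄) (toField-* g₅ g₆ w₅ w₆))) ⟩
    cubeTerms i a b ∎
    where
    f₀ = F (vertex (suc i) a b) (time (suc i) a b)
    f₁ = F (vertex (suc i) (1ℤ ℤ.+ a) (1ℤ ℤ.+ b)) (time (suc i) (1ℤ ℤ.+ a) (1ℤ ℤ.+ b))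
    g₁ = F (vertex (2 ℕ.+ i) a (1ℤ ℤ.+ b)) (time (2 ℕ.+ i) a (1ℤ ℤ.+ b))
    g₂ = F (vertex i (1ℤ ℤ.+ a) b) (time i (1ℤ ℤ.+ a) b)
    g₃ = F (vertex (suc i) (1ℤ ℤ.+ a) b) (time (suc i) (1ℤ ℤ.+ a) b)
    g₄ = F (vertex (suc i) a (1ℤ ℤ.+ b)) (time (suc i) a (1ℤ ℤ.+ b))
    g₅ = F (vertex i (1ℤ ℤ.+ a) (1ℤ ℤ.+ b)) (time i (1ℤ ℤ.+ a) (1ℤ ℤ.+ b))
    g₆ = F (vertex (2 ℕ.+ i) a b) (time (2 ℕ.+ i) a b)
    i≤m  = ℕ.<⇒≤ i<m
    i₀≤m = ℕ.<⇒≤ i≤m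
    v₀ = vertex-valid (suc i) a b i≤m
    v₁ = vertex-valid (suc i) (1ℤ ℤ.+ a) (1ℤ ℤ.+ b) i≤m
    w₁ = vertex-valid (2 ℕ.+ i) a (1ℤ ℤ.+ b) i<m
    w₂ = vertex-valid i (1ℤ ℤ.+ a) b i₀≤m
    w₃ = vertex-valid (suc i) (1ℤ ℤ.+ a) b i≤m
    w₄ = vertex-valid (suc i) a (1ℤ ℤ.+ b) i≤m
    w₅ = vertex-valid i (1ℤ ℤ.+ a) (1ℤ ℤ.+ b) i₀≤m
    w₆ = vertex-valid (2 ℕ.+ i) a b i<m

    combine : ∀ {f₁ f₀ g₁ g₂ g₃ g₄ g₅ g₆ f₁′ g₁′ g₂′ g₃′ g₄′ g₅′ g₆′ : RatFun m n} →
      f₁ ≡ f₁′ → g₁ ≡ g₁′ → g₂ ≡ g₂′ → g₃ ≡ g₃′ → g₄ ≡ g₄′ → g₅ ≡ g₅′ → g₆ ≡ g₆′ →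
      (f₁ *F f₀) ≈F ((g₁ *F g₂) +F ((g₃ *F g₄) +F (g₅ *F g₆))) →
      (f₁′ *F f₀) ≈F ((g₁′ *F g₂′) +F ((g₃′ *F g₄′) +F (g₅′ *F g₆′)))
    combine ≡.refl ≡.refl ≡.refl ≡.refl ≡.refl ≡.refl ≡.refl h = h

    relation : (f₁ *F f₀) ≈F ((g₁ *F g₂) +F ((g₃ *F g₄) +F (g₅ *F g₆)))
    relation = combine {f₀ = f₀} (next-≡ i a b) (e12⁺-≡ i a b) (e12⁻-≡ i a b) (e23⁺-≡ i a b)
      (e23⁻-≡ i a b) (e31⁺-≡ i a b) (e31⁻-≡ i a b)
      (recur (vertex (suc i) a b) (time (suc i) a b)
        (vertex∈P₀ (suc i) a b , ℤ.+<+ (s≤s z≤n) , ℤ.+<+ i<m) (vertex-color (suc i) a b))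

  -- Induction on time.

  module _ (P : ℕ → ℤ → ℤ → Set) (P-left : ∀ a b → P 0 a b) (P-right : ∀ a b → P m a b)
    (P-initial : ∀ i a b → suc i ℕ.< m → time (suc i) a b ≡ + color (vertex (suc i) a b) → P (suc i) a b)
    (P-step : ∀ i a b → suc i ℕ.< m → P (suc i) a b →
      P (2 ℕ.+ i) a (1ℤ ℤ.+ b) → P i (1ℤ ℤ.+ a) b →
      P (suc i) (1ℤ ℤ.+ a) b → P (suc i) a (1ℤ ℤ.+ b) →
      P i (1ℤ ℤ.+ a) (1ℤ ℤ.+ b) → P (2 ℕ.+ i) a b →
      P (suc i) (1ℤ ℤ.+ a) (1ℤ ℤ.+ b)) where

    private
      At : ℕ → Set
      At s = ∀ i a b → i ℕ.≤ m → time i a b ≡ + s → P i a b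

      at-start : ∀ s → s ℕ.< 3 → At s
      at-start s s<3 ℕ.zero  a b _   e = P-left a b
      at-start s s<3 (suc i) a b i≤m e with ℕ.m≤n⇒m<n∨m≡n i≤m
      ... | inj₂ ≡.refl = P-right a b
      ... | inj₁ i<m    = P-initial i a b i<m (≡.trans e (≡.cong +_ (≡.trans (≡.sym (m<n⇒m%n≡m s<3))
        (≡.trans (≡.cong (_%ℕ 3) (≡.sym e)) (vertex-color (suc i) a b)))))
        where open import Data.Nat.DivMod using (m<n⇒m%n≡m)

      -- The recurrence is used at (i, a - 1, b - 1), which lies 3 earlier; the six neighbours lie 1
      -- or 2 earlier. As these steps can leave the naturals, a and b are integers here.
      at-next : ∀ s → At s → At (1 ℕ.+ s) → At (2 ℕ.+ s) → At (3 ℕ.+ s)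
      at-next s p₀ p₁ p₂ ℕ.zero  a b _   e = P-left a b
      at-next s p₀ p₁ p₂ (suc i) a b i≤m e with ℕ.m≤n⇒m<n∨m≡n i≤m
      ... | inj₂ ≡.refl = P-right a b
      ... | inj₁ i<m    = ≡.subst₂ (P (suc i)) (suc-pred a) (suc-pred b)
        (P-step i a′ b′ i<m
          (p₀ _ _ _ i≤m  (at 3 (isolve 3 (λ i a b → T (1I :+ i) (p a) (p b) := T (1I :+ i) a b :- con (+ 3)) ≡.refl (+ i) a b)))
          (p₂ _ _ _ i<m  (at 1 (isolve 3 (λ i a b → T (1I :+ (1I :+ i)) (p a) (1I :+ p b) := T (1I :+ i) a b :- con (+ 1)) ≡.refl (+ i) a b)))
          (p₁ _ _ _ i₀≤m (at 2 (isolve 3 (λ i a b → T i (1I :+ p a) (p b) := T (1I :+ i) a b :- con (+ 2)) ≡.refl (+ i) a b)))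
          (p₂ _ _ _ i≤m  (at 1 (isolve 3 (λ i a b → T (1I :+ i) (1I :+ p a) (p b) := T (1I :+ i) a b :- con (+ 1)) ≡.refl (+ i) a b)))
          (p₁ _ _ _ i≤m  (at 2 (isolve 3 (λ i a b → T (1I :+ i) (p a) (1I :+ p b) := T (1I :+ i) a b :- con (+ 2)) ≡.refl (+ i) a b)))
          (p₂ _ _ _ i₀≤m (at 1 (isolve 3 (λ i a b → T i (1I :+ p a) (1I :+ p b) := T (1I :+ i) a b :- con (+ 1)) ≡.refl (+ i) a b)))
          (p₁ _ _ _ i<m  (at 2 (isolve 3 (λ i a b → T (1I :+ (1I :+ i)) (p a) (p b) := T (1I :+ i) a b :- con (+ 2)) ≡.refl (+ i) a b))))
        where
        open I renaming (solve to isolve)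
        1I : ∀ {k} → I.Polynomial k
        1I = con 1ℤ
        p : ∀ {k} → I.Polynomial k → I.Polynomial k
        p x = x :- 1I
        T : ∀ {k} → (i a b : I.Polynomial k) → I.Polynomial k
        T i a b = a :+ b :+ (a :+ i)
        a′ = a ℤ.- 1ℤ
        b′ = b ℤ.- 1ℤ
        i₀≤m = ℕ.<⇒≤ i≤m
        suc-pred : ∀ x → 1ℤ ℤ.+ (x ℤ.- 1ℤ) ≡ x
        suc-pred x = isolve 1 (λ x → 1I :+ (x :- 1I) := x) ≡.refl x
        at : ∀ k {x} → x ≡ time (suc i) a b ℤ.- + k → x ≡ + (3 ℕ.+ s) ℤ.- + k
        at k q = ≡.trans q (≡.cong (λ t → t ℤ.- + k) e)

      at-three : ∀ s → At s × At (1 ℕ.+ s) × At (2 ℕ.+ s)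
      at-three ℕ.zero  = at-start 0 (s≤s z≤n) , at-start 1 (s≤s (s≤s z≤n)) , at-start 2 (s≤s (s≤s (s≤s z≤n)))
      at-three (suc s) = let p₀ , p₁ , p₂ = at-three s in p₁ , p₂ , at-next s p₀ p₁ p₂

    time-induction : ∀ s i a b → i ℕ.≤ m → time i a b ≡ + s → P i a b
    time-induction s = proj₁ (at-three s)

  value-initial : ∀ i a b → suc i ℕ.< m → time (suc i) a b ≡ + color (vertex (suc i) a b) →
    value (suc i) a b ≈ toField (embed (var m n (vertex (suc i) a b)))
  value-initial i a b i<m e = toField-≈ _ (embed (var m n v)) (vertex-valid (suc i) a b (ℕ.<⇒≤ i<m)) (valid-embed (var m n v))
    (≡.subst (λ t → F v t ≈F embed (var m n v)) (≡.sym e)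
      (initial v (vertex∈P₀ (suc i) a b , ℤ.+<+ (s≤s z≤n) , ℤ.+<+ i<m)))
    where v = vertex (suc i) a b

  -- The shift (a + n, b - 2 n) keeps the time and moves the vertex by 3 g. Positivity and
  -- periodicity are proved together, since the induction for the latter cancels an earlier value,
  -- which positivity shows to be nonzero.
  Good : ℕ → ℤ → ℤ → Set
  Good i a b = Positive (value i a b) × value i (+ n ℤ.+ a) (b ℤ.- + (2 ℕ.* n)) ≈ value i a b

  good : ∀ s i a b → i ℕ.≤ m → time i a b ≡ + s → Good i a b
  good = time-induction Good
    (λ a b → positive-resp (sym (value-left a b)) positive-1 , trans (value-left (+ n ℤ.+ a) (b ℤ.- + (2 ℕ.* n))) (sym (value-left a b)))
    (λ a b → positive-resp (sym (value-right a b)) positive-1 , trans (value-right (+ n ℤ.+ a) (b ℤ.- + (2 ℕ.* n))) (sym (value-right a b)))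
    base step
    where
    open I renaming (solve to isolve)
    1I : ∀ {k} → I.Polynomial k
    1I = con 1ℤ

    base : ∀ i a b → suc i ℕ.< m → time (suc i) a b ≡ + color (vertex (suc i) a b) → Good (suc i) a b
    base i a b i<m e =
      positive-resp (sym (value-initial i a b i<m e)) (positive-monomial _) ,
      trans (value-initial i a₀ b₀ i<m time-color)
        (trans (reflexive (≡.cong (λ j → toField (embed ((1ℤ , unitExp i j) ∷ []))) same-variable))
          (sym (value-initial i a b i<m e)))
      where
      open import Data.List.Base using ([]; _∷_)
      a₀ = + n ℤ.+ a
      b₀ = b ℤ.- + (2 ℕ.* n)
      same-time : time (suc i) a₀ b₀ ≡ time (suc i) a b
      same-time = isolve 4 (λ n i a b → (n :+ a) :+ (b :- (n :+ (n :+ con 0ℤ))) :+ ((n :+ a) :+ i) :=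
        a :+ b :+ (a :+ i)) ≡.refl (+ n) (+ suc i) a b
      time-color : time (suc i) a₀ b₀ ≡ + color (vertex (suc i) a₀ b₀)
      time-color = ≡.trans same-time (≡.trans e (≡.cong +_ (≡.trans (≡.sym (vertex-color (suc i) a b))
        (≡.trans (≡.cong (_%ℕ 3) (≡.sym same-time)) (vertex-color (suc i) a₀ b₀)))))
      same-variable : (a₀ ℤ.- b₀) %ℕ suc (3 ℕ.* n ℕ.∸ 1) ≡ (a ℤ.- b) %ℕ suc (3 ℕ.* n ℕ.∸ 1)
      same-variable = ≡.trans (≡.cong (_%ℕ (3 ℕ.* n))
        (isolve 3 (λ n a b → (n :+ a) :- (b :- (n :+ (n :+ con 0ℤ))) := (a :- b) :+ con 1ℤ :* (n :+ (n :+ (n :+ con 0ℤ))))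
          ≡.refl (+ n) a b))
        (%ℕ-shift (a ℤ.- b) 1ℤ (3 ℕ.* n))

    step : ∀ i a b → suc i ℕ.< m → Good (suc i) a b →
      Good (2 ℕ.+ i) a (1ℤ ℤ.+ b) → Good i (1ℤ ℤ.+ a) b →
      Good (suc i) (1ℤ ℤ.+ a) b → Good (suc i) a (1ℤ ℤ.+ b) →
      Good i (1ℤ ℤ.+ a) (1ℤ ℤ.+ b) → Good (2 ℕ.+ i) a b →
      Good (suc i) (1ℤ ℤ.+ a) (1ℤ ℤ.+ b)
    step i a b i<m (p₀ , e₀) (p₁ , e₁) (p₂ , e₂) (p₃ , e₃) (p₄ , e₄) (p₅ , e₅) (p₆ , e₆) =
      positive-/ (value-cube i a b i<m) p₀
        (positive-+ (positive-* p₁ p₂) (positive-+ (positive-* p₃ p₄) (positive-* p₅ p₆))) ,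
      *-cancelˡ (positive-nonzero p₀) (begin
        value (suc i) a b * value (suc i) a₁ b₁
          ≈⟨ *-congʳ e₀ ⟨
        value (suc i) a₀ b₀ * value (suc i) a₁ b₁
          ≈⟨ *-comm _ _ ⟩
        value (suc i) a₁ b₁ * value (suc i) a₀ b₀
          ≈⟨ shifted ⟩
        value (2 ℕ.+ i) a₀ b₁ * value i a₁ b₀ +
          (value (suc i) a₁ b₀ * value (suc i) a₀ b₁ + value i a₁ b₁ * value (2 ℕ.+ i) a₀ b₀)
          ≈⟨ +-cong (*-cong e₁ e₂) (+-cong (*-cong e₃ e₄) (*-cong e₅ e₆)) ⟩
        cubeTerms i a b
          ≈⟨ value-cube i a b i<m ⟨
        value (suc i) (1ℤ ℤ.+ a) (1ℤ ℤ.+ b) * value (suc i) a b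
          ≈⟨ *-comm _ _ ⟩
        value (suc i) a b * value (suc i) (1ℤ ℤ.+ a) (1ℤ ℤ.+ b) ∎)
      where
      a₀ = + n ℤ.+ a
      b₀ = b ℤ.- + (2 ℕ.* n)
      a₁ = + n ℤ.+ (1ℤ ℤ.+ a)
      b₁ = (1ℤ ℤ.+ b) ℤ.- + (2 ℕ.* n)
      shifted = ≡.subst₂ (λ a₁ b₁ → value (suc i) a₁ b₁ * value (suc i) a₀ b₀ ≈
          value (2 ℕ.+ i) a₀ b₁ * value i a₁ b₀ +
          (value (suc i) a₁ b₀ * value (suc i) a₀ b₁ + value i a₁ b₁ * value (2 ℕ.+ i) a₀ b₀))
        (isolve 2 (λ n a → 1I :+ (n :+ a) := n :+ (1I :+ a)) ≡.refl (+ n) a)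
        (isolve 2 (λ n b → 1I :+ (b :- n) := (1I :+ b) :- n) ≡.refl (+ (2 ℕ.* n)) b)
        (value-cube i a₀ b₀ i<m)

  φ : ℕ → ℕ → ℕ → Carrier
  φ i a b with i ℕ.≤? m
  ... | yes _ = value i (+ a) (+ b)
  ... | no _  = 0#

  φ-value : ∀ {i} a b → i ℕ.≤ m → φ i a b ≡ value i (+ a) (+ b)
  φ-value {i} a b i≤m with i ℕ.≤? m
  ... | yes _  = ≡.refl
  ... | no i≰m = ⊥-elim (i≰m i≤m)

  φ-outside : ∀ a b → φ (suc m) a b ≡ 0#
  φ-outside a b with suc m ℕ.≤? m
  ... | yes 1+m≤m = ⊥-elim (ℕ.1+n≰n 1+m≤m)
  ... | no _      = ≡.refl

  φ-good : ∀ i a b → i ℕ.≤ m → Good i (+ a) (+ b)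
  φ-good i a b i≤m = good _ i (+ a) (+ b) i≤m ≡.refl

  φ-period : ∀ i → i ℕ.≤ m → ∀ a b → φ i (n ℕ.+ a) b ≈ φ i a (2 ℕ.* n ℕ.+ b)
  φ-period i i≤m a b = begin
    φ i (n ℕ.+ a) b                                 ≡⟨ φ-value (n ℕ.+ a) b i≤m ⟩
    value i (+ n ℤ.+ + a) (+ b)                     ≡⟨ ≡.cong (value i (+ n ℤ.+ + a))
      (I.solve 2 (λ n b → (n I.:+ b) I.:- n I.:= b) ≡.refl (+ (2 ℕ.* n)) (+ b)) ⟨
    value i (+ n ℤ.+ + a) (+ (2 ℕ.* n ℕ.+ b) ℤ.- + (2 ℕ.* n)) ≈⟨ proj₂ (φ-good i a (2 ℕ.* n ℕ.+ b) i≤m) ⟩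
    value i (+ a) (+ (2 ℕ.* n ℕ.+ b))               ≡⟨ φ-value a (2 ℕ.* n ℕ.+ b) i≤m ⟨
    φ i a (2 ℕ.* n ℕ.+ b)                           ∎

  open CubeStrip K
  open RingSolver commutativeRing

  φ-left : ∀ a b → φ 0 a b ≈ 1#
  φ-left a b = trans (reflexive (φ-value a b z≤n)) (value-left (+ a) (+ b))

  φ-right : ∀ a b → φ m a b ≈ 1#
  φ-right a b = trans (reflexive (φ-value a b ℕ.≤-refl)) (value-right (+ a) (+ b))

  isCubeStrip : IsCubeStrip m φ
  isCubeStrip = record
    { left    = φ-left
    ; outside = λ a b → reflexive (φ-outside a b)
    ; nonzero = λ i a b i≤m e → positive-nonzero (proj₁ (φ-good i a b i≤m)) (trans (reflexive (≡.sym (φ-value a b i≤m))) e)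
    ; cube    = cube
    }
    where
    cube : ∀ i a b → suc i ℕ.≤ m →
      φ (suc i) a b * φ (suc i) (suc a) (suc b) ≈
        φ (suc i) a (suc b) * φ (suc i) (suc a) b + φ i (suc a) b * φ (2 ℕ.+ i) a (suc b) +
        φ (2 ℕ.+ i) a b * φ i (suc a) (suc b)
    cube i a b i≤m with ℕ.m≤n⇒m<n∨m≡n i≤m
    -- At the right boundary no recurrence is given. The equation reads 1 = 1 there, because the two
    -- products involving i = m + 1 vanish.
    ... | inj₂ ≡.refl = begin
      φ m a b * φ m (suc a) (suc b)
        ≈⟨ *-cong (φ-right a b) (φ-right (suc a) (suc b)) ⟩
      1# * 1#
        ≈⟨ solve 2 (λ x y → :1 :* :1 := :1 :* :1 :+ x :* :0 :+ :0 :* y) refl _ _ ⟩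
      1# * 1# + φ i (suc a) b * 0# + 0# * φ i (suc a) (suc b)
        ≈⟨ +-cong (+-cong (*-cong (φ-right a (suc b)) (φ-right (suc a) b)) (*-congˡ (reflexive (φ-outside a (suc b)))))
             (*-congʳ (reflexive (φ-outside a b))) ⟨
      φ m a (suc b) * φ m (suc a) b + φ i (suc a) b * φ (suc m) a (suc b) + φ (suc m) a b * φ i (suc a) (suc b) ∎
    ... | inj₁ i<m = begin
      φ (suc i) a b * φ (suc i) (suc a) (suc b)
        ≡⟨ ≡.cong₂ _*_ (φ-value a b i≤m) (φ-value (suc a) (suc b) i≤m) ⟩
      value (suc i) (+ a) (+ b) * value (suc i) (+ suc a) (+ suc b)
        ≈⟨ trans (*-comm _ _) (value-cube i (+ a) (+ b) i<m) ⟩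
      cubeTerms i (+ a) (+ b)
        ≈⟨ solve 6 (λ x₁ x₂ x₃ x₄ x₅ x₆ → x₁ :* x₂ :+ (x₃ :* x₄ :+ x₅ :* x₆) := x₄ :* x₃ :+ x₂ :* x₁ :+ x₆ :* x₅)
             refl _ _ _ _ _ _ ⟩
      value (suc i) (+ a) (+ suc b) * value (suc i) (+ suc a) (+ b) +
        value i (+ suc a) (+ b) * value (2 ℕ.+ i) (+ a) (+ suc b) +
        value (2 ℕ.+ i) (+ a) (+ b) * value i (+ suc a) (+ suc b)
        ≡⟨ ≡.cong₂ _+_ (≡.cong₂ _+_ (≡.cong₂ _*_ (φ-value a (suc b) i≤m) (φ-value (suc a) b i≤m))
             (≡.cong₂ _*_ (φ-value (suc a) b i₀≤m) (φ-value a (suc b) i<m)))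
             (≡.cong₂ _*_ (φ-value a b i<m) (φ-value (suc a) (suc b) i₀≤m)) ⟨
      φ (suc i) a (suc b) * φ (suc i) (suc a) b + φ i (suc a) b * φ (2 ℕ.+ i) a (suc b) +
        φ (2 ℕ.+ i) a b * φ i (suc a) (suc b) ∎
      where i₀≤m = ℕ.<⇒≤ i≤m

  -- The recurrence with Laurent polynomial coefficients.

  open LinearRecurrence K
  open Solution isCubeStrip using (basis; φ-span)
  open import Data.Fin.Base as Fin using (Fin; toℕ; fromℕ)
  open import Data.Nat.DivMod using (_/_; m≡m%n+[m/n]*n)
  open import Data.Nat.Solver using (module +-*-Solver)

  toField-sum : ∀ k (f : Fin k → RatFun m n) → (∀ i → ValidF (f i)) →
    ValidF (sumF k f) × toField (sumF k f) ≈ sumFin k (λ i → toField (f i))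
  toField-sum ℕ.zero  f v = valid-embed 0L , toField-0
  toField-sum (suc k) f v =
    let w , e = toField-sum k (λ i → f (Fin.suc i)) (λ i → v (Fin.suc i))
    in valid-* (f Fin.zero) (sumF k (λ i → f (Fin.suc i))) (v Fin.zero) w ,
       trans (toField-+ (f Fin.zero) (sumF k (λ i → f (Fin.suc i))) (v Fin.zero) w) (+-congˡ e)

  sumFin-cong : ∀ k {f g : Fin k → Carrier} → (∀ i → f i ≈ g i) → sumFin k f ≈ sumFin k g
  sumFin-cong ℕ.zero  e = refl
  sumFin-cong (suc k) e = +-cong (e Fin.zero) (sumFin-cong k λ i → e (Fin.suc i))

  sumFin-scale : ∀ k d (f : Fin k → Carrier) → sumFin k (λ i → d * f i) ≈ d * sumFin k f
  sumFin-scale ℕ.zero  d f = sym (zeroʳ d)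
  sumFin-scale (suc k) d f = trans (+-congˡ (sumFin-scale k d (λ i → f (Fin.suc i)))) (sym (distribˡ d _ _))

  LaurentRecurrence : Vertex → Set
  LaurentRecurrence v = ∃ λ M → ∃ λ (H : Fin (suc M) → Ring m n) →
    ¬ (H Fin.zero ≈L 0L) × ¬ (H (fromℕ M) ≈L 0L) × ∃ λ T → ∀ t → T ℕ.≤ t →
      sumF (suc M) (λ i → embed (H i) *F F v (+ (color v ℕ.+ 3 ℕ.* (t ℕ.+ toℕ i)))) ≈F 0F

  vertex-recurrence : ∀ i a b → i ℕ.≤ m → LaurentRecurrence (vertex i (+ a) (+ b))
  vertex-recurrence i a b i≤m =
    let k , M , h , first , last , relation =
          diagonal-recurrence (φ i) n₁ (φ-period i i≤m) (basis i) (λ a → φ-span i a i≤m) a b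
        d , d≉0 , H , clear = clearDenominators (suc M) h
        D = toField (embed d)
        nonzero : ∀ j → ¬ h j ≈ 0# → ¬ (H j ≈L 0L)
        nonzero j hj≉0 = embed-nonzero⁻ (H j) λ e →
          *-nonzero (embed-nonzero d d≉0) hj≉0 (trans (sym (clear j)) e)
        sequence : ∀ t′ (j : Fin (suc M)) →
          toField (F v (+ (color v ℕ.+ 3 ℕ.* (q ℕ.+ k ℕ.+ t′ ℕ.+ toℕ j)))) ≡
          φ i (t′ ℕ.+ (k ℕ.+ toℕ j) ℕ.+ a) (t′ ℕ.+ (k ℕ.+ toℕ j) ℕ.+ b)
        sequence t′ j = ≡.trans (≡.cong toField (F-shift (t′ ℕ.+ (k ℕ.+ toℕ j)) _ (index k t′ (toℕ j))))
          (≡.sym (φ-value _ _ i≤m))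
        vanish : ∀ t′ → sumF (suc M) (λ j → embed (H j) *F F v (+ (color v ℕ.+ 3 ℕ.* (q ℕ.+ k ℕ.+ t′ ℕ.+ toℕ j)))) ≈F 0F
        vanish t′ =
          let g : Fin (suc M) → RatFun m n
              g j = F v (+ (color v ℕ.+ 3 ℕ.* (q ℕ.+ k ℕ.+ t′ ℕ.+ toℕ j)))
              f = λ j → embed (H j) *F g j
              valid′ : ∀ j → ValidF (g j)
              valid′ j = F-valid (t′ ℕ.+ (k ℕ.+ toℕ j)) _ (index k t′ (toℕ j))
              w , e = toField-sum (suc M) f (λ j → valid-* (embed (H j)) (g j) (valid-embed (H j)) (valid′ j))
          in toField-≈⁻ (sumF (suc M) f) 0F w (valid-embed 0L) (begin
            toField (sumF (suc M) f)
              ≈⟨ e ⟩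
            sumFin (suc M) (λ j → toField (f j))
              ≈⟨ sumFin-cong (suc M) (λ j → trans (toField-* (embed (H j)) (g j) (valid-embed (H j)) (valid′ j))
                   (trans (*-cong (clear j) (reflexive (sequence t′ j))) (*-assoc _ _ _))) ⟩
            sumFin (suc M) (λ j → D * (h j * φ i (t′ ℕ.+ (k ℕ.+ toℕ j) ℕ.+ a) (t′ ℕ.+ (k ℕ.+ toℕ j) ℕ.+ b)))
              ≈⟨ sumFin-scale (suc M) D (λ j → h j * φ i (t′ ℕ.+ (k ℕ.+ toℕ j) ℕ.+ a) (t′ ℕ.+ (k ℕ.+ toℕ j) ℕ.+ b)) ⟩
            D * sumFin (suc M) (λ j → h j * φ i (t′ ℕ.+ (k ℕ.+ toℕ j) ℕ.+ a) (t′ ℕ.+ (k ℕ.+ toℕ j) ℕ.+ b))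
              ≈⟨ *-congˡ (relation t′) ⟩
            D * 0#
              ≈⟨ zeroʳ D ⟩
            0#
              ≈⟨ toField-0 ⟨
            toField 0F ∎)
    -- The naturals a and b place the vertex at time τ₀ = color v + 3 q, so φ covers the sequence
    -- only from index q on; k is the shift caused by removing leading zero coefficients.
    in M , H , nonzero Fin.zero first , nonzero (fromℕ M) last , q ℕ.+ k , λ t T≤t →
       ≡.subst (λ t → sumF (suc M) (λ j → embed (H j) *F F v (+ (color v ℕ.+ 3 ℕ.* (t ℕ.+ toℕ j)))) ≈F 0F)
         (ℕ.m+[n∸m]≡n T≤t) (vanish (t ℕ.∸ (q ℕ.+ k)))
    where
    open +-*-Solver renaming (solve to solve′; _:+_ to _⊕_; _:*_ to _⊗_; _:=_ to _⊜_; con to con′)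
    v = vertex i (+ a) (+ b)
    τ₀ q : ℕ
    τ₀ = a ℕ.+ b ℕ.+ (a ℕ.+ i)
    q  = τ₀ / 3

    τ₀-color : τ₀ ≡ color v ℕ.+ q ℕ.* 3
    τ₀-color = ≡.trans (m≡m%n+[m/n]*n τ₀ 3) (≡.cong (ℕ._+ q ℕ.* 3) (vertex-color i (+ a) (+ b)))

    index : ∀ k t j → color v ℕ.+ 3 ℕ.* (q ℕ.+ k ℕ.+ t ℕ.+ j) ≡ τ₀ ℕ.+ 3 ℕ.* (t ℕ.+ (k ℕ.+ j))
    index k t j = ≡.trans
      (solve′ 5 (λ c q k t j → c ⊕ con′ 3 ⊗ (q ⊕ k ⊕ t ⊕ j) ⊜ c ⊕ q ⊗ con′ 3 ⊕ con′ 3 ⊗ (t ⊕ (k ⊕ j))) ≡.refl (color v) q k t j)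
      (≡.cong (ℕ._+ 3 ℕ.* (t ℕ.+ (k ℕ.+ j))) (≡.sym τ₀-color))

    F-shift : ∀ s τ → τ ≡ τ₀ ℕ.+ 3 ℕ.* s →
      F v (+ τ) ≡ F (vertex i (+ (s ℕ.+ a)) (+ (s ℕ.+ b))) (time i (+ (s ℕ.+ a)) (+ (s ℕ.+ b)))
    F-shift s τ e = ≡.cong₂ F
      (vertex-≡ ≡.refl
        (I.solve 3 (λ s a b → a I.:- b I.:= (s I.:+ a) I.:- (s I.:+ b)) ≡.refl (+ s) (+ a) (+ b))
        (I.solve 4 (λ i s a b → b I.:- (a I.:+ i) I.:= (s I.:+ b) I.:- ((s I.:+ a) I.:+ i)) ≡.refl (+ i) (+ s) (+ a) (+ b)))
      (≡.cong +_ (≡.trans e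
        (solve′ 4 (λ s a b i → a ⊕ b ⊕ (a ⊕ i) ⊕ con′ 3 ⊗ s ⊜ (s ⊕ a) ⊕ (s ⊕ b) ⊕ ((s ⊕ a) ⊕ i)) ≡.refl s a b i)))

    F-valid : ∀ s τ → τ ≡ τ₀ ℕ.+ 3 ℕ.* s → ValidF (F v (+ τ))
    F-valid s τ e = ≡.subst ValidF (≡.sym (F-shift s τ e)) (vertex-valid i (+ (s ℕ.+ a)) (+ (s ℕ.+ b)) i≤m)

  -- For either sign of j there are naturals a and b with j = a - b, and then the last coordinate is
  -- forced by the sum being zero.
  strip-recurrence : ∀ v → InStrip m v → LaurentRecurrence v
  strip-recurrence (+ i , j , k) (P₀ , _ , ℤ.+≤+ i≤m) with difference j
    where
    difference : ∀ j → ∃₂ λ a b → j ≡ + a ℤ.- + b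
    difference (+ x)    = x , 0 , ≡.sym (ℤ.+-identityʳ (+ x))
    difference -[1+ x ] = 0 , suc x , ≡.refl
  ... | a , b , ≡.refl = ≡.subst (λ k → LaurentRecurrence (+ i , + a ℤ.- + b , k)) (≡.sym k≡) (vertex-recurrence i a b i≤m)
    where
    k≡ : k ≡ + b ℤ.- (+ a ℤ.+ + i)
    k≡ = ≡.trans (I.solve 4 (λ i a b k → k I.:= (i I.:+ (a I.:- b) I.:+ k) I.:+ (b I.:- (a I.:+ i))) ≡.refl (+ i) (+ a) (+ b) k)
      (≡.trans (≡.cong (ℤ._+ (+ b ℤ.- (+ a ℤ.+ + i))) P₀) (ℤ.+-identityˡ _))

open import Data.Nat using (ℕ; suc; _+_; _*_; _≤_)
open import Data.Integer using (ℤ; +_)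
open import Data.Fin using (Fin; zero; fromℕ; toℕ)
open import Data.Product using (Σ; _×_)
open import Relation.Nullary using (¬_)

theorem2p5 : (n m : ℕ) → 1 ≤ n → 2 ≤ m →
    (F : Vertex → ℤ → RatFun m n) → IsCubeRecurrence m n F →
    (v : Vertex) → InStrip m v →
    Σ ℕ λ M → Σ (Fin (suc M) → Ring m n) λ H →
      ¬ (H zero ≈L 0L) × ¬ (H (fromℕ M) ≈L 0L) ×
      Σ ℕ λ T → (t : ℕ) → T ≤ t →
        sumF (suc M) (λ i → embed (H i) *F F v (+ (color v + 3 * (t + toℕ i)))) ≈F 0F
theorem2p5 (suc n₁) (suc m₁) _ _ F isCube v v∈strip =
  Cylinder.strip-recurrence n₁ m₁ (RationalFunctions.rationalFunctionField m₁ (3 * suc n₁)) F isCube v v∈strip
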